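{- Let $s\ge 2$, $m\ge 1$ and $1\le l\le s$ be integers and put $n=sm+s-l$. Then $e(n,s)=|\mathcal P(s,m,l)|$ holds in each of the following cases: (i) $l=2$ and $s\ge 5$; also $l=2$, $s=4$ and $m$ even; (ii) $m=1$; (iii) $s\ge lm+3l+3$.
   Context: For a family $\mathcal F\subset 2^{[n]}$, a sequence $F_1,\dots,F_s$ of members of $\mathcal F$ is called pairwise disjoint if $F_i\cap F_j=\emptyset$ for all $i\neq j$ (so members can coincide only if they are empty; in particular if $\emptyset\in\mathcal F$ then $\mathcal F$ contains arbitrarily many pairwise disjoint members). The matching number $\nu(\mathcal F)$ is the maximum number of pairwise disjoint members of $\mathcal F$. For $n\ge s\ge 2$, $e(n,s):=\max\{|\mathcal F|:\mathcal F\subset 2^{[n]},\ \nu(\mathcal F)<s\}$. For $n=sm+s-l$ with $0<l\le s$, $\mathcal P(s,m,l):=\{P\subset[n]: |P|+|P\cap[l-1]|\ge m+1\}$, where $[l-1]=\{1,\dots,l-1\}$ (empty if $l=1$). -}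

module Defs where

open import Data.Nat using (ℕ; zero; suc; _+_; _*_; _∸_; _≤_; _<_; _≤?_; _<?_)
open import Data.Nat.Divisibility using (_∣_)
open import Data.Bool using (Bool; true; false)
open import Data.Fin using (Fin; toℕ)
open import Data.Fin.Subset using (Subset; _∩_; Empty; ∣_∣; ⁅_⁆; ⊥; _∈_)
open import Data.Vec using (Vec; []; _∷_; tabulate)
open import Data.List using (List; []; _∷_; map; _++_; filter; length)
import Data.List.Membership.Propositional as LM
open import Data.List.Relation.Unary.Unique.Propositional using (Unique)
open import Data.Product using (Σ; _×_; _,_)
open import Data.Sum using (_⊎_)
open import Relation.Nullary using (¬_)
open import Relation.Binary.PropositionalEquality using (_≡_; _≢_)

-- A family F ⊂ 2^[n] is a duplicate-free list of subsets of [n] (= Fin n);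
-- its cardinality |F| is the length of the list.

-- F contains s pairwise disjoint members F_1,…,F_s (a sequence indexed by Fin s;
-- members may coincide only if they are empty, forced by disjointness).
HasDisjoint : {n : ℕ} → List (Subset n) → ℕ → Set
HasDisjoint {n} F s =
  Σ (Fin s → Subset n) λ G →
    ((i : Fin s) → G i LM.∈ F) ×
    ((i j : Fin s) → i ≢ j → Empty (G i ∩ G j))

NuLess : {n : ℕ} → List (Subset n) → ℕ → Set
NuLess F s = ¬ HasDisjoint F s

IsE : ℕ → ℕ → ℕ → Set
IsE n s k =
  (Σ (List (Subset n)) λ F → Unique F × NuLess F s × length F ≡ k) ×
  ((F : List (Subset n)) → Unique F → NuLess F s → length F ≤ k)

allSubsets : (n : ℕ) → List (Subset n)
allSubsets zero = [] ∷ []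
allSubsets (suc n) = map (false ∷_) (allSubsets n) ++ map (true ∷_) (allSubsets n)

-- [l-1] = {1,…,l-1} as a subset of [n]; element i : Fin n stands for toℕ i + 1.
initSeg : (n l : ℕ) → Subset n
initSeg n l = tabulate λ (i : Fin n) → Data.Nat._<ᵇ_ (suc (toℕ i)) l

PFam : (s m l : ℕ) → List (Subset (s * m + (s ∸ l)))
PFam s m l = filter (λ P → suc m ≤? ∣ P ∣ + ∣ P ∩ initSeg (s * m + (s ∸ l)) l ∣)
                    (allSubsets (s * m + (s ∸ l)))

Cases : ℕ → ℕ → ℕ → Set
Cases s m l =
  (l ≡ 2 × 5 ≤ s) ⊎ (l ≡ 2 × s ≡ 4 × 2 ∣ m) ⊎ (m ≡ 1) ⊎ (l * m + 3 * l + 3 ≤ s)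

{-# OPTIONS --safe #-}
-- F is replaced by its up-closure, seen as a Boolean function on 0-1 vectors.  To show |F| ≤ |𝒫| it suffices that
-- F ∖ 𝒫 is at most as large as 𝒫 ∖ F.  Place a configuration of sets on the ground set and average over all
-- permutations: an inequality between the numbers of members and non-members among the sets of the configuration
-- becomes one between the densities of the levels of F.  The basic configuration consists of s disjoint blocks and
-- b disjoint tails; if at least s - b blocks are members, then at least b of the sets block ∪ tail are missing.
-- For l = 2 the blocks are arcs of length m on a circle of n points, and all rotations of the configuration are
-- counted together, as in Katona's proof of the Erdős–Ko–Rado theorem.  For m = 1 and for s ≥ l m + 3 l + 3 the
-- family is compressed first.  In the latter case, if F has an m-set far from [l - 1], then F contains l disjoint
-- m-sets on the first l m points, and so many (m + 1)-sets are missing that crude bounds suffice; otherwise almost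
-- all of F ∖ 𝒫 is controlled by the sets {l} ∪ T with |T| = m - 1, which are weighed against the missing sets
-- {i} ∪ T, i < l, by a Hall-type argument for nested neighbourhoods.

module Submission where

open import Defs
open import Data.Bool using (Bool; true; false; not; _∧_; _∨_; if_then_else_)
import Data.Bool as Bool
open import Data.Bool.ListAction using (any)
open import Data.Bool.Properties using (∨-identityʳ)
open import Data.Empty using (⊥; ⊥-elim)
open import Data.Fin using (Fin; toℕ; fromℕ<)
open import Data.Fin.Properties using (toℕ-injective; toℕ<n; fromℕ<-cong; fromℕ<-injective)
open import Data.Fin.Subset using (Subset; _∩_; Empty; ∣_∣; _∈_)
open import Data.Fin.Subset.Properties using (x∈p∩q⁻)
open import Data.List using (List; []; _∷_; length; map; filter)
import Data.List as List
open import Data.List.Properties using (length-++; filter-++)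
import Data.List.Membership.Propositional as LM
open import Data.List.Membership.Propositional.Properties using (∈-filter⁻; ∈-map⁻)
import Data.List.Relation.Unary.All as All
open import Data.List.Relation.Unary.AllPairs using ([]; _∷_)
open import Data.List.Relation.Unary.Any using (here; there)
open import Data.List.Relation.Unary.Unique.Propositional using (Unique)
open import Data.List.Relation.Unary.Unique.Propositional.Properties using (map⁺; filter⁺) renaming (++⁺ to unique-++)
open import Data.Nat using (ℕ; zero; suc; _+_; _*_; _∸_; _≤_; _<_; z≤n; s≤s; _!; _≤?_; _<?_; _≡ᵇ_; _<ᵇ_; _≤ᵇ_; NonZero; >-nonZero)
open import Data.Nat.DivMod using (_%_; %-distribˡ-+; m%n%n≡m%n; [m+kn]%n≡m%n; [m+n]%n≡m%n; m<n⇒m%n≡m; m%n<n)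
open import Data.Nat.Divisibility using (_∣_; divides)
open import Data.Nat.Properties
open import Data.Nat.Tactic.RingSolver using (solve-∀)
open import Data.Product using (Σ; _×_; _,_; proj₁; proj₂)
open import Data.Sum using (_⊎_; inj₁; inj₂; [_,_]′)
open import Data.Unit using (⊤; tt)
open import Data.Vec using (Vec; []; _∷_; _++_; here; there)
import Data.Vec as Vec
open import Data.Vec.Properties using (∷-injectiveʳ)
open import Data.Vec.Relation.Binary.Pointwise.Inductive using (Pointwise; []; _∷_; ++⁺)
open import Function using (_∘_; id)
open import Relation.Binary.Definitions using (tri<; tri≈; tri>)
open import Relation.Binary.PropositionalEquality using (_≡_; _≢_; refl; sym; trans; cong; cong₂; subst; module ≡-Reasoning)
open import Relation.Nullary using (yes; no; does; ¬_)
open import Relation.Unary using (Pred; Decidable)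

-- Sums, permutations and levels of the cube

-- All estimates stay in ℕ: sums over permutations are never divided, and `den` scales each level so
-- that full density is `n !`.
--
-- The side conditions come from the estimates. For l = 2 put d = s - 2. The critical case has m + 1
-- member arcs and no window with three of them. It guarantees two windows with two member arcs,
-- while the estimate asks for d (d + 2) ≤ (d + 1)(d - 1) N, where N counts such windows. N = 2
-- suffices for d ≥ 3; for d = 2 a third window is needed, and an even m supplies it.
--
-- For (iii) put d = s - l and let Y be the number of missing (m + 1)-sets. If l disjoint m-sets are
-- members, deleting their l m points keeps most (m + 1)-sets, and at least one in d of those is
-- missing. As C(n, m + 1) ≥ d C(n, m), this makes s Y at least about (d - l m) C(n, m). Half of Y
-- is spent on the blocks and the other half has to cover (l + 1) C(n, m). The condition s ≥ l m + 3
-- l + 3 says d - l m ≥ 2 l + 3, just above the double of l + 1.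

∑ : ℕ → (ℕ → ℕ) → ℕ
∑ zero    f = 0
∑ (suc n) f = ∑ n f + f n

∑-mono : ∀ n {f g : ℕ → ℕ} → (∀ i → i < n → f i ≤ g i) → ∑ n f ≤ ∑ n g
∑-mono zero    h = z≤n
∑-mono (suc n) h = +-mono-≤ (∑-mono n (λ i i<n → h i (m<n⇒m<1+n i<n))) (h n ≤-refl)

∑-cong : ∀ n {f g : ℕ → ℕ} → (∀ i → i < n → f i ≡ g i) → ∑ n f ≡ ∑ n g
∑-cong zero    h = refl
∑-cong (suc n) h = cong₂ _+_ (∑-cong n (λ i i<n → h i (m<n⇒m<1+n i<n))) (h n ≤-refl)

level-ring₁ : ∀ a b c d → a * b * (suc c * d) ≡ suc c * a * b * d
level-ring₁ = solve-∀

level-ring₂ : ∀ a b c d → a * b * (suc c * d) ≡ a * (suc c * b) * d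
level-ring₂ = solve-∀

level-ring₃ : ∀ a b c d → a * b * c * d ≡ b * c * (a * d)
level-ring₃ = solve-∀

level-ring₄ : ∀ a b c d → a * b * (c * d) ≡ a * (c * b) * d
level-ring₄ = solve-∀

level-ring₅ : ∀ a b c → a * (b * c) ≡ b * a * c
level-ring₅ = solve-∀

level-ring₆ : ∀ t f → t + 1 * f ≡ 1 * (f + t)
level-ring₆ = solve-∀

level-ring₇ : ∀ t f k → t + (suc (suc k) * f + suc k * t) ≡ suc (suc k) * (f + t)
level-ring₇ = solve-∀

interchange : ∀ a b c d → (a + b) + (c + d) ≡ (a + c) + (b + d)
interchange = solve-∀

∑-+ : ∀ n (f g : ℕ → ℕ) → ∑ n (λ i → f i + g i) ≡ ∑ n f + ∑ n g
∑-+ zero    f g = refl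
∑-+ (suc n) f g = trans (cong (_+ (f n + g n)) (∑-+ n f g)) (interchange (∑ n f) (∑ n g) (f n) (g n))

∑-* : ∀ n c (f : ℕ → ℕ) → ∑ n (λ i → c * f i) ≡ c * ∑ n f
∑-* zero    c f = sym (*-zeroʳ c)
∑-* (suc n) c f = trans (cong (_+ c * f n) (∑-* n c f)) (sym (*-distribˡ-+ c (∑ n f) (f n)))

∑-const : ∀ n c → ∑ n (λ _ → c) ≡ n * c
∑-const zero    c = refl
∑-const (suc n) c = trans (cong (_+ c) (∑-const n c)) (+-comm (n * c) c)

∑-zero : ∀ n {f : ℕ → ℕ} → (∀ i → i < n → f i ≡ 0) → ∑ n f ≡ 0
∑-zero n h = trans (∑-cong n h) (trans (∑-const n 0) (*-zeroʳ n))

∑-swap : ∀ a b (f : ℕ → ℕ → ℕ) → ∑ a (λ i → ∑ b (f i)) ≡ ∑ b (λ j → ∑ a (λ i → f i j))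
∑-swap zero    b f = sym (∑-zero b (λ _ _ → refl))
∑-swap (suc a) b f =
  trans (cong (_+ ∑ b (f a)) (∑-swap a b f)) (sym (∑-+ b (λ j → ∑ a (λ i → f i j)) (f a)))

∑-split : ∀ a b (f : ℕ → ℕ) → ∑ (a + b) f ≡ ∑ a f + ∑ b (λ i → f (a + i))
∑-split a zero    f = trans (cong (λ n → ∑ n f) (+-identityʳ a)) (sym (+-identityʳ _))
∑-split a (suc b) f = begin
  ∑ (a + suc b) f ≡⟨ cong (λ n → ∑ n f) (+-suc a b) ⟩
  ∑ (a + b) f + f (a + b) ≡⟨ cong (_+ f (a + b)) (∑-split a b f) ⟩
  ∑ a f + ∑ b (λ i → f (a + i)) + f (a + b) ≡⟨ +-assoc (∑ a f) _ _ ⟩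
  ∑ a f + ∑ (suc b) (λ i → f (a + i)) ∎
  where open ≡-Reasoning

∑-head : ∀ n (f : ℕ → ℕ) → ∑ (suc n) f ≡ f 0 + ∑ n (f ∘ suc)
∑-head n f = ∑-split 1 n f

∑-≤-bound : ∀ {a b} (f : ℕ → ℕ) → a ≤ b → ∑ a f ≤ ∑ b f
∑-≤-bound {a} {b} f a≤b = subst (λ n → ∑ a f ≤ ∑ n f) (m+[n∸m]≡n a≤b)
  (subst (∑ a f ≤_) (sym (∑-split a (b ∸ a) f)) (m≤m+n _ _))

∑-term : ∀ n (f : ℕ → ℕ) i → i < n → f i ≤ ∑ n f
∑-term n f i i<n = ≤-trans (m≤n+m (f i) (∑ i f)) (∑-≤-bound f i<n)

∑-periodic : ∀ n (f : ℕ → ℕ) → (∀ x → f (x + n) ≡ f x) → ∀ d → ∑ n (λ x → f (x + d)) ≡ ∑ n f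
∑-periodic n f per zero    = ∑-cong n (λ i _ → cong f (+-identityʳ i))
∑-periodic n f per (suc d) = trans (∑-cong n (λ i _ → cong f (+-suc i d)))
  (trans (+-cancelʳ-≡ (g 0) _ _ rotate) (∑-periodic n f per d))
  where
  g : ℕ → ℕ
  g x = f (x + d)
  g-per : g n ≡ g 0
  g-per = trans (cong f (+-comm n d)) (per d)
  rotate : ∑ n (g ∘ suc) + g 0 ≡ ∑ n g + g 0
  rotate = trans (+-comm _ (g 0)) (trans (sym (∑-head n g)) (cong (∑ n g +_) g-per))

ι : Bool → ℕ
ι true  = 1
ι false = 0

miss : Bool → ℕ
miss b = ι (not b)

ι≤1 : ∀ b → ι b ≤ 1
ι≤1 true  = ≤-refl
ι≤1 false = z≤n

ι+miss : ∀ b → ι b + miss b ≡ 1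
ι+miss true  = refl
ι+miss false = refl

ι-mono : ∀ {a b} → (a ≡ true → b ≡ true) → ι a ≤ ι b
ι-mono {false}        h = z≤n
ι-mono {true} {true}  h = ≤-refl
ι-mono {true} {false} h with h refl
... | ()

miss-anti : ∀ {a b} → (a ≡ true → b ≡ true) → miss b ≤ miss a
miss-anti {true}  {true}  h = z≤n
miss-anti {true}  {false} h with h refl
... | ()
miss-anti {false} {b}     h = ι≤1 (not b)

Act : ℕ → Set
Act g = Vec Bool g → Vec Bool g

insert : ∀ {g} → ℕ → Bool → Vec Bool g → Vec Bool (suc g)
insert zero    x ys       = x ∷ ys
insert (suc i) x []       = x ∷ []
insert (suc i) x (y ∷ ys) = y ∷ insert i x ys

-- A permutation of g + 1 coordinates is a permutation of the last g followed by an insertion of the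
-- first at one of g + 1 positions; iterating this yields each permutation exactly once.
place : ∀ {g} → ℕ → Act g → Act (suc g)
place i σ (x ∷ xs) = insert i x (σ xs)

-- The sum of F over the actions of all g! permutations of the coordinates.
𝔼 : ∀ g → (Act g → ℕ) → ℕ
𝔼 zero    F = F id
𝔼 (suc g) F = ∑ (suc g) (λ i → 𝔼 g (λ σ → F (place i σ)))

-- Parametricity stands in for bijectivity: an action that only rearranges coordinates carries every
-- pointwise relation along. With `Below` and `Apart` for R it preserves inclusion and disjointness.
Natural : ∀ {g} → Act g → Set₁
Natural {g} σ = ∀ (R : Bool → Bool → Set) {u v : Vec Bool g} → Pointwise R u v → Pointwise R (σ u) (σ v)

insert-pointwise : ∀ {g} (R : Bool → Bool → Set) i {x y} {u v : Vec Bool g} →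
  R x y → Pointwise R u v → Pointwise R (insert i x u) (insert i y v)
insert-pointwise R zero    r rs       = r ∷ rs
insert-pointwise R (suc i) r []       = r ∷ []
insert-pointwise R (suc i) r (q ∷ rs) = q ∷ insert-pointwise R i r rs

place-natural : ∀ {g} i {σ : Act g} → Natural σ → Natural (place i σ)
place-natural i nat R {_ ∷ _} {_ ∷ _} (r ∷ rs) = insert-pointwise R i r (nat R rs)

𝔼-mono : ∀ g {F G : Act g → ℕ} → (∀ σ → Natural σ → F σ ≤ G σ) → 𝔼 g F ≤ 𝔼 g G
𝔼-mono zero    h = h id (λ R rs → rs)
𝔼-mono (suc g) h =
  ∑-mono (suc g) (λ i _ → 𝔼-mono g (λ σ nat → h (place i σ) (place-natural i nat)))

𝔼-cong : ∀ g {F G : Act g → ℕ} → (∀ σ → F σ ≡ G σ) → 𝔼 g F ≡ 𝔼 g G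
𝔼-cong g h = ≤-antisym (𝔼-mono g (λ σ _ → ≤-reflexive (h σ))) (𝔼-mono g (λ σ _ → ≤-reflexive (sym (h σ))))

𝔼-+ : ∀ g (F G : Act g → ℕ) → 𝔼 g (λ σ → F σ + G σ) ≡ 𝔼 g F + 𝔼 g G
𝔼-+ zero    F G = refl
𝔼-+ (suc g) F G =
  trans (∑-cong (suc g) (λ i _ → 𝔼-+ g (λ σ → F (place i σ)) (λ σ → G (place i σ))))
        (∑-+ (suc g) (λ i → 𝔼 g (λ σ → F (place i σ))) (λ i → 𝔼 g (λ σ → G (place i σ))))

𝔼-* : ∀ g c (F : Act g → ℕ) → 𝔼 g (λ σ → c * F σ) ≡ c * 𝔼 g F
𝔼-* zero    c F = refl
𝔼-* (suc g) c F =
  trans (∑-cong (suc g) (λ i _ → 𝔼-* g c (λ σ → F (place i σ))))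
        (∑-* (suc g) c (λ i → 𝔼 g (λ σ → F (place i σ))))

𝔼-const : ∀ g c → 𝔼 g (λ _ → c) ≡ g ! * c
𝔼-const zero    c = sym (*-identityˡ c)
𝔼-const (suc g) c = trans (∑-cong (suc g) (λ _ _ → 𝔼-const g c))
  (trans (∑-const (suc g) (g ! * c)) (sym (*-assoc (suc g) (g !) c)))

𝔼-∑ : ∀ g n (F : ℕ → Act g → ℕ) → 𝔼 g (λ σ → ∑ n (λ i → F i σ)) ≡ ∑ n (λ i → 𝔼 g (F i))
𝔼-∑ g zero    F = trans (𝔼-const g 0) (*-zeroʳ (g !))
𝔼-∑ g (suc n) F =
  trans (𝔼-+ g (λ σ → ∑ n (λ i → F i σ)) (F n)) (cong (_+ 𝔼 g (F n)) (𝔼-∑ g n F))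

wt : ∀ {n} → Vec Bool n → ℕ
wt []      = 0
wt (b ∷ v) = ι b + wt v

wt≤n : ∀ {n} (v : Vec Bool n) → wt v ≤ n
wt≤n []      = z≤n
wt≤n (b ∷ v) = +-mono-≤ (ι≤1 b) (wt≤n v)

Lev : ∀ n → ℕ → (Vec Bool n → ℕ) → ℕ
Lev zero    zero    h = h []
Lev zero    (suc k) h = 0
Lev (suc n) zero    h = Lev n zero (h ∘ (false ∷_))
Lev (suc n) (suc k) h = Lev n (suc k) (h ∘ (false ∷_)) + Lev n k (h ∘ (true ∷_))

Lev-mono : ∀ n k {h h′ : Vec Bool n → ℕ} → (∀ v → wt v ≡ k → h v ≤ h′ v) → Lev n k h ≤ Lev n k h′
Lev-mono zero    zero    H = H [] refl
Lev-mono zero    (suc k) H = z≤n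
Lev-mono (suc n) zero    H = Lev-mono n zero (λ v e → H (false ∷ v) e)
Lev-mono (suc n) (suc k) H =
  +-mono-≤ (Lev-mono n (suc k) (λ v e → H (false ∷ v) e)) (Lev-mono n k (λ v e → H (true ∷ v) (cong suc e)))

Lev-cong : ∀ n k {h h′ : Vec Bool n → ℕ} → (∀ v → wt v ≡ k → h v ≡ h′ v) → Lev n k h ≡ Lev n k h′
Lev-cong n k H = ≤-antisym (Lev-mono n k (λ v e → ≤-reflexive (H v e))) (Lev-mono n k (λ v e → ≤-reflexive (sym (H v e))))

Lev-+ : ∀ n k (h h′ : Vec Bool n → ℕ) → Lev n k (λ v → h v + h′ v) ≡ Lev n k h + Lev n k h′
Lev-+ zero    zero    h h′ = refl
Lev-+ zero    (suc k) h h′ = refl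
Lev-+ (suc n) zero    h h′ = Lev-+ n zero _ _
Lev-+ (suc n) (suc k) h h′ = trans (cong₂ _+_ (Lev-+ n (suc k) _ _) (Lev-+ n k _ _))
  (interchange (Lev n (suc k) (h ∘ (false ∷_))) _ _ _)

Lev-zero : ∀ n k {h : Vec Bool n → ℕ} → (∀ v → wt v ≡ k → h v ≡ 0) → Lev n k h ≡ 0
Lev-zero zero    zero    H = H [] refl
Lev-zero zero    (suc k) H = refl
Lev-zero (suc n) zero    H = Lev-zero n zero (λ v → H (false ∷ v))
Lev-zero (suc n) (suc k) H = cong₂ _+_ (Lev-zero n (suc k) (λ v → H (false ∷ v)))
    (Lev-zero n k (λ v e → H (true ∷ v) (cong suc e)))

Lev-big : ∀ n k (h : Vec Bool n → ℕ) → n < k → Lev n k h ≡ 0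
Lev-big zero    (suc k) h _         = refl
Lev-big (suc n) (suc k) h (s≤s n<k) = cong₂ _+_ (Lev-big n (suc k) _ (m<n⇒m<1+n n<k)) (Lev-big n k _ n<k)

-- Double counting: a set of size k + 1 arises once for each of its elements, regarded as the
-- inserted one.
Lev-insert-true : ∀ n k (h : Vec Bool (suc n) → ℕ) →
  ∑ (suc n) (λ i → Lev n k (λ v → h (insert i true v))) ≡ suc k * Lev (suc n) (suc k) h
Lev-insert-true zero    zero    h = sym (+-identityʳ _)
Lev-insert-true zero    (suc k) h = sym (*-zeroʳ (suc (suc k)))
Lev-insert-true (suc n) zero    h = begin
  ∑ (suc (suc n)) (λ i → Lev (suc n) 0 (λ v → h (insert i true v)))
    ≡⟨ ∑-head (suc n) (λ i → Lev (suc n) 0 (λ v → h (insert i true v))) ⟩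
  t + ∑ (suc n) (λ i → Lev n 0 (λ v → h (false ∷ insert i true v)))
    ≡⟨ cong (t +_) (Lev-insert-true n 0 (h ∘ (false ∷_))) ⟩
  t + 1 * f
    ≡⟨ level-ring₆ t f ⟩
  1 * (f + t) ∎
  where
  open ≡-Reasoning
  t = Lev (suc n) 0 (h ∘ (true ∷_))
  f = Lev (suc n) 1 (h ∘ (false ∷_))
Lev-insert-true (suc n) (suc k) h = begin
  ∑ (suc (suc n)) (λ i → Lev (suc n) (suc k) (λ v → h (insert i true v)))
    ≡⟨ ∑-head (suc n) (λ i → Lev (suc n) (suc k) (λ v → h (insert i true v))) ⟩
  t + ∑ (suc n) (λ i → Lev n (suc k) (λ v → h (false ∷ insert i true v)) + Lev n k (λ v → h (true ∷ insert i true v)))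
    ≡⟨ cong (t +_) (∑-+ (suc n) (λ i → Lev n (suc k) (λ v → h (false ∷ insert i true v)))
         (λ i → Lev n k (λ v → h (true ∷ insert i true v)))) ⟩
  t + (∑ (suc n) (λ i → Lev n (suc k) (λ v → h (false ∷ insert i true v))) + ∑ (suc n)
      (λ i → Lev n k (λ v → h (true ∷ insert i true v))))
    ≡⟨ cong (t +_) (cong₂ _+_ (Lev-insert-true n (suc k) (h ∘ (false ∷_))) (Lev-insert-true n k (h ∘ (true ∷_)))) ⟩
  t + (suc (suc k) * f + suc k * t)
    ≡⟨ level-ring₇ t f k ⟩
  suc (suc k) * (f + t) ∎
  where
  open ≡-Reasoning
  t = Lev (suc n) (suc k) (h ∘ (true ∷_))
  f = Lev (suc n) (suc (suc k)) (h ∘ (false ∷_))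

-- The same double counting, over the coordinates outside the set.
Lev-insert-false : ∀ n k (h : Vec Bool (suc n) → ℕ) →
  ∑ (suc n) (λ i → Lev n k (λ v → h (insert i false v))) ≡ (suc n ∸ k) * Lev (suc n) k h
Lev-insert-false zero    zero    h = sym (+-identityʳ _)
Lev-insert-false zero    (suc k) h = sym (cong (_* Lev 1 (suc k) h) (0∸n≡0 k))
Lev-insert-false (suc n) zero    h =
  trans (∑-head (suc n) (λ i → Lev (suc n) 0 (λ v → h (insert i false v))))
        (cong (Lev (suc n) 0 (h ∘ (false ∷_)) +_) (Lev-insert-false n 0 (h ∘ (false ∷_))))
Lev-insert-false (suc n) (suc k) h = begin
  ∑ (suc (suc n)) (λ i → Lev (suc n) (suc k) (λ v → h (insert i false v)))
    ≡⟨ ∑-head (suc n) (λ i → Lev (suc n) (suc k) (λ v → h (insert i false v))) ⟩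
  f + ∑ (suc n) (λ i → Lev n (suc k) (λ v → h (false ∷ insert i false v)) + Lev n k (λ v → h (true ∷ insert i false v)))
    ≡⟨ cong (f +_) (∑-+ (suc n) (λ i → Lev n (suc k) (λ v → h (false ∷ insert i false v)))
         (λ i → Lev n k (λ v → h (true ∷ insert i false v)))) ⟩
  f + (∑ (suc n) (λ i → Lev n (suc k) (λ v → h (false ∷ insert i false v))) + ∑ (suc n)
      (λ i → Lev n k (λ v → h (true ∷ insert i false v))))
    ≡⟨ cong (f +_) (cong₂ _+_ (Lev-insert-false n (suc k) (h ∘ (false ∷_))) (Lev-insert-false n k (h ∘ (true ∷_)))) ⟩
  f + ((n ∸ k) * f + (suc n ∸ k) * t)
    ≡⟨ sym (+-assoc f _ _) ⟩
  suc (n ∸ k) * f + (suc n ∸ k) * t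
    ≡⟨ cong (_+ (suc n ∸ k) * t) coefficient ⟩
  (suc n ∸ k) * f + (suc n ∸ k) * t
    ≡⟨ sym (*-distribˡ-+ (suc n ∸ k) f t) ⟩
  (suc n ∸ k) * (f + t) ∎
  where
  open ≡-Reasoning
  t = Lev (suc n) k (h ∘ (true ∷_))
  f = Lev (suc n) (suc k) (h ∘ (false ∷_))
  -- For k > n truncated subtraction spoils the equality of the coefficients, but then the level is
  -- empty and f vanishes.
  coefficient : suc (n ∸ k) * f ≡ (suc n ∸ k) * f
  coefficient with k ≤? n
  ... | yes k≤n = cong (_* f) (sym (+-∸-assoc 1 k≤n))
  ... | no  k≰n = trans (cong (suc (n ∸ k) *_) f≡0)
    (trans (*-zeroʳ (suc (n ∸ k))) (sym (trans (cong ((suc n ∸ k) *_) f≡0) (*-zeroʳ (suc n ∸ k)))))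
    where f≡0 = Lev-big (suc n) (suc k) (h ∘ (false ∷_)) (s≤s (≰⇒> k≰n))

binom : ℕ → ℕ → ℕ
binom n k = Lev n k (λ _ → 1)

absorb : ∀ n k → suc n * binom n k ≡ suc k * binom (suc n) (suc k)
absorb n k = trans (sym (∑-const (suc n) (binom n k))) (Lev-insert-true n k (λ _ → 1))

absorb′ : ∀ n k → suc n * binom n k ≡ (suc n ∸ k) * binom (suc n) k
absorb′ n k = trans (sym (∑-const (suc n) (binom n k))) (Lev-insert-false n k (λ _ → 1))

binom-step : ∀ n k → suc k * binom n (suc k) ≡ (n ∸ k) * binom n k
binom-step zero    k = trans (*-zeroʳ (suc k)) (sym (cong (_* binom 0 k) (0∸n≡0 k)))
binom-step (suc n) k = trans (sym (absorb n k)) (absorb′ n k)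

-- Each set of the size of A is its image under equally many permutations. The induction strips the
-- first coordinate of A and reinserts it by one of the two double counts.
average : ∀ g (A : Vec Bool g) (h : Vec Bool g → ℕ) →
  𝔼 g (λ σ → h (σ A)) ≡ wt A ! * (g ∸ wt A) ! * Lev g (wt A) h
average zero    []      h = sym (*-identityˡ (h []))
average (suc g) (true ∷ A) h = begin
  ∑ (suc g) (λ i → 𝔼 g (λ σ → h (insert i true (σ A))))
    ≡⟨ ∑-cong (suc g) (λ i _ → average g A (λ v → h (insert i true v))) ⟩
  ∑ (suc g) (λ i → k ! * (g ∸ k) ! * Lev g k (λ v → h (insert i true v)))
    ≡⟨ ∑-* (suc g) (k ! * (g ∸ k) !) (λ i → Lev g k (λ v → h (insert i true v))) ⟩
  k ! * (g ∸ k) ! * ∑ (suc g) (λ i → Lev g k (λ v → h (insert i true v)))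
    ≡⟨ cong (k ! * (g ∸ k) ! *_) (Lev-insert-true g k h) ⟩
  k ! * (g ∸ k) ! * (suc k * Lev (suc g) (suc k) h)
    ≡⟨ level-ring₁ (k !) ((g ∸ k) !) k (Lev (suc g) (suc k) h) ⟩
  suc k * k ! * (g ∸ k) ! * Lev (suc g) (suc k) h ∎
  where
  open ≡-Reasoning
  k = wt A
average (suc g) (false ∷ A) h = begin
  ∑ (suc g) (λ i → 𝔼 g (λ σ → h (insert i false (σ A))))
    ≡⟨ ∑-cong (suc g) (λ i _ → average g A (λ v → h (insert i false v))) ⟩
  ∑ (suc g) (λ i → k ! * (g ∸ k) ! * Lev g k (λ v → h (insert i false v)))
    ≡⟨ ∑-* (suc g) (k ! * (g ∸ k) !) (λ i → Lev g k (λ v → h (insert i false v))) ⟩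
  k ! * (g ∸ k) ! * ∑ (suc g) (λ i → Lev g k (λ v → h (insert i false v)))
    ≡⟨ cong (k ! * (g ∸ k) ! *_) (Lev-insert-false g k h) ⟩
  k ! * (g ∸ k) ! * ((suc g ∸ k) * Lev (suc g) k h)
    ≡⟨ cong (λ j → k ! * (g ∸ k) ! * (j * Lev (suc g) k h)) (+-∸-assoc 1 (wt≤n A)) ⟩
  k ! * (g ∸ k) ! * (suc (g ∸ k) * Lev (suc g) k h)
    ≡⟨ level-ring₂ (k !) ((g ∸ k) !) (g ∸ k) (Lev (suc g) k h) ⟩
  k ! * suc (g ∸ k) ! * Lev (suc g) k h
    ≡⟨ cong (λ j → k ! * j ! * Lev (suc g) k h) (sym (+-∸-assoc 1 (wt≤n A))) ⟩
  k ! * (suc g ∸ k) ! * Lev (suc g) k h ∎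
  where
  open ≡-Reasoning
  k = wt A

-- The level sum of h, normalised so that the constant 1 has density n !.
den : ∀ n → ℕ → (Vec Bool n → ℕ) → ℕ
den n k h = k ! * (n ∸ k) ! * Lev n k h

factorials : ∀ n k → k ≤ n → k ! * (n ∸ k) ! * binom n k ≡ n !
factorials n zero    _   = trans (cong₂ _*_ (*-identityˡ (n !)) (one n)) (*-identityʳ (n !))
  where
  one : ∀ n → binom n 0 ≡ 1
  one zero    = refl
  one (suc n) = one n
factorials n (suc k) k<n = begin
  suc k * k ! * (n ∸ suc k) ! * binom n (suc k)
    ≡⟨ level-ring₃ (suc k) (k !) ((n ∸ suc k) !) (binom n (suc k)) ⟩
  k ! * (n ∸ suc k) ! * (suc k * binom n (suc k))
    ≡⟨ cong (k ! * (n ∸ suc k) ! *_) (binom-step n k) ⟩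
  k ! * (n ∸ suc k) ! * ((n ∸ k) * binom n k)
    ≡⟨ cong (λ j → k ! * (n ∸ suc k) ! * (j * binom n k)) (sym n∸k) ⟩
  k ! * (n ∸ suc k) ! * (suc (n ∸ suc k) * binom n k)
    ≡⟨ level-ring₄ (k !) ((n ∸ suc k) !) (suc (n ∸ suc k)) (binom n k) ⟩
  k ! * suc (n ∸ suc k) ! * binom n k
    ≡⟨ cong (λ j → k ! * j ! * binom n k) n∸k ⟩
  k ! * (n ∸ k) ! * binom n k
    ≡⟨ factorials n k (<⇒≤ k<n) ⟩
  n ! ∎
  where
  open ≡-Reasoning
  n∸k : suc (n ∸ suc k) ≡ n ∸ k
  n∸k = sym (+-∸-assoc 1 k<n)

-- The way back from densities to numbers of sets; above level n both sides vanish.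
binom-den : ∀ n k h → binom n k * den n k h ≡ n ! * Lev n k h
binom-den n k h with k ≤? n
... | yes k≤n = trans (level-ring₅ (binom n k) (k ! * (n ∸ k) !) (Lev n k h)) (cong (_* Lev n k h) (factorials n k k≤n))
... | no  k≰n = trans (cong (_* den n k h) (Lev-big n k _ (≰⇒> k≰n)))
  (sym (trans (cong (n ! *_) (Lev-big n k h (≰⇒> k≰n))) (*-zeroʳ (n !))))

tab : ∀ g → (ℕ → Bool) → Vec Bool g
tab zero    p = []
tab (suc g) p = p 0 ∷ tab g (p ∘ suc)

wt-tab : ∀ g p → wt (tab g p) ≡ ∑ g (ι ∘ p)
wt-tab zero    p = refl
wt-tab (suc g) p = trans (cong (ι (p 0) +_) (wt-tab g (p ∘ suc))) (sym (∑-head g (ι ∘ p)))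

tab-pointwise : ∀ (R : Bool → Bool → Set) g {p q : ℕ → Bool} →
  (∀ x → x < g → R (p x) (q x)) → Pointwise R (tab g p) (tab g q)
tab-pointwise R zero    h = []
tab-pointwise R (suc g) h = h 0 (s≤s z≤n) ∷ tab-pointwise R g (λ x x<g → h (suc x) (s≤s x<g))

tab-cong : ∀ g {p q : ℕ → Bool} → (∀ x → x < g → p x ≡ q x) → tab g p ≡ tab g q
tab-cong zero    h = refl
tab-cong (suc g) h = cong₂ _∷_ (h 0 (s≤s z≤n)) (tab-cong g (λ x x<g → h (suc x) (s≤s x<g)))

tab-++ : ∀ c g p → tab (c + g) p ≡ tab c p ++ tab g (λ x → p (c + x))
tab-++ zero    g p = refl
tab-++ (suc c) g p = cong (p 0 ∷_) (tab-++ c g (p ∘ suc))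

-- Families without s pairwise disjoint members

false≢true : {A : Set} → false ≡ true → A
false≢true ()

<ᵇ-sound : ∀ a b → (a <ᵇ b) ≡ true → a < b
<ᵇ-sound a b e = <ᵇ⇒< a b (subst Bool.T (sym e) tt)

<ᵇ-complete : ∀ {a b} → a < b → (a <ᵇ b) ≡ true
<ᵇ-complete {zero}  {suc b} _         = refl
<ᵇ-complete {suc a} {suc b} (s≤s a<b) = <ᵇ-complete a<b

<ᵇ-refute : ∀ {a b} → b ≤ a → (a <ᵇ b) ≡ false
<ᵇ-refute {a} {b} b≤a with a <ᵇ b in e
... | false = refl
... | true  = ⊥-elim (<⇒≱ (<ᵇ-sound a b e) b≤a)

∧-true : ∀ {a b} → a ∧ b ≡ true → a ≡ true × b ≡ true
∧-true {true} e = refl , e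

∨-true : ∀ {a b} → a ∨ b ≡ true → a ≡ true ⊎ b ≡ true
∨-true {true}  e = inj₁ refl
∨-true {false} e = inj₂ e

∨-left : ∀ {a} b → a ≡ true → a ∨ b ≡ true
∨-left b refl = refl

∨-right : ∀ a {b} → b ≡ true → a ∨ b ≡ true
∨-right true  e = refl
∨-right false e = e

Below : Bool → Bool → Set
Below a b = a ≡ true → b ≡ true

Apart : Bool → Bool → Set
Apart a b = a ≡ true → b ≡ true → ⊥

below-refl : ∀ {n} (u : Vec Bool n) → Pointwise Below u u
below-refl []      = []
below-refl (a ∷ u) = id ∷ below-refl u

record Matchless (n s : ℕ) (f : Vec Bool n → Bool) : Set where
  field
    upward   : ∀ {u v} → Pointwise Below u v → f u ≡ true → f v ≡ true
    matching : (G : ℕ → Vec Bool n) → (∀ i j → i < j → j < s → Pointwise Apart (G i) (G j)) →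
               (∀ i → i < s → f (G i) ≡ true) → ⊥

Points : Set
Points = ℕ → Bool

-- Configurations are predicates on ℕ of which the first n values count, so blocks, arcs and tails
-- need no vectors. In contrast to `Matchless`, the second field exhibits a non-member, as the
-- counting of missing sets requires.
record MatchlessOn (n s : ℕ) (φ : Points → Bool) : Set where
  field
    upwardOn   : ∀ p q → (∀ x → x < n → p x ≡ true → q x ≡ true) → φ p ≡ true → φ q ≡ true
    matchingOn : (G : ℕ → Points) → (∀ i j x → i < j → j < s → x < n → G i x ≡ true → G j x ≡ true → ⊥) →
                 Σ ℕ λ i → i < s × φ (G i) ≡ false
open Matchless public
open MatchlessOn public

search : ∀ s (b : ℕ → Bool) → (Σ ℕ λ i → i < s × b i ≡ false) ⊎ (∀ i → i < s → b i ≡ true)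
search zero    b = inj₂ (λ i ())
search (suc s) b with search s b
... | inj₁ (i , i<s , e) = inj₁ (i , m<n⇒m<1+n i<s , e)
... | inj₂ all with b s in e
...   | false = inj₁ (s , ≤-refl , e)
...   | true  = inj₂ (λ i i<1+s → [ (λ i<s → all i i<s) , (λ { refl → e }) ]′ (m≤n⇒m<n∨m≡n (≤-pred i<1+s)))

-- Only the last g coordinates are permuted, so averaging produces densities of levels above a fixed
-- prefix.
view : ∀ c g → (Vec Bool (c + g) → Bool) → Act g → Points → Bool
view c g f σ p = f (tab c p ++ σ (tab g (λ x → p (c + x))))

view-matchless : ∀ c g {s f} {σ : Act g} → Natural σ → Matchless (c + g) s f → MatchlessOn (c + g) s (view c g f σ)
view-matchless c g {s} {f} {σ} nat M = record { upwardOn = up ; matchingOn = match }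
  where
  both : ∀ (R : Bool → Bool → Set) {p q} → (∀ x → x < c + g → R (p x) (q x)) →
    Pointwise R (tab c p ++ σ (tab g (λ x → p (c + x)))) (tab c q ++ σ (tab g (λ x → q (c + x))))
  both R h = ++⁺ (tab-pointwise R c (λ x x<c → h x (≤-trans x<c (m≤m+n c g))))
                 (nat R (tab-pointwise R g (λ x x<g → h (c + x) (+-monoʳ-< c x<g))))
  up : ∀ p q → (∀ x → x < c + g → p x ≡ true → q x ≡ true) → view c g f σ p ≡ true → view c g f σ q ≡ true
  up p q h = upward M (both Below h)
  match : (G : ℕ → Points) → (∀ i j x → i < j → j < s → x < c + g → G i x ≡ true → G j x ≡ true → ⊥) →
    Σ ℕ λ i → i < s × view c g f σ (G i) ≡ false
  match G apart with search s (λ i → view c g f σ (G i))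
  ... | inj₁ found = found
  ... | inj₂ all   = ⊥-elim (matching M (λ i → tab c (G i) ++ σ (tab g (λ x → G i (c + x))))
                       (λ i j i<j j<s → both Apart (λ x x<n → apart i j x i<j j<s x<n)) all)

join : ℕ → Points → Points → Points
join c q p x = if x <ᵇ c then q x else p (x ∸ c)

join-left : ∀ c q p x → x < c → join c q p x ≡ q x
join-left c q p x x<c rewrite <ᵇ-complete x<c = refl

join-right : ∀ c q p x → join c q p (c + x) ≡ p x
join-right c q p x rewrite <ᵇ-refute (m≤m+n c x) = cong p (m+n∸m≡n c x)

view-join : ∀ c g f (σ : Act g) q p → view c g f σ (join c q p) ≡ f (tab c q ++ σ (tab g p))
view-join c g f σ q p = cong f (cong₂ _++_ (tab-cong c (join-left c q p))
    (cong σ (tab-cong g (λ x _ → join-right c q p x))))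

join-apart : ∀ c g q p q′ p′ →
  (∀ x → x < c → q x ≡ true → q′ x ≡ true → ⊥) → (∀ x → x < g → p x ≡ true → p′ x ≡ true → ⊥) →
  ∀ x → x < c + g → join c q p x ≡ true → join c q′ p′ x ≡ true → ⊥
join-apart c g q p q′ p′ hq hp x x<n with x <ᵇ c in e
... | true  = hq x (<ᵇ-sound x c e)
... | false = hp (x ∸ c) (+-cancelˡ-< c (x ∸ c) g (subst (_< c + g) (sym (m+[n∸m]≡n c≤x)) x<n))
  where
  c≤x : c ≤ x
  c≤x = ≮⇒≥ (λ x<c → false≢true (trans (sym e) (<ᵇ-complete x<c)))

interval : ℕ → ℕ → Points
interval a k x = (a ≤ᵇ x) ∧ (x <ᵇ a + k)

interval-bounds : ∀ a k x → interval a k x ≡ true → a ≤ x × x < a + k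
interval-bounds a k x e with ∧-true {a ≤ᵇ x} e
... | e₁ , e₂ = ≤ᵇ⇒≤ a x (subst Bool.T (sym e₁) tt) , <ᵇ-sound x (a + k) e₂

≤ᵇ-complete : ∀ {a b} → a ≤ b → (a ≤ᵇ b) ≡ true
≤ᵇ-complete {zero}  _ = refl
≤ᵇ-complete {suc a} h = <ᵇ-complete h

interval-member : ∀ a k x → a ≤ x → x < a + k → interval a k x ≡ true
interval-member a k x a≤x x<a+k rewrite ≤ᵇ-complete a≤x = <ᵇ-complete x<a+k

interval-below : ∀ a k x → x < a → interval a k x ≡ false
interval-below a k x x<a with interval a k x in e
... | false = refl
... | true  = ⊥-elim (<⇒≱ x<a (proj₁ (interval-bounds a k x e)))

interval-above : ∀ a k x → a + k ≤ x → interval a k x ≡ false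
interval-above a k x a+k≤x with interval a k x in e
... | false = refl
... | true  = ⊥-elim (<⇒≱ (proj₂ (interval-bounds a k x e)) a+k≤x)

interval-apart : ∀ a k a′ k′ x → a + k ≤ a′ → interval a k x ≡ true → interval a′ k′ x ≡ true → ⊥
interval-apart a k a′ k′ x h e e′ =
  <⇒≱ (proj₂ (interval-bounds a k x e)) (≤-trans h (proj₁ (interval-bounds a′ k′ x e′)))

interval-size : ∀ g a k → a + k ≤ g → ∑ g (λ x → ι (interval a k x)) ≡ k
interval-size g a k h = begin
  ∑ g I ≡⟨ cong (λ n → ∑ n I) (sym (m+[n∸m]≡n h)) ⟩
  ∑ (a + k + (g ∸ (a + k))) I ≡⟨ ∑-split (a + k) (g ∸ (a + k)) I ⟩
  ∑ (a + k) I + ∑ (g ∸ (a + k)) (λ x → I (a + k + x))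
    ≡⟨ cong₂ _+_ (∑-split a k I) (∑-zero (g ∸ (a + k)) (λ x _ → cong ι (interval-above a k (a + k + x) (m≤m+n _ x)))) ⟩
  ∑ a I + ∑ k (λ x → I (a + x)) + 0 ≡⟨ +-identityʳ _ ⟩
  ∑ a I + ∑ k (λ x → I (a + x))
    ≡⟨ cong₂ _+_ (∑-zero a (λ x x<a → cong ι (interval-below a k x x<a)))
         (trans (∑-cong k (λ x x<k → cong ι (interval-member a k (a + x) (m≤m+n a x) (+-monoʳ-< a x<k)))) (∑-const k 1)) ⟩
  0 + k * 1 ≡⟨ *-identityʳ k ⟩
  k ∎
  where
  open ≡-Reasoning
  I : ℕ → ℕ
  I x = ι (interval a k x)

hits gaps : ∀ {c g} → (Vec Bool (c + g) → Bool) → Vec Bool c → ℕ → ℕ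
hits {c} {g} f Q k = den g k (λ v → ι (f (Q ++ v)))
gaps {c} {g} f Q k = den g k (λ v → miss (f (Q ++ v)))

hits+gaps : ∀ {c g} (f : Vec Bool (c + g) → Bool) Q k → k ≤ g → hits f Q k + gaps f Q k ≡ g !
hits+gaps {c} {g} f Q k k≤g = begin
  w * Lev g k (λ v → ι (f (Q ++ v))) + w * Lev g k (λ v → miss (f (Q ++ v)))
    ≡⟨ sym (*-distribˡ-+ w _ _) ⟩
  w * (Lev g k (λ v → ι (f (Q ++ v))) + Lev g k (λ v → miss (f (Q ++ v))))
    ≡⟨ cong (w *_) (sym (Lev-+ g k _ _)) ⟩
  w * Lev g k (λ v → ι (f (Q ++ v)) + miss (f (Q ++ v)))
    ≡⟨ cong (w *_) (Lev-cong g k (λ v _ → ι+miss (f (Q ++ v)))) ⟩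
  w * binom g k
    ≡⟨ factorials g k k≤g ⟩
  g ! ∎
  where
  open ≡-Reasoning
  w = k ! * (g ∸ k) !

average-tab : ∀ g (h : Vec Bool g → ℕ) p k → ∑ g (λ x → ι (p x)) ≡ k → 𝔼 g (λ σ → h (σ (tab g p))) ≡ den g k h
average-tab g h p k e = trans (average g (tab g p) h) (cong (λ j → den g j h) (trans (wt-tab g p) e))

average-interval : ∀ g (h : Vec Bool g → ℕ) a k → a + k ≤ g → 𝔼 g (λ σ → h (σ (tab g (interval a k)))) ≡ den g k h
average-interval g h a k a+k≤g = average-tab g h (interval a k) k (interval-size g a k a+k≤g)

-- The local LYM inequality: under every permutation the interval of length k lies inside the one of
-- length k′, and `f` is increasing.
hits-mono : ∀ {c g s} {f : Vec Bool (c + g) → Bool} → Matchless (c + g) s f → ∀ {Q Q′ k k′} →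
  Pointwise Below Q Q′ → k ≤ k′ → k′ ≤ g → hits f Q k ≤ hits f Q′ k′
hits-mono {c} {g} {f = f} M {Q} {Q′} {k} {k′} Q≤Q′ k≤k′ k′≤g =
  subst (_≤ hits f Q′ k′) (average-interval g (λ v → ι (f (Q ++ v))) 0 k (≤-trans k≤k′ k′≤g))
    (subst (𝔼 g (λ σ → ι (f (Q ++ σ (tab g (interval 0 k))))) ≤_) (average-interval g (λ v → ι (f (Q′ ++ v))) 0 k′ k′≤g)
      (𝔼-mono g (λ σ nat → ι-mono (upward M (++⁺ Q≤Q′ (nat Below (tab-pointwise Below g (λ x _ e →
        interval-member 0 k′ x z≤n (≤-trans (proj₂ (interval-bounds 0 k x e)) k≤k′)))))))))

-- The s sets are disjoint, so under every permutation of the suffix one of them is missing.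
union-bound : ∀ {c g s} {f : Vec Bool (c + g) → Bool} → Matchless (c + g) s f → (q : ℕ → Points) (k : ℕ → ℕ) →
  (∀ i j x → i < j → j < s → x < c → q i x ≡ true → q j x ≡ true → ⊥) → ∑ s k ≤ g →
  g ! ≤ ∑ s (λ i → gaps f (tab c (q i)) (k i))
union-bound {c} {g} {s} {f} M q k q-apart fits = begin
  g ! ≡⟨ sym (*-identityʳ (g !)) ⟩
  g ! * 1 ≡⟨ sym (𝔼-const g 1) ⟩
  𝔼 g (λ _ → 1) ≤⟨ 𝔼-mono g some-missing ⟩
  𝔼 g (λ σ → ∑ s (λ i → miss (f (tab c (q i) ++ σ (tab g (slot i)))))) ≡⟨ 𝔼-∑ g s _ ⟩
  ∑ s (λ i → 𝔼 g (λ σ → miss (f (tab c (q i) ++ σ (tab g (slot i))))))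
    ≡⟨ ∑-cong s (λ i i<s → average-interval g (λ v → miss (f (tab c (q i) ++ v))) (∑ i k) (k i)
         (≤-trans (∑-≤-bound k i<s) fits)) ⟩
  ∑ s (λ i → gaps f (tab c (q i)) (k i)) ∎
  where
  open ≤-Reasoning
  slot : ℕ → Points
  slot i = interval (∑ i k) (k i)
  some-missing : ∀ σ → Natural σ → 1 ≤ ∑ s (λ i → miss (f (tab c (q i) ++ σ (tab g (slot i)))))
  some-missing σ nat with matchingOn (view-matchless c g nat M) (λ i → join c (q i) (slot i))
    (λ i j x i<j j<s x<n → join-apart c g (q i) (slot i) (q j) (slot j) (λ x x<c → q-apart i j x i<j j<s x<c)
      (λ x _ → interval-apart (∑ i k) (k i) (∑ j k) (k j) x (∑-≤-bound k i<j)) x x<n)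
  ... | i , i<s , e = ≤-trans (≤-reflexive (sym (cong miss (trans (sym (view-join c g f σ (q i) (slot i))) e))))
                        (∑-term s (λ i → miss (f (tab c (q i) ++ σ (tab g (slot i))))) i i<s)

mod-+ : ∀ a e b .{{_ : NonZero b}} → (a % b + e) % b ≡ (a + e) % b
mod-+ a e b = trans (%-distribˡ-+ (a % b) e b)
  (trans (cong (λ z → (z + e % b) % b) (m%n%n≡m%n a b)) (sym (%-distribˡ-+ a e b)))

mod-shift-injective : ∀ x y d b .{{_ : NonZero b}} → x < b → y < b → (x + d) % b ≡ (y + d) % b → x ≡ y
mod-shift-injective x y d (suc b) x<b y<b e = trans (sym (unshift x x<b))
  (trans (cong (λ z → (z + d * b) % suc b) e) (unshift y y<b))
  where
  -- After the shift by d a further shift by d * b completes a multiple of the modulus suc b.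
  unshift : ∀ x → x < suc b → ((x + d) % suc b + d * b) % suc b ≡ x
  unshift x x<b = trans (mod-+ (x + d) (d * b) (suc b))
    (trans (cong (_% suc b) (trans (+-assoc x d (d * b)) (cong (x +_) (sym (*-suc d b)))))
      (trans ([m+kn]%n≡m%n x d (suc b)) (m<n⇒m%n≡m x<b)))

infixr 6 _∪_
_∪_ : Points → Points → Points
(p ∪ q) x = p x ∨ q x

-- The blocks outside the family are ranked and given distinct tails; the b cyclic shifts of
-- this assignment use disjoint sets of pairs (block, tail) and each of them meets a non-member.
missing-pairs : ∀ {n s φ} → MatchlessOn n s φ → (A T : ℕ → Points) (b : ℕ) →
  (∀ i j x → i < j → j < s → x < n → A i x ≡ true → A j x ≡ true → ⊥) →
  (∀ c d x → c < d → d < b → x < n → T c x ≡ true → T d x ≡ true → ⊥) →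
  (∀ i c x → i < s → c < b → x < n → A i x ≡ true → T c x ≡ true → ⊥) →
  s ≤ ∑ s (λ i → ι (φ (A i))) + b →
  b ≤ ∑ s (λ i → ∑ b (λ c → miss (φ (A i ∪ T c))))
missing-pairs M A T zero _ _ _ _ = z≤n
missing-pairs {n} {s} {φ} M A T b@(suc _) A-apart T-apart AT-apart enough = begin
  b ≡⟨ sym (*-identityʳ b) ⟩
  b * 1 ≡⟨ sym (∑-const b 1) ⟩
  ∑ b (λ _ → 1) ≤⟨ ∑-mono b (λ d _ → one d) ⟩
  ∑ b (λ d → ∑ s (λ i → gap i ((d + rank i) % b))) ≡⟨ ∑-swap b s _ ⟩
  ∑ s (λ i → ∑ b (λ d → gap i ((d + rank i) % b)))
    ≡⟨ ∑-cong s (λ i _ → ∑-periodic b (λ c → gap i (c % b)) (λ x → cong (gap i) ([m+n]%n≡m%n x b)) (rank i)) ⟩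
  ∑ s (λ i → ∑ b (λ c → gap i (c % b)))
    ≡⟨ ∑-cong s (λ i _ → ∑-cong b (λ c c<b → cong (gap i) (m<n⇒m%n≡m c<b))) ⟩
  ∑ s (λ i → ∑ b (gap i)) ∎
  where
  open ≤-Reasoning
  bad : ℕ → ℕ
  bad i = miss (φ (A i))
  rank : ℕ → ℕ
  rank i = ∑ i bad
  gap : ℕ → ℕ → ℕ
  gap i c = miss (φ (A i ∪ T c))
  -- At most b blocks are non-members, so their ranks are distinct and less than b, and so are the
  -- tails they receive.
  rank≤b : rank s ≤ b
  rank≤b = +-cancelˡ-≤ (∑ s (λ i → ι (φ (A i)))) _ _ (≤-trans (≤-reflexive
    (trans (sym (∑-+ s (λ i → ι (φ (A i))) bad))
      (trans (∑-cong s (λ i _ → ι+miss (φ (A i)))) (trans (∑-const s 1) (*-identityʳ s))))) enough)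
  rank<rank : ∀ {i j} → i < j → φ (A i) ≡ false → rank i < rank j
  rank<rank {i} {j} i<j e = ≤-trans (≤-reflexive (sym (trans (cong (rank i +_) (cong miss e)) (+-comm (rank i) 1))))
    (∑-≤-bound bad i<j)
  member : ℕ → ℕ → Points
  member d i = if φ (A i) then A i else (A i ∪ T ((d + rank i) % b))
  member-cases : ∀ d i x → member d i x ≡ true → A i x ≡ true ⊎ (φ (A i) ≡ false × T ((d + rank i) % b) x ≡ true)
  member-cases d i x e with φ (A i)
  ... | true  = inj₁ e
  ... | false with ∨-true {A i x} e
  ...   | inj₁ a = inj₁ a
  ...   | inj₂ t = inj₂ (refl , t)
  T-apart′ : ∀ c d x → c ≢ d → c < b → d < b → x < n → T c x ≡ true → T d x ≡ true → ⊥
  T-apart′ c d x c≢d c<b d<b x<n tc td with <-cmp c d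
  ... | tri< c<d _ _ = T-apart c d x c<d d<b x<n tc td
  ... | tri≈ _ c≡d _ = c≢d c≡d
  ... | tri> _ _ d<c = T-apart d c x d<c c<b x<n td tc
  member-apart : ∀ d i j x → i < j → j < s → x < n → member d i x ≡ true → member d j x ≡ true → ⊥
  member-apart d i j x i<j j<s x<n ei ej with member-cases d i x ei | member-cases d j x ej
  ... | inj₁ ai       | inj₁ aj       = A-apart i j x i<j j<s x<n ai aj
  ... | inj₁ ai       | inj₂ (_ , tj) = AT-apart i ((d + rank j) % b) x (<-trans i<j j<s) (m%n<n (d + rank j) b) x<n ai tj
  ... | inj₂ (_ , ti) | inj₁ aj       = AT-apart j ((d + rank i) % b) x j<s (m%n<n (d + rank i) b) x<n aj ti
  ... | inj₂ (fi , ti) | inj₂ (fj , tj) = T-apart′ ((d + rank i) % b) ((d + rank j) % b) x different (m%n<n (d + rank i) b)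
      (m%n<n (d + rank j) b) x<n ti tj
    where
    ri<rj : rank i < rank j
    ri<rj = rank<rank i<j fi
    rj<b : rank j < b
    rj<b = ≤-trans (rank<rank j<s fj) rank≤b
    different : (d + rank i) % b ≢ (d + rank j) % b
    different e = <⇒≢ ri<rj (mod-shift-injective (rank i) (rank j) d b (<-trans ri<rj rj<b) rj<b
      (trans (cong (_% b) (+-comm (rank i) d)) (trans e (cong (_% b) (+-comm d (rank j))))))
  one : ∀ d → 1 ≤ ∑ s (λ i → gap i ((d + rank i) % b))
  one d with matchingOn M (member d) (member-apart d)
  ... | i , i<s , e = ≤-trans (≤-reflexive (sym (at-i e))) (∑-term s (λ i → gap i ((d + rank i) % b)) i i<s)
    where
    at-i : φ (member d i) ≡ false → gap i ((d + rank i) % b) ≡ 1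
    at-i e with φ (A i) in a
    ... | true  = false≢true (trans (sym e) a)
    ... | false = cong miss e

-- Comparison with 𝒫(s, m, l)

Tot : ∀ n → (Vec Bool n → ℕ) → ℕ
Tot zero    h = h []
Tot (suc n) h = Tot n (h ∘ (false ∷_)) + Tot n (h ∘ (true ∷_))

Tot-mono : ∀ n {h h′ : Vec Bool n → ℕ} → (∀ v → h v ≤ h′ v) → Tot n h ≤ Tot n h′
Tot-mono zero    H = H []
Tot-mono (suc n) H = +-mono-≤ (Tot-mono n (λ v → H (false ∷ v))) (Tot-mono n (λ v → H (true ∷ v)))

Tot-cong : ∀ n {h h′ : Vec Bool n → ℕ} → (∀ v → h v ≡ h′ v) → Tot n h ≡ Tot n h′
Tot-cong n H = ≤-antisym (Tot-mono n (λ v → ≤-reflexive (H v))) (Tot-mono n (λ v → ≤-reflexive (sym (H v))))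

Tot-zero : ∀ n {h : Vec Bool n → ℕ} → (∀ v → h v ≡ 0) → Tot n h ≡ 0
Tot-zero zero    H = H []
Tot-zero (suc n) H = cong₂ _+_ (Tot-zero n (λ v → H (false ∷ v))) (Tot-zero n (λ v → H (true ∷ v)))

Tot-+ : ∀ n (h h′ : Vec Bool n → ℕ) → Tot n (λ v → h v + h′ v) ≡ Tot n h + Tot n h′
Tot-+ zero    h h′ = refl
Tot-+ (suc n) h h′ = trans (cong₂ _+_ (Tot-+ n (h ∘ (false ∷_)) (h′ ∘ (false ∷_))) (Tot-+ n (h ∘ (true ∷_)) (h′ ∘ (true ∷_))))
  (interchange (Tot n (h ∘ (false ∷_))) (Tot n (h′ ∘ (false ∷_))) (Tot n (h ∘ (true ∷_))) (Tot n (h′ ∘ (true ∷_))))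

Tot-* : ∀ n a (h : Vec Bool n → ℕ) → Tot n (λ v → a * h v) ≡ a * Tot n h
Tot-* zero    a h = refl
Tot-* (suc n) a h = trans (cong₂ _+_ (Tot-* n a (h ∘ (false ∷_))) (Tot-* n a (h ∘ (true ∷_))))
  (sym (*-distribˡ-+ a (Tot n (h ∘ (false ∷_))) (Tot n (h ∘ (true ∷_)))))

Tot-++ : ∀ c g (h : Vec Bool (c + g) → ℕ) → Tot (c + g) h ≡ Tot c (λ Q → Tot g (λ T → h (Q ++ T)))
Tot-++ zero    g h = refl
Tot-++ (suc c) g h = cong₂ _+_ (Tot-++ c g (h ∘ (false ∷_))) (Tot-++ c g (h ∘ (true ∷_)))

Tot-levels : ∀ n (h : Vec Bool n → ℕ) → Tot n h ≡ ∑ (suc n) (λ k → Lev n k h)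
Tot-levels zero    h = refl
Tot-levels (suc n) h = sym (begin
  ∑ (suc (suc n)) (λ k → Lev (suc n) k h)
    ≡⟨ ∑-head (suc n) (λ k → Lev (suc n) k h) ⟩
  Lev n 0 h₀ + ∑ (suc n) (λ k → Lev n (suc k) h₀ + Lev n k h₁)
    ≡⟨ cong (Lev n 0 h₀ +_) (∑-+ (suc n) (λ k → Lev n (suc k) h₀) (λ k → Lev n k h₁)) ⟩
  Lev n 0 h₀ + (∑ (suc n) (λ k → Lev n (suc k) h₀) + ∑ (suc n) (λ k → Lev n k h₁))
    ≡⟨ sym (+-assoc (Lev n 0 h₀) _ _) ⟩
  Lev n 0 h₀ + ∑ (suc n) (λ k → Lev n (suc k) h₀) + ∑ (suc n) (λ k → Lev n k h₁)
    ≡⟨ cong (_+ ∑ (suc n) (λ k → Lev n k h₁)) (sym (∑-head (suc n) (λ k → Lev n k h₀))) ⟩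
  ∑ (suc n) (λ k → Lev n k h₀) + Lev n (suc n) h₀ + ∑ (suc n) (λ k → Lev n k h₁)
    ≡⟨ cong (λ z → ∑ (suc n) (λ k → Lev n k h₀) + z + ∑ (suc n) (λ k → Lev n k h₁)) (Lev-big n (suc n) h₀ ≤-refl) ⟩
  ∑ (suc n) (λ k → Lev n k h₀) + 0 + ∑ (suc n) (λ k → Lev n k h₁)
    ≡⟨ cong₂ _+_ (trans (+-identityʳ _) (sym (Tot-levels n h₀))) (sym (Tot-levels n h₁)) ⟩
  Tot n h₀ + Tot n h₁ ∎)
  where
  open ≡-Reasoning
  h₀ = h ∘ (false ∷_)
  h₁ = h ∘ (true ∷_)

Lev≤Tot : ∀ n k (h : Vec Bool n → ℕ) → Lev n k h ≤ Tot n h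
Lev≤Tot n k h with k ≤? n
... | yes k≤n = subst (Lev n k h ≤_) (sym (Tot-levels n h)) (∑-term (suc n) (λ j → Lev n j h) k (s≤s k≤n))
... | no  k≰n = subst (_≤ Tot n h) (sym (Lev-big n k h (≰⇒> k≰n))) z≤n

Lev₂≤Tot : ∀ n k (h : Vec Bool n → ℕ) → Lev n k h + Lev n (suc k) h ≤ Tot n h
Lev₂≤Tot n k h with suc k ≤? n
... | yes k<n = subst (Lev n k h + Lev n (suc k) h ≤_) (sym (Tot-levels n h))
  (≤-trans (+-monoˡ-≤ (Lev n (suc k) h) (∑-term (suc k) (λ j → Lev n j h) k ≤-refl)) (∑-≤-bound (λ j → Lev n j h) (s≤s k<n)))
... | no  k≮n = subst (_≤ Tot n h) (sym (trans (cong (Lev n k h +_) (Lev-big n (suc k) h (≰⇒> k≮n))) (+-identityʳ _)))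
    (Lev≤Tot n k h)

Tot-low : ∀ n κ {h h′ : Vec Bool n → ℕ} → (∀ v → wt v < κ → h v ≤ h′ v) → (∀ v → κ ≤ wt v → h v ≡ 0) →
  Tot n h ≤ ∑ κ (λ k → Lev n k h′)
Tot-low n κ {h} {h′} below above = begin
  Tot n h ≡⟨ Tot-levels n h ⟩
  ∑ (suc n) (λ k → Lev n k h) ≤⟨ ∑-≤-bound (λ k → Lev n k h) (m≤n+m (suc n) κ) ⟩
  ∑ (κ + suc n) (λ k → Lev n k h) ≡⟨ ∑-split κ (suc n) (λ k → Lev n k h) ⟩
  ∑ κ (λ k → Lev n k h) + ∑ (suc n) (λ j → Lev n (κ + j) h)
    ≡⟨ cong (∑ κ (λ k → Lev n k h) +_) (∑-zero (suc n) (λ j _ → vanish (κ + j) (m≤m+n κ j))) ⟩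
  ∑ κ (λ k → Lev n k h) + 0 ≡⟨ +-identityʳ _ ⟩
  ∑ κ (λ k → Lev n k h) ≤⟨ ∑-mono κ (λ k k<κ → Lev-mono n k (λ v e → below v (subst (_< κ) (sym e) k<κ))) ⟩
  ∑ κ (λ k → Lev n k h′) ∎
  where
  open ≤-Reasoning
  vanish : ∀ k → κ ≤ k → Lev n k h ≡ 0
  vanish k κ≤k = Lev-zero n k (λ v e → above v (subst (κ ≤_) (sym e) κ≤k))

empty : ∀ n → Vec Bool n
empty n = tab n (λ _ → false)

single : ∀ n → ℕ → Vec Bool n
single n i = tab n (interval i 1)

single-suc : ∀ n i → single (suc n) (suc i) ≡ false ∷ single n i
single-suc n i = cong (false ∷_) (tab-cong n (λ x _ → shifted i x))
  where
  shifted : ∀ i x → interval (suc i) 1 (suc x) ≡ interval i 1 x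
  shifted zero    x = refl
  shifted (suc i) x = refl

Lev₀ : ∀ n (h : Vec Bool n → ℕ) → Lev n 0 h ≡ h (empty n)
Lev₀ zero    h = refl
Lev₀ (suc n) h = Lev₀ n (h ∘ (false ∷_))

Lev₁ : ∀ n (h : Vec Bool n → ℕ) → Lev n 1 h ≡ ∑ n (λ i → h (single n i))
Lev₁ zero    h = refl
Lev₁ (suc n) h = begin
  Lev n 1 (h ∘ (false ∷_)) + Lev n 0 (h ∘ (true ∷_))
    ≡⟨ cong₂ _+_ (Lev₁ n (h ∘ (false ∷_))) (trans (Lev₀ n (h ∘ (true ∷_))) (cong (h ∘ (true ∷_)) (tab-cong n (λ x _ → refl)))) ⟩
  ∑ n (λ i → h (false ∷ single n i)) + h (single (suc n) 0)
    ≡⟨ +-comm _ (h (single (suc n) 0)) ⟩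
  h (single (suc n) 0) + ∑ n (λ i → h (false ∷ single n i))
    ≡⟨ cong (h (single (suc n) 0) +_) (∑-cong n (λ i _ → cong h (sym (single-suc n i)))) ⟩
  h (single (suc n) 0) + ∑ n (λ i → h (single (suc n) (suc i)))
    ≡⟨ sym (∑-head n (λ i → h (single (suc n) i))) ⟩
  ∑ (suc n) (λ i → h (single (suc n) i)) ∎
  where open ≡-Reasoning

Tot-empty-singles : ∀ n (h : Vec Bool n → ℕ) → h (empty n) + ∑ n (λ i → h (single n i)) ≤ Tot n h
Tot-empty-singles n h = subst (_≤ Tot n h) (cong₂ _+_ (Lev₀ n h) (Lev₁ n h)) (Lev₂≤Tot n 0 h)

pre : ∀ {n} → ℕ → Vec Bool n → ℕ
pre zero    v       = 0
pre (suc c) []      = 0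
pre (suc c) (b ∷ v) = ι b + pre c v

wt-++ : ∀ {c g} (Q : Vec Bool c) (T : Vec Bool g) → wt (Q ++ T) ≡ wt Q + wt T
wt-++ []      T = refl
wt-++ (b ∷ Q) T = trans (cong (ι b +_) (wt-++ Q T)) (sym (+-assoc (ι b) (wt Q) (wt T)))

pre-++ : ∀ {c g} (Q : Vec Bool c) (T : Vec Bool g) → pre c (Q ++ T) ≡ wt Q
pre-++ []      T = refl
pre-++ (b ∷ Q) T = cong (ι b +_) (pre-++ Q T)

-- Membership in 𝒫(s, m, c + 1).
heavy : ∀ {n} → ℕ → ℕ → Vec Bool n → Bool
heavy m c v = m <ᵇ wt v + pre c v

gain loss : ∀ {n} → ℕ → ℕ → (Vec Bool n → Bool) → Vec Bool n → ℕ
gain m c f v = ι (f v ∧ not (heavy m c v))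
loss m c f v = ι (heavy m c v ∧ not (f v))

-- The family with the loss added and 𝒫 with the gain added are the same union, each time split into
-- disjoint parts.
exchange : ∀ n m c (f : Vec Bool n → Bool) → Tot n (gain m c f) ≤ Tot n (loss m c f) →
  Tot n (λ v → ι (f v)) ≤ Tot n (λ v → ι (heavy m c v))
exchange n m c f gain≤loss = +-cancelʳ-≤ (Tot n (loss m c f)) _ _ (begin
  Tot n (λ v → ι (f v)) + Tot n (loss m c f) ≡⟨ sym (Tot-+ n (λ v → ι (f v)) (loss m c f)) ⟩
  Tot n (λ v → ι (f v) + loss m c f v) ≡⟨ Tot-cong n (λ v → union (f v) (heavy m c v)) ⟩
  Tot n (λ v → ι (heavy m c v) + gain m c f v) ≡⟨ Tot-+ n (λ v → ι (heavy m c v)) (gain m c f) ⟩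
  Tot n (λ v → ι (heavy m c v)) + Tot n (gain m c f) ≤⟨ +-monoʳ-≤ _ gain≤loss ⟩
  Tot n (λ v → ι (heavy m c v)) + Tot n (loss m c f) ∎)
  where
  open ≤-Reasoning
  union : ∀ a b → ι a + ι (b ∧ not a) ≡ ι b + ι (a ∧ not b)
  union true  true  = refl
  union true  false = refl
  union false true  = refl
  union false false = refl

gain≤ι : ∀ {n} m c (f : Vec Bool n → Bool) v → gain m c f v ≤ ι (f v)
gain≤ι m c f v with f v
... | false = z≤n
... | true  = ι≤1 (not (heavy m c v))

gain-heavy : ∀ {n} m c (f : Vec Bool n → Bool) v → m < wt v + pre c v → gain m c f v ≡ 0
gain-heavy m c f v h rewrite <ᵇ-complete h with f v
... | true  = refl
... | false = refl

loss-heavy : ∀ {n} m c (f : Vec Bool n → Bool) v → m < wt v + pre c v → loss m c f v ≡ miss (f v)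
loss-heavy m c f v h rewrite <ᵇ-complete h = refl

-- A crude form: every member of at most m points is charged as gain, and only the losses on levels
-- m + 1 and m + 2 are used, which lie in 𝒫 whatever their trace on the prefix.
exchange-levels : ∀ n m c (f : Vec Bool n → Bool) →
  ∑ (suc m) (λ k → Lev n k (λ v → ι (f v))) ≤ Lev n (suc m) (λ v → miss (f v)) + Lev n (suc (suc m)) (λ v → miss (f v)) →
  Tot n (λ v → ι (f v)) ≤ Tot n (λ v → ι (heavy m c v))
exchange-levels n m c f h = exchange n m c f (begin
  Tot n (gain m c f)
    ≤⟨ Tot-low n (suc m) (λ v _ → gain≤ι m c f v) (λ v m<w → gain-heavy m c f v (≤-trans m<w (m≤m+n (wt v) _))) ⟩
  ∑ (suc m) (λ k → Lev n k (λ v → ι (f v)))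
    ≤⟨ h ⟩
  Lev n (suc m) (λ v → miss (f v)) + Lev n (suc (suc m)) (λ v → miss (f v))
    ≡⟨ cong₂ _+_ (level (suc m) ≤-refl) (level (suc (suc m)) (n≤1+n (suc m))) ⟩
  Lev n (suc m) (loss m c f) + Lev n (suc (suc m)) (loss m c f)
    ≤⟨ Lev₂≤Tot n (suc m) (loss m c f) ⟩
  Tot n (loss m c f) ∎)
  where
  open ≤-Reasoning
  level : ∀ k → m < k → Lev n k (λ v → miss (f v)) ≡ Lev n k (loss m c f)
  level k m<k = Lev-cong n k (λ v e → sym (loss-heavy m c f v (≤-trans (subst (m <_) (sym e) m<k) (m≤m+n (wt v) _))))

-- Densities obtained from blocks of equal size

≤-by : ∀ {a b} z → b ≡ a + z → a ≤ b
≤-by {a} z refl = m≤m+n a z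

∪-size : ∀ g {p q : Points} → (∀ x → x < g → p x ≡ true → q x ≡ true → ⊥) →
  ∑ g (λ x → ι ((p ∪ q) x)) ≡ ∑ g (λ x → ι (p x)) + ∑ g (λ x → ι (q x))
∪-size g {p} {q} apart = trans (∑-cong g (λ x x<g → bit (p x) (q x) (apart x x<g))) (∑-+ g (λ x → ι (p x)) (λ x → ι (q x)))
  where
  bit : ∀ a b → Apart a b → ι (a ∨ b) ≡ ι a + ι b
  bit true  true  h = ⊥-elim (h refl refl)
  bit true  false h = refl
  bit false b     h = refl

-- The quotient of the two coefficients is (n - k) / (k + 1).
binom-grow : ∀ n k r → r * suc k + k ≤ n → r * binom n k ≤ binom n (suc k)
binom-grow n k r h = *-cancelˡ-≤ (suc k) (begin
  suc k * (r * binom n k) ≡⟨ regroup (suc k) r (binom n k) ⟩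
  r * suc k * binom n k ≤⟨ *-monoˡ-≤ (binom n k) (m+n≤o⇒m≤o∸n (r * suc k) h) ⟩
  (n ∸ k) * binom n k ≡⟨ sym (binom-step n k) ⟩
  suc k * binom n (suc k) ∎)
  where
  open ≤-Reasoning
  regroup : ∀ a b c → a * (b * c) ≡ b * a * c
  regroup a b c = trans (sym (*-assoc a b c)) (cong (_* c) (*-comm a b))

-- A geometric series of ratio 1 / (r + 1), whose sum after the leading term is 1 / r.
binom-below : ∀ n r m → (∀ k → k < m → suc r * binom n k ≤ binom n (suc k)) → r * ∑ m (binom n) ≤ binom n m
binom-below n r zero    h = subst (_≤ binom n 0) (sym (*-zeroʳ r)) z≤n
binom-below n r (suc m) h = begin
  r * (∑ m (binom n) + binom n m) ≡⟨ *-distribˡ-+ r (∑ m (binom n)) (binom n m) ⟩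
  r * ∑ m (binom n) + r * binom n m ≤⟨ +-monoˡ-≤ (r * binom n m) (binom-below n r m (λ k k<m → h k (m<n⇒m<1+n k<m))) ⟩
  suc r * binom n m ≤⟨ h m ≤-refl ⟩
  binom n (suc m) ∎
  where open ≤-Reasoning

-- By `hits-mono` no level below m is denser than level m.
low-levels : ∀ {c g s} {f : Vec Bool (c + g) → Bool} → Matchless (c + g) s f → ∀ Q m → m ≤ g →
  g ! * ∑ (suc m) (λ k → Lev g k (λ v → ι (f (Q ++ v)))) ≤ ∑ (suc m) (binom g) * hits f Q m
low-levels {c} {g} {f = f} M Q m m≤g = begin
  g ! * ∑ (suc m) (λ k → Lev g k (λ v → ι (f (Q ++ v)))) ≡⟨ sym (∑-* (suc m) (g !) _) ⟩
  ∑ (suc m) (λ k → g ! * Lev g k (λ v → ι (f (Q ++ v))))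
      ≡⟨ ∑-cong (suc m) (λ k _ → sym (binom-den g k (λ v → ι (f (Q ++ v))))) ⟩
  ∑ (suc m) (λ k → binom g k * hits f Q k)
    ≤⟨ ∑-mono (suc m) (λ k k≤m → *-monoʳ-≤ (binom g k) (hits-mono M (below-refl Q) (≤-pred k≤m) m≤g)) ⟩
  ∑ (suc m) (λ k → binom g k * hits f Q m) ≡⟨ ∑-cong (suc m) (λ k _ → *-comm (binom g k) (hits f Q m)) ⟩
  ∑ (suc m) (λ k → hits f Q m * binom g k) ≡⟨ ∑-* (suc m) (hits f Q m) (binom g) ⟩
  hits f Q m * ∑ (suc m) (binom g) ≡⟨ *-comm (hits f Q m) _ ⟩
  ∑ (suc m) (binom g) * hits f Q m ∎
  where
  open ≤-Reasoning

module Blocks (n s w b v : ℕ) (fits : s * w + b * v ≤ n) where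

  block tail : ℕ → Points
  block i = interval (i * w) w
  tail c  = interval (s * w + c * v) v

  block-end : ∀ {i j} → i < j → i * w + w ≤ j * w
  block-end {i} {j} i<j = subst (_≤ j * w) (+-comm w (i * w)) (*-monoˡ-≤ w i<j)

  tail-end : ∀ {c d} → c < d → s * w + c * v + v ≤ s * w + d * v
  tail-end {c} {d} c<d = subst (_≤ s * w + d * v) (sym (+-assoc (s * w) (c * v) v))
    (+-monoʳ-≤ (s * w) (subst (_≤ d * v) (+-comm v (c * v)) (*-monoˡ-≤ v c<d)))

  block-apart : ∀ i j x → i < j → block i x ≡ true → block j x ≡ true → ⊥
  block-apart i j x i<j = interval-apart (i * w) w (j * w) w x (block-end i<j)

  tail-apart : ∀ c d x → c < d → tail c x ≡ true → tail d x ≡ true → ⊥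
  tail-apart c d x c<d = interval-apart (s * w + c * v) v (s * w + d * v) v x (tail-end c<d)

  block-tail-apart : ∀ i c x → i < s → block i x ≡ true → tail c x ≡ true → ⊥
  block-tail-apart i c x i<s = interval-apart (i * w) w (s * w + c * v) v x (≤-trans (block-end i<s) (m≤m+n (s * w) (c * v)))

  block-size : ∀ i → i < s → ∑ n (λ x → ι (block i x)) ≡ w
  block-size i i<s = interval-size n (i * w) w (≤-trans (block-end i<s) (≤-trans (m≤m+n (s * w) (b * v)) fits))

  tail-size : ∀ c → c < b → ∑ n (λ x → ι (tail c x)) ≡ v
  tail-size c c<b = interval-size n (s * w + c * v) v (≤-trans (tail-end c<b) fits)

  block-tail-size : ∀ i c → i < s → c < b → ∑ n (λ x → ι ((block i ∪ tail c) x)) ≡ w + v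
  block-tail-size i c i<s c<b = trans (∪-size n {block i} {tail c} (λ x _ → block-tail-apart i c x i<s))
    (cong₂ _+_ (block-size i i<s) (tail-size c c<b))

  missing : ∀ {φ} → MatchlessOn n s φ → s ≤ ∑ s (λ i → ι (φ (block i))) + b →
    b ≤ ∑ s (λ i → ∑ b (λ c → miss (φ (block i ∪ tail c))))
  missing M = missing-pairs M block tail b (λ i j x i<j _ _ → block-apart i j x i<j) (λ c d x c<d _ _ → tail-apart c d x c<d)
    (λ i c x i<s _ _ → block-tail-apart i c x i<s)

average-pairs : ∀ n s b (f : Vec Bool n → Bool) (A : ℕ → ℕ → Points) k →
  (∀ i c → i < s → c < b → ∑ n (λ x → ι (A i c x)) ≡ k) →
  𝔼 n (λ σ → ∑ s (λ i → ∑ b (λ c → miss (view 0 n f σ (A i c))))) ≡ s * (b * gaps {0} f [] k)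
average-pairs n s b f A k size = begin
  𝔼 n (λ σ → ∑ s (λ i → ∑ b (λ c → miss (view 0 n f σ (A i c))))) ≡⟨ 𝔼-∑ n s _ ⟩
  ∑ s (λ i → 𝔼 n (λ σ → ∑ b (λ c → miss (view 0 n f σ (A i c))))) ≡⟨ ∑-cong s (λ i _ → 𝔼-∑ n b _) ⟩
  ∑ s (λ i → ∑ b (λ c → 𝔼 n (λ σ → miss (view 0 n f σ (A i c)))))
    ≡⟨ ∑-cong s (λ i i<s → ∑-cong b (λ c c<b → average-tab n (λ v → miss (f v)) (A i c) k (size i c i<s c<b))) ⟩
  ∑ s (λ i → ∑ b (λ c → gaps {0} f [] k)) ≡⟨ ∑-cong s (λ i _ → ∑-const b _) ⟩
  ∑ s (λ i → b * gaps {0} f [] k) ≡⟨ ∑-const s _ ⟩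
  s * (b * gaps {0} f [] k) ∎
  where open ≡-Reasoning

average-singles : ∀ n s (f : Vec Bool n → Bool) (A : ℕ → Points) k →
  (∀ i → i < s → ∑ n (λ x → ι (A i x)) ≡ k) →
  𝔼 n (λ σ → ∑ s (λ i → ι (view 0 n f σ (A i)))) ≡ s * hits {0} f [] k
average-singles n s f A k size = begin
  𝔼 n (λ σ → ∑ s (λ i → ι (view 0 n f σ (A i)))) ≡⟨ 𝔼-∑ n s _ ⟩
  ∑ s (λ i → 𝔼 n (λ σ → ι (view 0 n f σ (A i))))
    ≡⟨ ∑-cong s (λ i i<s → average-tab n (λ v → ι (f v)) (A i) k (size i i<s)) ⟩
  ∑ s (λ i → hits {0} f [] k) ≡⟨ ∑-const s _ ⟩
  s * hits {0} f [] k ∎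
  where open ≡-Reasoning

swap-factors : ∀ a b c → a * (b * c) ≡ b * (a * c)
swap-factors = solve-∀

-- Blocks of size m and d spare points.  If more than c blocks are members, a tail of one spare point
-- is missing somewhere; if p blocks or fewer are not members, already a tail of two spare points is.
block-density : ∀ {n s f} → Matchless n s f → ∀ m c d p → s ≡ suc c + d → s * m + d ≤ n → 0 < p → p + p ≤ d →
  s * hits {0} f [] m ≤ n ! * c + (d ∸ p) * (s * gaps {0} f [] (suc m)) + s * (s * gaps {0} f [] (suc (suc m)))
block-density {n} {s} {f} M m c d p s≡ fits 0<p 2p≤d = begin
  s * hits {0} f [] m ≡⟨ sym (average-singles n s f W₁.block m W₁.block-size) ⟩
  𝔼 n X ≤⟨ 𝔼-mono n (λ σ _ → pointwise σ) ⟩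
  𝔼 n (λ σ → c + (d ∸ p) * e₁ σ + s * e₂ σ) ≡⟨ 𝔼-+ n (λ σ → c + (d ∸ p) * e₁ σ) (λ σ → s * e₂ σ) ⟩
  𝔼 n (λ σ → c + (d ∸ p) * e₁ σ) + 𝔼 n (λ σ → s * e₂ σ)
    ≡⟨ cong₂ _+_ (trans (𝔼-+ n (λ _ → c) (λ σ → (d ∸ p) * e₁ σ)) (cong₂ _+_ (𝔼-const n c) (𝔼-* n (d ∸ p) e₁))) (𝔼-* n s e₂) ⟩
  n ! * c + (d ∸ p) * 𝔼 n e₁ + s * 𝔼 n e₂
    ≤⟨ +-mono-≤ (+-monoʳ-≤ (n ! * c) (*-monoʳ-≤ (d ∸ p) 𝔼e₁)) (*-monoʳ-≤ s 𝔼e₂) ⟩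
  n ! * c + (d ∸ p) * (s * gaps {0} f [] (suc m)) + s * (s * gaps {0} f [] (suc (suc m))) ∎
  where
  open ≤-Reasoning
  p≤d : p ≤ d
  p≤d = ≤-trans (m≤m+n p p) 2p≤d
  module W₁ = Blocks n s m d 1 (subst (λ z → s * m + z ≤ n) (sym (*-identityʳ d)) fits)
  module W₂ = Blocks n s m p 2
      (≤-trans (+-monoʳ-≤ (s * m) (≤-trans (≤-reflexive (trans (*-comm p 2) (cong (p +_) (+-identityʳ p)))) 2p≤d)) fits)
  X e₁ e₂ M₁ M₂ : Act n → ℕ
  X σ = ∑ s (λ i → ι (view 0 n f σ (W₁.block i)))
  e₁ σ = ι (c <ᵇ X σ)
  e₂ σ = ι (c + (d ∸ p) <ᵇ X σ)
  M₁ σ = ∑ s (λ i → ∑ d (λ t → miss (view 0 n f σ (W₁.block i ∪ W₁.tail t))))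
  M₂ σ = ∑ s (λ i → ∑ p (λ t → miss (view 0 n f σ (W₂.block i ∪ W₂.tail t))))
  ≤s : ∀ σ → X σ ≤ s
  ≤s σ = subst (X σ ≤_) (trans (∑-const s 1) (*-identityʳ s)) (∑-mono s (λ i _ → ι≤1 _))
  -- X is at most c, c + (d - p) or s, according to the thresholds it passes. The last jump is
  -- really p + 1; it is paid with s, which level m + 2 is large enough to bear.
  pointwise : ∀ σ → X σ ≤ c + (d ∸ p) * e₁ σ + s * e₂ σ
  pointwise σ with c + (d ∸ p) <ᵇ X σ in e
  ... | true  = ≤-trans (≤-trans (≤s σ) (≤-reflexive (sym (*-identityʳ s)))) (m≤n+m (s * 1) _)
  ... | false with c <ᵇ X σ in e′
  ...   | true  = ≤-trans (≮⇒≥ (λ lt → false≢true (trans (sym e) (<ᵇ-complete lt))))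
                    (≤-trans (+-monoʳ-≤ c (≤-reflexive (sym (*-identityʳ (d ∸ p))))) (m≤m+n _ _))
  ...   | false = ≤-trans (≮⇒≥ (λ lt → false≢true (trans (sym e′) (<ᵇ-complete lt)))) (≤-trans (m≤m+n c _) (m≤m+n _ _))
  d*e₁≤M₁ : ∀ σ → Natural σ → d * e₁ σ ≤ M₁ σ
  d*e₁≤M₁ σ nat with c <ᵇ X σ in e
  ... | false = ≤-trans (≤-reflexive (*-zeroʳ d)) z≤n
  ... | true  = ≤-trans (≤-reflexive (*-identityʳ d)) (W₁.missing (view-matchless 0 n nat M)
                  (subst (_≤ X σ + d) (sym s≡) (+-monoˡ-≤ d (<ᵇ-sound c (X σ) e))))
  p*e₂≤M₂ : ∀ σ → Natural σ → p * e₂ σ ≤ M₂ σ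
  p*e₂≤M₂ σ nat with c + (d ∸ p) <ᵇ X σ in e
  ... | false = ≤-trans (≤-reflexive (*-zeroʳ p)) z≤n
  ... | true  = ≤-trans (≤-reflexive (*-identityʳ p)) (W₂.missing (view-matchless 0 n nat M)
                  (≤-trans (≤-reflexive
                      (trans s≡ (trans (cong (suc c +_) (sym (m∸n+n≡m p≤d))) (sym (+-assoc (suc c) (d ∸ p) p)))))
                           (+-monoˡ-≤ p (<ᵇ-sound (c + (d ∸ p)) (X σ) e))))
  𝔼e₁ : 𝔼 n e₁ ≤ s * gaps {0} f [] (suc m)
  𝔼e₁ = *-cancelˡ-≤ d {{>-nonZero (≤-trans 0<p p≤d)}} (begin
    d * 𝔼 n e₁ ≡⟨ sym (𝔼-* n d e₁) ⟩
    𝔼 n (λ σ → d * e₁ σ) ≤⟨ 𝔼-mono n d*e₁≤M₁ ⟩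
    𝔼 n M₁ ≡⟨ average-pairs n s d f (λ i t → W₁.block i ∪ W₁.tail t) (suc m)
        (λ i t i<s t<d → trans (W₁.block-tail-size i t i<s t<d) (+-comm m 1)) ⟩
    s * (d * gaps {0} f [] (suc m)) ≡⟨ swap-factors s d (gaps {0} f [] (suc m)) ⟩
    d * (s * gaps {0} f [] (suc m)) ∎)
  𝔼e₂ : 𝔼 n e₂ ≤ s * gaps {0} f [] (suc (suc m))
  𝔼e₂ = *-cancelˡ-≤ p {{>-nonZero 0<p}} (begin
    p * 𝔼 n e₂ ≡⟨ sym (𝔼-* n p e₂) ⟩
    𝔼 n (λ σ → p * e₂ σ) ≤⟨ 𝔼-mono n p*e₂≤M₂ ⟩
    𝔼 n M₂ ≡⟨ average-pairs n s p f (λ i t → W₂.block i ∪ W₂.tail t) (suc (suc m))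
        (λ i t i<s t<p → trans (W₂.block-tail-size i t i<s t<p) (+-comm m 2)) ⟩
    s * (p * gaps {0} f [] (suc (suc m))) ≡⟨ swap-factors s p (gaps {0} f [] (suc (suc m))) ⟩
    p * (s * gaps {0} f [] (suc (suc m))) ∎)

-- One set of size m and t sets of size m + 2 cannot all be members.
small-set-density : ∀ {n t f} → Matchless n (suc t) f → ∀ m → m + t * suc (suc m) ≤ n →
  hits {0} f [] m ≤ t * gaps {0} f [] (suc (suc m))
small-set-density {n} {t} {f} M m fits = +-cancelʳ-≤ (gaps {0} f [] m) _ _ (begin
  hits {0} f [] m + gaps {0} f [] m ≡⟨ hits+gaps {0} f [] m (≤-trans (m≤m+n m _) fits) ⟩
  n ! ≤⟨ union-bound {0} M (λ _ _ → false) k (λ i j x i<j j<s ()) sizes ⟩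
  ∑ (suc t) (λ i → gaps {0} f [] (k i)) ≡⟨ ∑-head t (λ i → gaps {0} f [] (k i)) ⟩
  gaps {0} f [] m + ∑ t (λ _ → gaps {0} f [] (suc (suc m))) ≡⟨ cong (gaps {0} f [] m +_) (∑-const t _) ⟩
  gaps {0} f [] m + t * gaps {0} f [] (suc (suc m)) ≡⟨ +-comm (gaps {0} f [] m) _ ⟩
  t * gaps {0} f [] (suc (suc m)) + gaps {0} f [] m ∎)
  where
  open ≤-Reasoning
  k : ℕ → ℕ
  k zero    = m
  k (suc _) = suc (suc m)
  sizes : ∑ (suc t) k ≤ n
  sizes = ≤-trans (≤-reflexive (trans (∑-head t k) (cong (m +_) (∑-const t (suc (suc m)))))) fits

-- The case l = 1

≤⇒∃ : ∀ {a b} → a ≤ b → Σ ℕ λ z → b ≡ a + z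
≤⇒∃ {a} {b} h = b ∸ a , sym (m+[n∸m]≡n h)

kleitman-ring₁ : ∀ e T L N → suc e * T * (L + N) ≡ suc e * (T * L) + suc e * (T * N)
kleitman-ring₁ = solve-∀

kleitman-ring₂ : ∀ e E g → suc e * (E * (suc (suc e) * g)) ≡ suc e * E * (suc (suc e) * g)
kleitman-ring₂ = solve-∀

kleitman-ring₃ : ∀ e C g g′ → suc e * (suc (suc e) * C * g + suc (suc (suc e)) * C * g′)
  ≡ C * (suc (suc e) * g) + suc e * (C * (e * g + suc (suc (suc e)) * g′)) + e * C * g
kleitman-ring₃ = solve-∀

kleitman-ring₄ : ∀ e T Y Y′ → suc e * (T * Y + T * Y′) ≡ suc e * T * (Y + Y′)
kleitman-ring₄ = solve-∀

-- Here and in the later arithmetic lemmas T = n !, the C's are binomial coefficients, h and g are densities of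
-- members and of non-members, and L, N, Y are numbers of sets; ⁺ marks the next level.
kleitman-arithmetic : ∀ e T E h h⁺ g g⁺ C C₁ C₂ L N Y Y⁺ → NonZero T →
  T * L ≤ E * h → C * h⁺ ≡ T * N → C₁ * g ≡ T * Y → C₂ * g⁺ ≡ T * Y⁺ →
  h ≤ suc (suc e) * g → h⁺ ≤ e * g + suc (suc (suc e)) * g⁺ →
  suc e * E ≤ C → suc (suc e) * C ≤ C₁ → suc (suc (suc e)) * C ≤ C₂ → L + N ≤ Y + Y⁺
kleitman-arithmetic e T E h h⁺ g g⁺ C C₁ C₂ L N Y Y⁺ T≢0 low level loss₁ loss₂ h≤ h⁺≤ E≤ C₁≥ C₂≥ =
  *-cancelˡ-≤ (suc e * T) {{m*n≢0 (suc e) T {{_}} {{T≢0}}}} (begin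
    suc e * T * (L + N) ≡⟨ kleitman-ring₁ e T L N ⟩
    suc e * (T * L) + suc e * (T * N) ≤⟨ +-mono-≤ (*-monoʳ-≤ (suc e) (≤-trans low (*-monoʳ-≤ E h≤)))
        (*-monoʳ-≤ (suc e) (≤-trans (≤-reflexive (sym level)) (*-monoʳ-≤ C h⁺≤))) ⟩
    suc e * (E * (suc (suc e) * g)) + suc e * (C * (e * g + suc (suc (suc e)) * g⁺))
      ≡⟨ cong (_+ suc e * (C * (e * g + suc (suc (suc e)) * g⁺))) (kleitman-ring₂ e E g) ⟩
    suc e * E * (suc (suc e) * g) + suc e * (C * (e * g + suc (suc (suc e)) * g⁺))
      ≤⟨ +-monoˡ-≤ _ (*-monoˡ-≤ (suc (suc e) * g) E≤) ⟩
    C * (suc (suc e) * g) + suc e * (C * (e * g + suc (suc (suc e)) * g⁺))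
      ≤⟨ ≤-by (e * C * g) (kleitman-ring₃ e C g g⁺) ⟩
    suc e * (suc (suc e) * C * g + suc (suc (suc e)) * C * g⁺)
      ≤⟨ *-monoʳ-≤ (suc e) (+-mono-≤ (*-monoˡ-≤ g C₁≥) (*-monoˡ-≤ g⁺ C₂≥)) ⟩
    suc e * (C₁ * g + C₂ * g⁺) ≡⟨ cong₂ (λ a b → suc e * (a + b)) loss₁ loss₂ ⟩
    suc e * (T * Y + T * Y⁺) ≡⟨ kleitman-ring₄ e T Y Y⁺ ⟩
    suc e * T * (Y + Y⁺) ∎)
  where open ≤-Reasoning

kleitman-ring₅ : ∀ e k j → suc (suc (suc e)) * suc (k + j) + suc (suc e)
    ≡ (suc (suc e) * suc k + k) + (suc (suc e) * suc j + j + 1)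
kleitman-ring₅ = solve-∀

kleitman-ring₆ : ∀ e m → suc (suc (suc e)) * suc m + suc (suc e) ≡ suc (suc e) * suc (suc m) + suc m
kleitman-ring₆ = solve-∀

kleitman-ring₇ : ∀ e m → suc (suc (suc (4 + e))) * suc m + suc (suc (4 + e))
    ≡ 2 * suc (suc (suc m)) + suc (suc m) + (5 + 4 * m + e * m + 2 * e)
kleitman-ring₇ = solve-∀

kleitman-ring₈ : ∀ e m → suc (suc (suc e)) * suc m + suc (suc e) ≡ m + suc (suc e) * suc (suc m) + 1
kleitman-ring₈ = solve-∀

kleitman-ring₉ : ∀ e T g g⁺ → T * 0 + e * (suc (suc (suc e)) * g) + suc (suc (suc e)) * (suc (suc (suc e)) * g⁺)
    ≡ suc (suc (suc e)) * (e * g + suc (suc (suc e)) * g⁺)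
kleitman-ring₉ = solve-∀

kleitman-ring₁₀ : ∀ e C → 2 * (suc (suc e) * C) ≡ suc (suc (suc e)) * C + suc e * C
kleitman-ring₁₀ = solve-∀

-- Kleitman's theorem for n congruent to -1 modulo s. The variable m is one less than the parameter
-- of 𝒫, and the offset 4 amounts to s ≥ 7, which condition (iii) gives for l = 1.
kleitman : ∀ e m f → let d = suc (suc (4 + e)) in let n = suc d * suc m + d in
  Matchless n (suc d) f → Tot n (λ v → ι (f v)) ≤ Tot n (λ v → ι (heavy (suc m) 0 v))
kleitman e′ m f M = exchange-levels n (suc m) 0 f
  (kleitman-arithmetic e (n !) (∑ (suc m) (binom n)) (hits {0} f [] m) (hits {0} f [] (suc m))
    (gaps {0} f [] (suc (suc m))) (gaps {0} f [] (suc (suc (suc m))))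
    (binom n (suc m)) (binom n (suc (suc m))) (binom n (suc (suc (suc m)))) _ _ _ _ (n !≢0)
    (low-levels {0} M [] m (≤-trans (m≤m+n m _) (≤-by 1 (kleitman-ring₈ e m))))
    (binom-den n (suc m) (λ v → ι (f v))) (binom-den n (suc (suc m)) (λ v → miss (f v)))
        (binom-den n (suc (suc (suc m))) (λ v → miss (f v)))
    (small-set-density M m (≤-by 1 (kleitman-ring₈ e m)))
    (*-cancelˡ-≤ (suc (suc (suc e))) (≤-trans
      -- The choice p = 2 is the least that works: with p = 1 the coefficients of g would add up to
      -- e² + 3 e + 3, against the available (e + 1)(e + 2).
      (block-density M (suc m) 0 (suc (suc e)) 2 refl ≤-refl (s≤s z≤n) (s≤s (s≤s (s≤s (s≤s z≤n)))))
      (≤-reflexive (kleitman-ring₉ e (n !) (gaps {0} f [] (suc (suc m))) (gaps {0} f [] (suc (suc (suc m))))))))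
    (binom-below n (suc e) (suc m) growth)
    grow₁
    (≤-trans (≤-by (suc e * binom n (suc m)) (kleitman-ring₁₀ e (binom n (suc m))))
      (≤-trans (*-monoʳ-≤ 2 grow₁) (binom-grow n (suc (suc m)) 2 (≤-by _ (kleitman-ring₇ e′ m))))))
  where
  e = 4 + e′
  n = suc (suc (suc e)) * suc m + suc (suc e)
  growth : ∀ k → k < suc m → suc (suc e) * binom n k ≤ binom n (suc k)
  growth k (s≤s k≤m) with ≤⇒∃ k≤m
  ... | j , refl = binom-grow n k (suc (suc e)) (≤-by _ (kleitman-ring₅ e k j))
  grow₁ : suc (suc e) * binom n (suc m) ≤ binom n (suc (suc m))
  grow₁ = binom-grow n (suc m) (suc (suc e)) (≤-reflexive (sym (kleitman-ring₆ e m)))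

-- The case l = 2

last-hit : ∀ t k (β : ℕ → Bool) → suc k ≤ ∑ t (λ i → ι (β i)) → Σ ℕ λ r → r < t × β r ≡ true × k ≤ ∑ r (λ i → ι (β i))
last-hit zero    k β ()
last-hit (suc t) k β h with β t in e
... | true  = t , ≤-refl , e , ≤-pred (≤-trans h (≤-reflexive (+-comm _ 1)))
... | false with last-hit t k β (≤-trans h (≤-reflexive (+-identityʳ _)))
...   | r , r<t , er , hr = r , m<n⇒m<1+n r<t , er , hr

two-terms : ∀ s (f : ℕ → ℕ) i i′ → i < i′ → i′ < s → f i + f i′ ≤ ∑ s f
two-terms s f i i′ i<i′ i′<s = ≤-trans (+-monoˡ-≤ (f i′) (∑-term i′ f i i<i′)) (∑-≤-bound f i′<s)

two-hits : ∀ s (β : ℕ → Bool) i i′ → i < i′ → i′ < s → β i ≡ true → β i′ ≡ true → 2 ≤ ∑ s (λ x → ι (β x))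
two-hits s β i i′ i<i′ i′<s e e′ = ≤-trans (≤-reflexive (sym (cong₂ _+_ (cong ι e) (cong ι e′))))
    (two-terms s (λ x → ι (β x)) i i′ i<i′ i′<s)

sparse : ∀ s m (h : ℕ → ℕ) → 0 < m → ∑ s (λ e → h (e * m)) ≤ ∑ (s * m) h
sparse zero    m       h _ = z≤n
sparse (suc s) (suc m) h _ = begin
  ∑ s (λ e → h (e * suc m)) + h (s * suc m)
      ≤⟨ +-mono-≤ (sparse s (suc m) h (s≤s z≤n)) (≤-reflexive (cong h (sym (+-identityʳ (s * suc m))))) ⟩
  ∑ (s * suc m) h + h (s * suc m + 0) ≤⟨ +-monoʳ-≤ (∑ (s * suc m) h) (∑-term (suc m) (λ x → h (s * suc m + x)) 0 (s≤s z≤n)) ⟩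
  ∑ (s * suc m) h + ∑ (suc m) (λ x → h (s * suc m + x)) ≡⟨ sym (∑-split (s * suc m) (suc m) h) ⟩
  ∑ (s * suc m + suc m) h ≡⟨ cong (λ z → ∑ z h) (+-comm (s * suc m) (suc m)) ⟩
  ∑ (suc s * suc m) h ∎
  where open ≤-Reasoning

∑-parity : ∀ k (h : ℕ → ℕ) → ∑ (k + k) h ≡ ∑ k (λ j → h (j + j)) + ∑ k (λ j → h (suc (j + j)))
∑-parity zero    h = refl
∑-parity (suc k) h = begin
  ∑ (suc k + suc k) h ≡⟨ cong (λ z → ∑ (suc z) h) (+-suc k k) ⟩
  ∑ (k + k) h + h (k + k) + h (suc (k + k)) ≡⟨ cong (λ z → z + h (k + k) + h (suc (k + k))) (∑-parity k h) ⟩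
  ∑ k (λ j → h (j + j)) + ∑ k (λ j → h (suc (j + j))) + h (k + k) + h (suc (k + k))
    ≡⟨ regroup (∑ k (λ j → h (j + j))) _ _ _ ⟩
  ∑ k (λ j → h (j + j)) + h (k + k) + (∑ k (λ j → h (suc (j + j))) + h (suc (k + k))) ∎
  where
  open ≡-Reasoning
  regroup : ∀ a b c d → a + b + c + d ≡ a + c + (b + d)
  regroup a b c d = trans (+-assoc (a + b) c d) (interchange a b c d)

pos₁ : ∀ e m j q d i → e * m + (j + q * m + (m + d)) + i * m ≡ j + (m + d) + (e + i + q) * m
pos₁ = solve-∀

pos₂ : ∀ j m d w → j + (m + d) + (suc d + w) * m ≡ j + w * m + ((2 + d) * m + d)
pos₂ = solve-∀

-- A periodic 0-1 sequence b, read through the windows j, j + m, …, j + (s - 1) m, where s = d + 2.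
module Windows (d m : ℕ) (0<m : 0 < m) (b : ℕ → Bool) (periodic : ∀ a → b (a + ((2 + d) * m + d)) ≡ b a) where

  s n : ℕ
  s = 2 + d
  n = s * m + d

  X : ℕ → ℕ
  X j = ∑ s (λ i → ι (b (j + i * m)))

  many full : ℕ → ℕ
  many j = ι (1 <ᵇ X j)
  full j = ι (d <ᵇ X j)

  X-periodic : ∀ j → X (j + n) ≡ X j
  X-periodic j = ∑-cong s (λ i _ → cong ι (trans (cong b (move j (i * m) n)) (periodic (j + i * m))))
    where
    move : ∀ a b c → a + c + b ≡ a + b + c
    move a b c = trans (+-assoc a c b) (trans (cong (a +_) (+-comm c b)) (sym (+-assoc a b c)))

  X-total : ∑ n X ≡ s * ∑ n (λ a → ι (b a))
  X-total = begin
    ∑ n (λ j → ∑ s (λ i → ι (b (j + i * m)))) ≡⟨ ∑-swap n s _ ⟩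
    ∑ s (λ i → ∑ n (λ j → ι (b (j + i * m))))
        ≡⟨ ∑-cong s (λ i _ → ∑-periodic n (λ a → ι (b a)) (λ a → cong ι (periodic a)) (i * m)) ⟩
    ∑ s (λ i → ∑ n (λ a → ι (b a))) ≡⟨ ∑-const s _ ⟩
    s * ∑ n (λ a → ι (b a)) ∎
    where open ≡-Reasoning

  many-if : ∀ j → 2 ≤ X j → 1 ≤ many j
  many-if j h = ≤-reflexive (sym (cong ι (<ᵇ-complete h)))

  -- A window with three hits at positions p < q < r: every window through the middle one has two hits.
  many-windows : ∀ j → 3 ≤ X j → s ≤ ∑ n many
  many-windows j h with last-hit s 2 (λ i → b (j + i * m)) h
  ... | r , r<s , br , hr with last-hit r 1 (λ i → b (j + i * m)) hr
  ...   | q , q<r , bq , hq with last-hit q 0 (λ i → b (j + i * m)) hq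
  ...     | p , p<q , bp , _ = begin
    s ≡⟨ sym (*-identityʳ s) ⟩
    s * 1 ≡⟨ sym (∑-const s 1) ⟩
    ∑ s (λ _ → 1) ≤⟨ ∑-mono s (λ e e<s → many-if (e * m + base) (two e e<s)) ⟩
    ∑ s (λ e → many (e * m + base)) ≤⟨ sparse s m (λ x → many (x + base)) 0<m ⟩
    ∑ (s * m) (λ x → many (x + base)) ≤⟨ ∑-≤-bound (λ x → many (x + base)) (m≤m+n (s * m) d) ⟩
    ∑ n (λ x → many (x + base)) ≡⟨ ∑-periodic n many (λ x → cong (λ z → ι (1 <ᵇ z)) (X-periodic x)) base ⟩
    ∑ n many ∎
    where
    open ≤-Reasoning
    -- The windows that contain the middle hit start at e m + base for e < s. Here base is j + q m -
    -- (d + 1) m modulo n, and n - (d + 1) m = m + d.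
    base : ℕ
    base = j + q * m + (m + d)
    hit : ∀ e i w → b (j + w * m) ≡ true → e + i + q ≡ suc d + w → b (e * m + base + i * m) ≡ true
    hit e i w bw eq = trans (cong b position) (trans (periodic (j + w * m)) bw)
      where
      position : e * m + base + i * m ≡ j + w * m + n
      position = begin-equality
        e * m + (j + q * m + (m + d)) + i * m ≡⟨ pos₁ e m j q d i ⟩
        j + (m + d) + (e + i + q) * m ≡⟨ cong (λ z → j + (m + d) + z * m) eq ⟩
        j + (m + d) + (suc d + w) * m ≡⟨ pos₂ j m d w ⟩
        j + w * m + ((2 + d) * m + d) ∎
    order : ∀ e i i′ {w w′} → e + i + q ≡ suc d + w → e + i′ + q ≡ suc d + w′ → w < w′ → i < i′
    order e i i′ {w} {w′} eq eq′ w<w′ = +-cancelˡ-< e i i′ (+-cancelʳ-< q (e + i) (e + i′)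
      (subst (_< e + i′ + q) (sym eq) (subst (suc d + w <_) (sym eq′) (+-monoʳ-< (suc d) w<w′))))
    solve-for : ∀ e w → e + q ≤ suc d + w → Σ ℕ λ i → e + i + q ≡ suc d + w
    solve-for e w h with ≤⇒∃ h
    ... | i , eq = i , trans (trans (+-assoc e i q) (trans (cong (e +_) (+-comm i q)) (sym (+-assoc e q i)))) (sym eq)
    small : ∀ e i w → e + i + q ≡ suc d + w → w ≤ e + q → i < s
    small e i w eq w≤ = s≤s (+-cancelʳ-≤ (e + q) i (suc d) (≤-trans (≤-reflexive (trans (+-comm i (e + q))
      (trans (+-assoc e q i) (trans (cong (e +_) (+-comm q i)) (sym (+-assoc e i q))))))
          (≤-trans (≤-reflexive eq) (+-monoʳ-≤ (suc d) w≤))))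
    -- Besides the hit q, the window also catches p if it starts early enough, and otherwise r.
    two : ∀ e → e < s → 2 ≤ X (e * m + base)
    two e e<s with solve-for e q (+-monoˡ-≤ q (≤-pred e<s)) | e + q ≤? suc d + p
    ... | i , eq | yes h with solve-for e p h
    ...   | i′ , eq′ = two-hits s (λ x → b (e * m + base + x * m)) i′ i (order e i′ i eq′ eq p<q) (small e i q eq (m≤n+m q e))
                         (hit e i′ p bp eq′) (hit e i q bq eq)
    two e e<s | i , eq | no h with solve-for e r (+-mono-≤ (≤-pred e<s) (<⇒≤ q<r))
    ...   | i′ , eq′ = two-hits s (λ x → b (e * m + base + x * m)) i i′ (order e i i′ eq eq′ q<r)
                         (small e i′ r eq′ (≤-trans (≤-trans (<⇒≤ r<s) (s≤s (m≤m+n (suc d) p))) (≰⇒> h)))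
                         (hit e i q bq eq) (hit e i′ r br eq′)

  many-or-one : ∀ j → X j ≤ 2 → X j ≤ 1 + many j
  many-or-one j h with X j
  ... | zero                = z≤n
  ... | suc zero            = s≤s z≤n
  ... | suc (suc zero)      = ≤-refl
  ... | suc (suc (suc _))   = ⊥-elim (<⇒≱ (s≤s (s≤s (s≤s z≤n))) h)

count-ring₁ : ∀ e m N N′ → let d = suc (suc e) in
  d * ((2 + d) * m + d + suc e * N + N′) + suc e * N ≡ d * ((2 + d) * m) + (suc d * suc e) * N + d * N′ + d * d
count-ring₁ = solve-∀

count-ring₂ : ∀ e z → suc e * (2 + suc (suc e) + z) ≡ suc (suc e) * suc (suc e) + (e + suc e * z)
count-ring₂ = solve-∀

count-ring₃ : ∀ e m k z → let d = 3 + e in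
  d * ((2 + d) * m) + (suc d * (2 + e)) * (2 + (2 + d) * k + z) ≡ d * ((2 + d) * (suc m + k))
    + (1 + 4 * e + 25 * k + 8 * z + e * e + 30 * e * k + 6 * e * z + 10 * e * e * k + e * e * z + e * e * e * k)
count-ring₃ = solve-∀

count-ring₄ : ∀ m k z → 2 * (4 * m) + 3 * 1 * (2 + 4 * suc k + z) ≡ 2 * (4 * (suc m + suc k)) + (2 + 4 * k + 3 * z)
count-ring₄ = solve-∀

count-ring₅ : ∀ m z → 2 * (4 * m) + 3 * 1 * (3 + z) ≡ 2 * (4 * (suc m + 0)) + (1 + 3 * z)
count-ring₅ = solve-∀

count-ring₆ : ∀ d m k → (2 + d) * (suc m + k) ≡ (2 + d) * m + d + (2 + (2 + d) * k)
count-ring₆ = solve-∀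

count-ring₇ : ∀ q → 4 * (q * 2) + 2 ≡ (4 * q + 1) + (4 * q + 1)
count-ring₇ = solve-∀

count-ring₈ : ∀ δ j i q → δ + (j + j) + i * (q * 2) ≡ δ + ((j + i * q) + (j + i * q))
count-ring₈ = solve-∀

count-ring₉ : ∀ δ j q → δ + ((j + (4 * q + 1)) + (j + (4 * q + 1))) ≡ δ + (j + j) + (4 * (q * 2) + 2)
count-ring₉ = solve-∀

count-ring₁₀ : ∀ q z → 4 * (suc q + z) ≡ (4 * q + 1) + (3 + 4 * z)
count-ring₁₀ = solve-∀

-- Here s = 4, d = 2 and m = 2 q. Then n = 8 q + 2 is even, and every window stays inside one of the
-- two parity classes, each of 4 q + 1 positions.
module Parity (q : ℕ) (0<m : 0 < q * 2) (b : ℕ → Bool) (periodic : ∀ a → b (a + (4 * (q * 2) + 2)) ≡ b a) where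
  open Windows 2 (q * 2) 0<m b periodic

  half : ℕ
  half = 4 * q + 1

  hitsIn manyIn : ℕ → ℕ
  hitsIn δ = ∑ half (λ j → ι (b (δ + (j + j))))
  manyIn δ = ∑ half (λ j → many (δ + (j + j)))

  X-class : ∀ δ → ∑ half (λ j → X (δ + (j + j))) ≡ 4 * hitsIn δ
  X-class δ = begin
    ∑ half (λ j → ∑ 4 (λ i → ι (b (δ + (j + j) + i * (q * 2)))))
      ≡⟨ ∑-swap half 4 (λ j i → ι (b (δ + (j + j) + i * (q * 2)))) ⟩
    ∑ 4 (λ i → ∑ half (λ j → ι (b (δ + (j + j) + i * (q * 2)))))
      ≡⟨ ∑-cong 4 (λ i _ → ∑-cong half (λ j _ → cong (λ z → ι (b z)) (count-ring₈ δ j i q))) ⟩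
    ∑ 4 (λ i → ∑ half (λ j → ι (b (δ + ((j + i * q) + (j + i * q))))))
      ≡⟨ ∑-cong 4 (λ i _ → ∑-periodic half (λ j → ι (b (δ + (j + j))))
           (λ j → cong ι (trans (cong b (count-ring₉ δ j q)) (periodic (δ + (j + j))))) (i * q)) ⟩
    ∑ 4 (λ i → hitsIn δ)
      ≡⟨ ∑-const 4 (hitsIn δ) ⟩
    4 * hitsIn δ ∎
    where open ≡-Reasoning

  class-bound : ∀ δ → δ ≤ 1 → (∀ j → j < n → X j ≤ 2) → 4 * hitsIn δ ≤ half + manyIn δ
  class-bound δ δ≤1 ≤2 = begin
    4 * hitsIn δ ≡⟨ sym (X-class δ) ⟩
    ∑ half (λ j → X (δ + (j + j))) ≤⟨ ∑-mono half (λ j j<half → many-or-one (δ + (j + j)) (≤2 _ (inside j j<half))) ⟩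
    ∑ half (λ j → 1 + many (δ + (j + j))) ≡⟨ ∑-+ half (λ _ → 1) (λ j → many (δ + (j + j))) ⟩
    ∑ half (λ _ → 1) + manyIn δ ≡⟨ cong (_+ manyIn δ) (trans (∑-const half 1) (*-identityʳ half)) ⟩
    half + manyIn δ ∎
    where
    open ≤-Reasoning
    inside : ∀ j → j < half → δ + (j + j) < n
    inside j j<half = subst (δ + (j + j) <_) (sym (count-ring₇ q))
      (≤-trans (s≤s (+-monoˡ-≤ (j + j) δ≤1)) (≤-trans (≤-reflexive (sym (cong suc (+-suc j j)))) (+-mono-≤ j<half j<half)))

  many-large : ∀ δ → δ ≤ 1 → (∀ j → j < n → X j ≤ 2) → suc q ≤ hitsIn δ → 3 ≤ manyIn δ
  many-large δ δ≤1 ≤2 h with ≤⇒∃ h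
  ... | z , eq = +-cancelˡ-≤ half 3 (manyIn δ) (begin
    half + 3 ≤⟨ +-monoʳ-≤ half (m≤m+n 3 (4 * z)) ⟩
    half + (3 + 4 * z) ≡⟨ sym (count-ring₁₀ q z) ⟩
    4 * (suc q + z) ≡⟨ cong (4 *_) (sym eq) ⟩
    4 * hitsIn δ ≤⟨ class-bound δ δ≤1 ≤2 ⟩
    half + manyIn δ ∎)
    where open ≤-Reasoning

  -- m is even, so shifting by m preserves the parity of a position; the more popular parity class
  -- of 2q + 1 = m + 1 hits has at least q + 1 of them.
  three-many : (∀ j → j < n → X j ≤ 2) → ∑ n (λ a → ι (b a)) ≡ suc (q * 2) → 3 ≤ ∑ n many
  three-many ≤2 total with suc q ≤? hitsIn 0
  ... | yes h = ≤-trans (many-large 0 z≤n ≤2 h) (≤-trans (m≤m+n (manyIn 0) (manyIn 1)) (≤-reflexive (sym split)))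
    where
    split : ∑ n many ≡ manyIn 0 + manyIn 1
    split = trans (cong (λ z → ∑ z many) (count-ring₇ q)) (∑-parity half many)
  ... | no  h = ≤-trans (many-large 1 ≤-refl ≤2 odd) (≤-trans (m≤n+m (manyIn 1) (manyIn 0)) (≤-reflexive (sym split)))
    where
    split : ∑ n many ≡ manyIn 0 + manyIn 1
    split = trans (cong (λ z → ∑ z many) (count-ring₇ q)) (∑-parity half many)
    hits-split : hitsIn 0 + hitsIn 1 ≡ suc (q + q)
    hits-split = trans (sym (trans (cong (λ z → ∑ z (λ a → ι (b a))) (count-ring₇ q)) (∑-parity half (λ a → ι (b a)))))
      (trans total (cong suc (trans (*-comm q 2) (cong (q +_) (+-identityʳ q)))))
    odd : suc q ≤ hitsIn 1
    odd = +-cancelˡ-≤ q (suc q) (hitsIn 1) (≤-trans (≤-reflexive (trans (+-suc q q) (sym hits-split)))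
      (+-monoˡ-≤ (hitsIn 1) (≤-pred (≰⇒> h))))

module CircleCount (e m : ℕ) (0<m : 0 < m) (b : ℕ → Bool)
  (periodic : ∀ a → b (a + ((2 + suc (suc e)) * m + suc (suc e))) ≡ b a) where

  open Windows (suc (suc e)) m 0<m b periodic

  d I N N⁺ : ℕ
  d  = suc (suc e)
  I  = ∑ n (λ a → ι (b a))
  N  = ∑ n many
  N⁺ = ∑ n full

  -- Summing X ≤ 1 + (d - 1) many + full and multiplying by d leaves an excess of d². Three hits in
  -- one window give N ≥ d + 2, and (d - 1)(d + 2) ≥ d² absorbs it.
  crowded : (∀ j → j < n → X j ≤ suc d) → ∀ j → 3 ≤ X j → d * (s * I) ≤ d * (s * m) + (suc d * suc e) * N + d * N⁺
  crowded ≤d+1 j h = +-cancelʳ-≤ (suc e * N) _ _ (begin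
    d * (s * I) + suc e * N ≡⟨ cong (λ z → d * z + suc e * N) (sym X-total) ⟩
    d * ∑ n X + suc e * N ≤⟨ +-monoˡ-≤ (suc e * N) (*-monoʳ-≤ d total) ⟩
    d * (s * m + d + suc e * N + N⁺) + suc e * N ≡⟨ count-ring₁ e m N N⁺ ⟩
    d * (s * m) + (suc d * suc e) * N + d * N⁺ + d * d
      ≤⟨ +-monoʳ-≤ (d * (s * m) + (suc d * suc e) * N + d * N⁺) enough ⟩
    d * (s * m) + (suc d * suc e) * N + d * N⁺ + suc e * N ∎)
    where
    open ≤-Reasoning
    pointwise : ∀ j → X j ≤ suc d → X j ≤ 1 + suc e * many j + full j
    pointwise j X≤ with d <ᵇ X j in f
    ... | true = ≤-trans X≤ (≤-reflexive
        (trans (cong suc (trans (+-comm 1 (suc e)) (cong (_+ 1) (trans (sym (*-identityʳ (suc e)))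
                   (cong (suc e *_) (sym (cong ι (<ᵇ-complete (≤-trans (s≤s (s≤s z≤n)) (<ᵇ-sound d (X j) f)))))))))) refl))
    ... | false with 1 <ᵇ X j in g
    ...   | true  = ≤-trans (≮⇒≥ (λ lt → false≢true (trans (sym f) (<ᵇ-complete lt))))
                      (≤-reflexive (cong suc (sym (trans (+-identityʳ _) (*-identityʳ (suc e))))))
    ...   | false = ≤-trans (≮⇒≥ (λ lt → false≢true (trans (sym g) (<ᵇ-complete lt)))) (s≤s z≤n)
    total : ∑ n X ≤ s * m + d + suc e * N + N⁺
    total = begin
      ∑ n X ≤⟨ ∑-mono n (λ j j<n → pointwise j (≤d+1 j j<n)) ⟩
      ∑ n (λ j → 1 + suc e * many j + full j) ≡⟨ ∑-+ n (λ j → 1 + suc e * many j) full ⟩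
      ∑ n (λ j → 1 + suc e * many j) + N⁺ ≡⟨ cong (_+ N⁺) (∑-+ n (λ _ → 1) (λ j → suc e * many j)) ⟩
      ∑ n (λ _ → 1) + ∑ n (λ j → suc e * many j) + N⁺
          ≡⟨ cong (_+ N⁺) (cong₂ _+_ (trans (∑-const n 1) (*-identityʳ n)) (∑-* n (suc e) many)) ⟩
      s * m + d + suc e * N + N⁺ ∎
    enough : d * d ≤ suc e * N
    enough with ≤⇒∃ (many-windows j h)
    ... | z , eq = subst (λ N → d * d ≤ suc e * N) (sym eq) (≤-by _ (count-ring₂ e z))

  -- If I = m + 1 + k, then s I ≤ n + N gives N ≥ 2 + s k. For k = 0 what remains is d (d + 2) ≤ (d
  -- + 1)(d - 1) N: N = 2 is enough for d ≥ 3, but d = 2 needs N = 3. For k ≥ 1 the bound on N is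
  -- ample in both cases.
  sparse-case : (∀ j → j < n → X j ≤ 2) → (1 ≤ e ⊎ (e ≡ 0 × 2 ∣ m)) → d * (s * I) ≤ d * (s * m) + (suc d * suc e) * N + d * N⁺
  sparse-case ≤2 cases with I ≤? m
  ... | yes I≤m = ≤-trans (*-monoʳ-≤ d (*-monoʳ-≤ s I≤m)) (≤-trans (m≤m+n (d * (s * m)) _) (m≤m+n _ (d * N⁺)))
  ... | no  I≰m with ≤⇒∃ (≰⇒> I≰m)
  ...   | k , I≡ = ≤-trans (subst (λ z → d * (s * z) ≤ d * (s * m) + (suc d * suc e) * N) (sym I≡) (go cases))
      (m≤m+n _ (d * N⁺))
    where
    open ≤-Reasoning
    N≥ : 2 + s * k ≤ N
    N≥ = +-cancelˡ-≤ n _ _ (begin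
      n + (2 + s * k) ≡⟨ sym (count-ring₆ d m k) ⟩
      s * (suc m + k) ≡⟨ cong (s *_) (sym I≡) ⟩
      s * I ≡⟨ sym X-total ⟩
      ∑ n X ≤⟨ ∑-mono n (λ j j<n → many-or-one j (≤2 j j<n)) ⟩
      ∑ n (λ j → 1 + many j) ≡⟨ ∑-+ n (λ _ → 1) many ⟩
      ∑ n (λ _ → 1) + N ≡⟨ cong (_+ N) (trans (∑-const n 1) (*-identityʳ n)) ⟩
      n + N ∎)
    go : (1 ≤ e ⊎ (e ≡ 0 × 2 ∣ m)) → d * (s * (suc m + k)) ≤ d * (s * m) + (suc d * suc e) * N
    go c with ≤⇒∃ N≥
    go (inj₁ 1≤e) | z , eq with ≤⇒∃ 1≤e
    ... | e′ , refl = subst (λ N → d * (s * (suc m + k)) ≤ d * (s * m) + (suc d * suc e) * N) (sym eq)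
        (≤-by _ (count-ring₃ e′ m k z))
    go (inj₂ (refl , even)) | z , eq = two-spare k z I≡ eq even
      where
      two-spare : ∀ k z → I ≡ suc m + k → N ≡ 2 + s * k + z → 2 ∣ m → d * (s * (suc m + k)) ≤ d * (s * m) + (suc d * suc e) * N
      two-spare (suc k) z _  eq _ = subst (λ N → d * (s * (suc m + suc k)) ≤ d * (s * m) + (suc d * suc e) * N) (sym eq)
          (≤-by _ (count-ring₄ m k z))
      two-spare zero    z I≡ _  (divides q refl) with ≤⇒∃
          (Parity.three-many q 0<m b periodic ≤2 (trans I≡ (+-identityʳ (suc m))))
      ... | z′ , eq′ = subst (λ N → d * (s * (suc m + 0)) ≤ d * (s * m) + (suc d * suc e) * N) (sym eq′)
          (≤-by _ (count-ring₅ m z′))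

  count-bound : (∀ j → j < n → X j ≤ suc d) → (1 ≤ e ⊎ (e ≡ 0 × 2 ∣ m)) → d * (s * I)
      ≤ d * (s * m) + (suc d * suc e) * N + d * N⁺
  count-bound ≤d+1 cases with search n (λ j → X j <ᵇ 3)
  ... | inj₁ (j , _ , f) = crowded ≤d+1 j (≮⇒≥ (λ lt → false≢true (trans (sym f) (<ᵇ-complete lt))))
  ... | inj₂ all         = sparse-case (λ j j<n → ≤-pred (<ᵇ-sound (X j) 3 (all j j<n))) cases

-- Arcs on the circle and their average over all permutations

matchless-cong : ∀ {n s φ} → MatchlessOn n s φ → ∀ {p q} → (∀ x → x < n → p x ≡ q x) → φ p ≡ φ q
matchless-cong {n} {s} {φ} M {p} {q} h with φ p in e | φ q in e′
... | true  | true  = refl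
... | false | false = refl
... | true  | false = false≢true (trans (sym e′) (upwardOn M p q (λ x x<n t → trans (sym (h x x<n)) t) e))
... | false | true  = false≢true (trans (sym e) (upwardOn M q p (λ x x<n t → trans (h x x<n) t) e′))

rotate : ∀ n .{{_ : NonZero n}} → ℕ → Points → Points
rotate n a p x = p ((x + a) % n)

rotate-size : ∀ n .{{_ : NonZero n}} a p → ∑ n (λ x → ι (rotate n a p x)) ≡ ∑ n (λ x → ι (p x))
rotate-size n a p = trans (∑-periodic n (λ x → ι (p (x % n))) (λ x → cong (λ z → ι (p z)) ([m+n]%n≡m%n x n)) a)
  (∑-cong n (λ x x<n → cong (λ z → ι (p z)) (m<n⇒m%n≡m x<n)))

rotate-∪-size : ∀ n .{{_ : NonZero n}} a b p q → (∀ x → rotate n a p x ≡ true → rotate n b q x ≡ true → ⊥) →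
  ∑ n (λ x → ι ((rotate n a p ∪ rotate n b q) x)) ≡ ∑ n (λ x → ι (p x)) + ∑ n (λ x → ι (q x))
rotate-∪-size n a b p q apart = trans (∪-size n {rotate n a p} {rotate n b q} (λ x _ → apart x))
  (cong₂ _+_ (rotate-size n a p) (rotate-size n b q))

arc-ring₁ : ∀ x j i m e → x + (j + (i + e) * m) ≡ (x + (j + i * m)) + e * m
arc-ring₁ = solve-∀

arc-ring₂ : ∀ m d t → suc t * m + (m + d) ≡ (2 + t) * m + d
arc-ring₂ = solve-∀

-- The points of the circle ℤ/n; in window j the blocks are the arcs of length m starting
-- at -j, -j - m, …, and the d remaining points are the positions m, …, m + d - 1 after -j.
module Circle (d m : ℕ) (0<m : 0 < m) .{{_ : NonZero ((2 + d) * m + d)}} where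

  s n : ℕ
  s = 2 + d
  n = s * m + d

  arc : ℕ → Points
  arc a = rotate n a (interval 0 m)

  spare : ℕ → ℕ → ℕ → Points
  spare j c v = rotate n j (interval (m + c) v)

  arc-sound : ∀ a x → arc a x ≡ true → (x + a) % n < m
  arc-sound a x h = proj₂ (interval-bounds 0 m ((x + a) % n) h)

  blocks-apart : ∀ j i i′ x → i < i′ → i′ < s → arc (j + i * m) x ≡ true → arc (j + i′ * m) x ≡ true → ⊥
  blocks-apart j i i′ x i<i′ i′<s h h′ with ≤⇒∃ i<i′
  ... | e , refl = <⇒≱ (arc-sound (j + i′ * m) x h′) (begin
    m ≤⟨ m≤m+n m (e * m) ⟩
    suc e * m ≤⟨ m≤n+m (suc e * m) y ⟩
    y + suc e * m ≡⟨ sym (m<n⇒m%n≡m inside) ⟩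
    (y + suc e * m) % n ≡⟨ mod-+ (x + (j + i * m)) (suc e * m) n ⟩
    (x + (j + i * m) + suc e * m) % n
        ≡⟨ cong (_% n) (sym (trans (cong (λ z → x + (j + z * m)) (sym (+-suc i e))) (arc-ring₁ x j i m (suc e)))) ⟩
    (x + (j + i′ * m)) % n ∎)
    where
    open ≤-Reasoning
    y = (x + (j + i * m)) % n
    inside : y + suc e * m < n
    inside = begin-strict
      y + suc e * m <⟨ +-monoˡ-< (suc e * m) (arc-sound (j + i * m) x h) ⟩
      suc (suc e) * m ≤⟨ *-monoˡ-≤ m (≤-trans (s≤s (s≤s (m≤n+m e i))) i′<s) ⟩
      s * m ≤⟨ m≤m+n (s * m) d ⟩
      n ∎

  block-spare-apart : ∀ j i c v x → i < s → c + v ≤ d → arc (j + i * m) x ≡ true → spare j c v x ≡ true → ⊥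
  block-spare-apart j i c v x i<s c+v≤d h h′ = <⇒≱ (arc-sound (j + i * m) x h) (begin
    m ≤⟨ m≤m+n m c ⟩
    m + c ≤⟨ proj₁ bounds ⟩
    y ≤⟨ m≤m+n y (i * m) ⟩
    y + i * m ≡⟨ sym (m<n⇒m%n≡m inside) ⟩
    (y + i * m) % n ≡⟨ mod-+ (x + j) (i * m) n ⟩
    (x + j + i * m) % n ≡⟨ cong (_% n) (+-assoc x j (i * m)) ⟩
    (x + (j + i * m)) % n ∎)
    where
    open ≤-Reasoning
    y = (x + j) % n
    bounds : m + c ≤ y × y < m + c + v
    bounds = interval-bounds (m + c) v y h′
    inside : y + i * m < n
    inside = begin-strict
      y + i * m <⟨ +-monoˡ-< (i * m) (proj₂ bounds) ⟩
      m + c + v + i * m ≡⟨ cong (_+ i * m) (+-assoc m c v) ⟩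
      m + (c + v) + i * m ≤⟨ +-mono-≤ (+-monoʳ-≤ m c+v≤d) (*-monoˡ-≤ m (≤-pred i<s)) ⟩
      m + d + suc d * m ≡⟨ trans (+-comm (m + d) (suc d * m)) (arc-ring₂ m d d) ⟩
      n ∎

  spare-apart : ∀ j c v c′ v′ x → c + v ≤ c′ → spare j c v x ≡ true → spare j c′ v′ x ≡ true → ⊥
  spare-apart j c v c′ v′ x h = interval-apart (m + c) v (m + c′) v′ ((x + j) % n)
    (subst (_≤ m + c′) (sym (+-assoc m c v)) (+-monoʳ-≤ m h))

  m≤n : m ≤ n
  m≤n = ≤-trans (m≤m+n m (suc d * m)) (m≤m+n (s * m) d)

  arc-size : ∀ a → ∑ n (λ x → ι (arc a x)) ≡ m
  arc-size a = trans (rotate-size n a (interval 0 m)) (interval-size n 0 m m≤n)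

  arc-spare-size : ∀ j i c v → i < s → c + v ≤ d → ∑ n (λ x → ι ((arc (j + i * m) ∪ spare j c v) x)) ≡ m + v
  arc-spare-size j i c v i<s c+v≤d = trans
    (rotate-∪-size n (j + i * m) j (interval 0 m) (interval (m + c) v) (λ x → block-spare-apart j i c v x i<s c+v≤d))
    (cong₂ _+_ (interval-size n 0 m m≤n) (interval-size n (m + c) v (begin
      m + c + v ≡⟨ +-assoc m c v ⟩
      m + (c + v) ≤⟨ +-mono-≤ (m≤m+n m (suc d * m)) c+v≤d ⟩
      n ∎)))
    where open ≤-Reasoning

  module Member {φ : Points → Bool} (M : MatchlessOn n s φ) where

    b : ℕ → Bool
    b a = φ (arc a)

    b-periodic : ∀ a → b (a + n) ≡ b a
    b-periodic a = matchless-cong M (λ x _ → cong (interval 0 m)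
      (trans (cong (_% n) (sym (+-assoc x a n))) ([m+n]%n≡m%n (x + a) n)))

    open Windows d m 0<m b b-periodic public using (X; many; full)

    X-bound : ∀ j → X j ≤ suc d
    X-bound j with matchingOn M (λ i → arc (j + i * m)) (λ i i′ x i<i′ i′<s _ → blocks-apart j i i′ x i<i′ i′<s)
    ... | i , i<s , e = ≤-pred (begin
      suc (X j) ≡⟨ +-comm 1 (X j) ⟩
      X j + 1 ≤⟨ +-monoʳ-≤ (X j) (≤-trans (≤-reflexive (sym (cong miss e)))
          (∑-term s (λ i → miss (b (j + i * m))) i i<s)) ⟩
      X j + ∑ s (λ i → miss (b (j + i * m))) ≡⟨ sym (∑-+ s (λ i → ι (b (j + i * m))) (λ i → miss (b (j + i * m)))) ⟩
      ∑ s (λ i → ι (b (j + i * m)) + miss (b (j + i * m))) ≡⟨ ∑-cong s (λ i _ → ι+miss (b (j + i * m))) ⟩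
      ∑ s (λ _ → 1) ≡⟨ trans (∑-const s 1) (*-identityʳ s) ⟩
      suc (suc d) ∎)
      where open ≤-Reasoning

    many-missing : ∀ j → d * many j ≤ ∑ s (λ i → ∑ d (λ c → miss (φ (arc (j + i * m) ∪ spare j c 1))))
    many-missing j with 1 <ᵇ X j in e
    ... | false = ≤-trans (≤-reflexive (*-zeroʳ d)) z≤n
    ... | true  = ≤-trans (≤-reflexive (*-identityʳ d)) (missing-pairs M (λ i → arc (j + i * m)) (λ c → spare j c 1) d
      (λ i i′ x i<i′ i′<s _ → blocks-apart j i i′ x i<i′ i′<s)
      (λ c c′ x c<c′ c′<d _ → spare-apart j c 1 c′ 1 x (≤-trans (≤-reflexive (+-comm c 1)) c<c′))
      (λ i c x i<s c<d _ → block-spare-apart j i c 1 x i<s (≤-trans (≤-reflexive (+-comm c 1)) c<d))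
      (+-monoˡ-≤ d (<ᵇ-sound 1 (X j) e)))

    full-missing : 2 ≤ d → ∀ j → full j ≤ ∑ s (λ i → ∑ 1 (λ c → miss (φ (arc (j + i * m) ∪ spare j 0 2))))
    full-missing 2≤d j with d <ᵇ X j in e
    ... | false = z≤n
    ... | true  = missing-pairs M (λ i → arc (j + i * m)) (λ _ → spare j 0 2) 1
      (λ i i′ x i<i′ i′<s _ → blocks-apart j i i′ x i<i′ i′<s)
      (λ { c c′ x () (s≤s z≤n) })
      (λ i c x i<s c<d _ → block-spare-apart j i 0 2 x i<s 2≤d)
      (≤-trans (≤-reflexive (+-comm 1 (suc d))) (+-monoˡ-≤ 1 (<ᵇ-sound d (X j) e)))

circle-ring₁ : ∀ s d n h → d * (s * (n * h)) ≡ s * (d * (n * h))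
circle-ring₁ = solve-∀

circle-ring₂ : ∀ s d m T a n g g⁺ → T * (d * (s * m)) + a * (n * (s * g)) + d * (n * (s * g⁺))
    ≡ s * (T * (d * m) + a * (n * g) + d * (n * g⁺))
circle-ring₂ = solve-∀

-- The averaged count on the circle. A window with two member arcs forces d of its s d one-point
-- extensions to be missing, and a full window one of its s two-point extensions; this bounds N and
-- N⁺ by the gaps.
circle-density : ∀ e m f → 0 < m → (1 ≤ e ⊎ (e ≡ 0 × 2 ∣ m)) → let d = suc (suc e) in let n = (2 + d) * m + d in
  Matchless n (2 + d) f →
  d * (n * hits {0} f [] m) ≤ n ! * (d * m) + (suc d * suc e) * (n * gaps {0} f [] (suc m)) + d *
      (n * gaps {0} f [] (suc (suc m)))
circle-density e m f 0<m cases M = *-cancelˡ-≤ s (begin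
  s * (d * (n * hits {0} f [] m)) ≡⟨ sym (circle-ring₁ s d n (hits {0} f [] m)) ⟩
  d * (s * (n * hits {0} f [] m))
    ≡⟨ cong (λ z → d * (s * z)) (sym (average-singles n n f arc m (λ a _ → arc-size a))) ⟩
  d * (s * 𝔼 n I) ≡⟨ sym (trans (𝔼-* n d (λ σ → s * I σ)) (cong (d *_) (𝔼-* n s I))) ⟩
  𝔼 n (λ σ → d * (s * I σ)) ≤⟨ 𝔼-mono n pointwise ⟩
  𝔼 n (λ σ → d * (s * m) + (suc d * suc e) * N σ + d * N⁺ σ)
    ≡⟨ trans (𝔼-+ n (λ σ → d * (s * m) + (suc d * suc e) * N σ) (λ σ → d * N⁺ σ))
         (cong₂ _+_ (trans (𝔼-+ n (λ _ → d * (s * m)) (λ σ → (suc d * suc e) * N σ))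
             (cong₂ _+_ (𝔼-const n _) (𝔼-* n (suc d * suc e) N))) (𝔼-* n d N⁺)) ⟩
  n ! * (d * (s * m)) + (suc d * suc e) * 𝔼 n N + d * 𝔼 n N⁺
    ≤⟨ +-mono-≤ (+-monoʳ-≤ (n ! * (d * (s * m))) (*-monoʳ-≤ (suc d * suc e) 𝔼N)) (*-monoʳ-≤ d 𝔼N⁺) ⟩
  n ! * (d * (s * m)) + (suc d * suc e) * (n * (s * g)) + d * (n * (s * g⁺))
    ≡⟨ circle-ring₂ s d m (n !) (suc d * suc e) n g g⁺ ⟩
  s * (n ! * (d * m) + (suc d * suc e) * (n * g) + d * (n * g⁺)) ∎)
  where
  open ≤-Reasoning
  d = suc (suc e)
  n = (2 + d) * m + d
  instance
    n≢0 : NonZero n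
    n≢0 = >-nonZero (≤-trans (s≤s z≤n) (m≤n+m d ((2 + d) * m)))
  open Circle d m 0<m using (s; arc; spare; arc-size; arc-spare-size; module Member)
  g  = gaps {0} f [] (suc m)
  g⁺ = gaps {0} f [] (suc (suc m))
  at : Act n → Points → Bool
  at σ = view 0 n f σ
  w : Act n → ℕ → ℕ
  w σ j = ∑ s (λ i → ι (at σ (arc (j + i * m))))
  I N N⁺ : Act n → ℕ
  I σ  = ∑ n (λ a → ι (at σ (arc a)))
  N σ  = ∑ n (λ j → ι (1 <ᵇ w σ j))
  N⁺ σ = ∑ n (λ j → ι (d <ᵇ w σ j))
  pointwise : ∀ σ → Natural σ → d * (s * I σ) ≤ d * (s * m) + (suc d * suc e) * N σ + d * N⁺ σ
  pointwise σ nat = CircleCount.count-bound e m 0<m b b-periodic (λ j _ → X-bound j) cases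
    where open Member (view-matchless 0 n nat M)
  𝔼N : 𝔼 n N ≤ n * (s * g)
  𝔼N = *-cancelˡ-≤ d (begin
    d * 𝔼 n N ≡⟨ sym (𝔼-* n d N) ⟩
    𝔼 n (λ σ → d * N σ) ≡⟨ 𝔼-cong n (λ σ → sym (∑-* n d (λ j → ι (1 <ᵇ w σ j)))) ⟩
    𝔼 n (λ σ → ∑ n (λ j → d * ι (1 <ᵇ w σ j)))
      ≤⟨ 𝔼-mono n (λ σ nat → ∑-mono n (λ j _ → Member.many-missing (view-matchless 0 n nat M) j)) ⟩
    𝔼 n (λ σ → ∑ n (λ j → ∑ s (λ i → ∑ d (λ c → miss (at σ (arc (j + i * m) ∪ spare j c 1))))))
      ≡⟨ 𝔼-∑ n n _ ⟩
    ∑ n (λ j → 𝔼 n (λ σ → ∑ s (λ i → ∑ d (λ c → miss (at σ (arc (j + i * m) ∪ spare j c 1))))))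
      ≡⟨ ∑-cong n (λ j _ → average-pairs n s d f (λ i c → arc (j + i * m) ∪ spare j c 1) (suc m)
           (λ i c i<s c<d → trans (arc-spare-size j i c 1 i<s (≤-trans (≤-reflexive (+-comm c 1)) c<d)) (+-comm m 1))) ⟩
    ∑ n (λ j → s * (d * g)) ≡⟨ ∑-const n _ ⟩
    n * (s * (d * g)) ≡⟨ cong (n *_) (swap-factors s d g) ⟩
    n * (d * (s * g)) ≡⟨ swap-factors n d (s * g) ⟩
    d * (n * (s * g)) ∎)
  𝔼N⁺ : 𝔼 n N⁺ ≤ n * (s * g⁺)
  𝔼N⁺ = begin
    𝔼 n (λ σ → ∑ n (λ j → ι (d <ᵇ w σ j)))
      ≤⟨ 𝔼-mono n (λ σ nat → ∑-mono n (λ j _ → Member.full-missing (view-matchless 0 n nat M) (s≤s (s≤s z≤n)) j)) ⟩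
    𝔼 n (λ σ → ∑ n (λ j → ∑ s (λ i → ∑ 1 (λ c → miss (at σ (arc (j + i * m) ∪ spare j 0 2))))))
      ≡⟨ 𝔼-∑ n n _ ⟩
    ∑ n (λ j → 𝔼 n (λ σ → ∑ s (λ i → ∑ 1 (λ c → miss (at σ (arc (j + i * m) ∪ spare j 0 2))))))
      ≡⟨ ∑-cong n (λ j _ → average-pairs n s 1 f (λ i c → arc (j + i * m) ∪ spare j 0 2) (suc (suc m))
           (λ i c i<s _ → trans (arc-spare-size j i 0 2 i<s (s≤s (s≤s z≤n))) (+-comm m 2))) ⟩
    ∑ n (λ j → s * (1 * g⁺)) ≡⟨ trans (∑-const n _) (cong (λ z → n * (s * z)) (*-identityˡ g⁺)) ⟩
    n * (s * g⁺) ∎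

Lev₃≤Tot : ∀ n k (h : Vec Bool n → ℕ) → suc (suc k) ≤ n → Lev n k h + Lev n (suc k) h + Lev n (suc (suc k)) h ≤ Tot n h
Lev₃≤Tot n k h k+2≤n = subst (Lev n k h + Lev n (suc k) h + Lev n (suc (suc k)) h ≤_) (sym (Tot-levels n h))
  (≤-trans (+-monoˡ-≤ (Lev n (suc (suc k)) h) (+-monoˡ-≤ (Lev n (suc k) h) (m≤n+m (Lev n k h) (∑ k (λ j → Lev n j h)))))
           (∑-≤-bound (λ j → Lev n j h) (s≤s k+2≤n)))

two-ring₁ : ∀ d m n T L N → d * suc m * n * T * (L + N) ≡ d * suc m * n * (T * L) + suc m * (d * n * (T * N))
two-ring₁ = solve-∀

two-ring₂ : ∀ d m n E g → d * suc m * n * (E * (suc d * g)) ≡ d * suc m * E * (n * (suc d * g))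
two-ring₂ = solve-∀

two-ring₃ : ∀ d m n C h → suc m * (d * n * (C * h)) ≡ suc m * C * (d * (n * h))
two-ring₃ = solve-∀

two-ring₄ : ∀ e m n T C g g′ → let d = suc (suc e) in
  m * C * (n * (suc d * g)) + suc m * C * (T * (d * m) + (suc d * suc e) * (n * g) + d * (n * g′)) + C * (n * g)
  ≡ suc m * T * d * (m * C) + d * n * g * (suc m * (d * C) + m * C) + d * suc m * n * (C * g′)
two-ring₄ = solve-∀

two-ring₅ : ∀ d m C → (m + d * suc m) * C ≡ suc m * (d * C) + m * C
two-ring₅ = solve-∀

two-ring₆ : ∀ d m n T R Y C₁ g → suc m * T * d * (n * R) + d * n * g * (suc m * C₁) + d * suc m * n * (T * Y)
    ≡ d * suc m * n * (T * R + C₁ * g + T * Y)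
two-ring₆ = solve-∀

two-ring₇ : ∀ d m n T R Y Y′ → d * suc m * n * (T * R + T * Y + T * Y′) ≡ d * suc m * n * T * (R + Y + Y′)
two-ring₇ = solve-∀

-- The constant term T (d m) of the circle inequality corresponds to the density m / n, which is
-- that of the m-sets through one fixed point. Their number R absorbs it exactly.
two-arithmetic : ∀ e m n T E h h⁺ g g⁺ C C₁ C₂ L N R Y Y⁺ → let d = suc (suc e) in NonZero n → NonZero T →
  T * L ≤ E * h → C * h⁺ ≡ T * N → C₁ * g ≡ T * Y → C₂ * g⁺ ≡ T * Y⁺ → h ≤ suc d * g →
  d * (n * h⁺) ≤ T * (d * m) + (suc d * suc e) * (n * g) + d * (n * g⁺) →
  d * suc m * E ≤ m * C → suc m * C₁ ≡ (m + d * suc m) * C → C ≤ C₂ → n * R ≡ m * C → L + N ≤ R + Y + Y⁺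
two-arithmetic e m n T E h h⁺ g g⁺ C C₁ C₂ L N R Y Y⁺ n≢0 T≢0 low level loss₁ loss₂ h≤ circle E≤ C₁≡ C≤ R≡ =
  *-cancelˡ-≤ (d * suc m * n * T) {{m*n≢0 (d * suc m * n) T {{m*n≢0 (d * suc m) n {{_}} {{n≢0}}}} {{T≢0}}}} (begin
    d * suc m * n * T * (L + N) ≡⟨ two-ring₁ d m n T L N ⟩
    d * suc m * n * (T * L) + suc m * (d * n * (T * N))
      ≤⟨ +-mono-≤ (*-monoʳ-≤ (d * suc m * n) (≤-trans low (*-monoʳ-≤ E h≤)))
           (≤-reflexive (cong (λ z → suc m * (d * n * z)) (sym level))) ⟩
    d * suc m * n * (E * (suc d * g)) + suc m * (d * n * (C * h⁺)) ≡⟨ cong₂ _+_ (two-ring₂ d m n E g) (two-ring₃ d m n C h⁺) ⟩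
    d * suc m * E * (n * (suc d * g)) + suc m * C * (d * (n * h⁺))
        ≤⟨ +-mono-≤ (*-monoˡ-≤ (n * (suc d * g)) E≤) (*-monoʳ-≤ (suc m * C) circle) ⟩
    m * C * (n * (suc d * g)) + suc m * C * (T * (d * m) + (suc d * suc e) * (n * g) + d * (n * g⁺))
      ≤⟨ ≤-by (C * (n * g)) (sym (two-ring₄ e m n T C g g⁺)) ⟩
    suc m * T * d * (m * C) + d * n * g * (suc m * (d * C) + m * C) + d * suc m * n * (C * g⁺)
      ≡⟨ cong (_+ d * suc m * n * (C * g⁺))
           (cong₂ (λ a b → suc m * T * d * a + d * n * g * b) (sym R≡) (sym (trans C₁≡ (two-ring₅ d m C)))) ⟩
    suc m * T * d * (n * R) + d * n * g * (suc m * C₁) + d * suc m * n * (C * g⁺)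
      ≤⟨ +-monoʳ-≤ (suc m * T * d * (n * R) + d * n * g * (suc m * C₁))
           (*-monoʳ-≤ (d * suc m * n) (≤-trans (*-monoˡ-≤ g⁺ C≤) (≤-reflexive loss₂))) ⟩
    suc m * T * d * (n * R) + d * n * g * (suc m * C₁) + d * suc m * n * (T * Y⁺) ≡⟨ two-ring₆ d m n T R Y⁺ C₁ g ⟩
    d * suc m * n * (T * R + C₁ * g + T * Y⁺) ≡⟨ cong (λ z → d * suc m * n * (T * R + z + T * Y⁺)) loss₁ ⟩
    d * suc m * n * (T * R + T * Y + T * Y⁺) ≡⟨ two-ring₇ d m n T R Y Y⁺ ⟩
    d * suc m * n * T * (R + Y + Y⁺) ∎)
  where
  open ≤-Reasoning
  d = suc (suc e)

two-size₁ : ∀ d μ → μ + suc d * suc (suc μ) ≡ (2 + d) * suc μ + d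
two-size₁ = solve-∀

two-size₂ : ∀ d k j → (2 + d) * suc (suc (k + j)) + d ≡ (suc d * suc k + k) + (3 + 2 * d + 2 * j + d * j)
two-size₂ = solve-∀

two-size₃ : ∀ e μ → let d = suc (suc e) in (2 + d) * suc μ + d ≡ (1 * suc (suc μ) + suc μ) + (3 + 2 * e + 2 * μ + e * μ)
two-size₃ = solve-∀

two-size₄ : ∀ e μ → let d = suc (suc e) in (2 + d) * suc μ + d
    ≡ (1 * suc (suc (suc μ)) + suc (suc μ)) + (1 + 2 * e + 2 * μ + e * μ)
two-size₄ = solve-∀

two-size₅ : ∀ d m → (2 + d) * m + d ≡ m + (m + d * suc m)
two-size₅ = solve-∀

two-size₆ : ∀ d E B → d * (E + B) ≡ d * E + d * B
two-size₆ = solve-∀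

two-size₇ : ∀ d μ X → d * suc (suc μ) * X ≡ suc (suc μ) * (d * X)
two-size₇ = solve-∀

two-size₈ : ∀ d μ B → suc (suc μ) * (B + d * B) ≡ suc d * suc (suc μ) * B
two-size₈ = solve-∀

two-special : ∀ e μ f → (1 ≤ e ⊎ (e ≡ 0 × 2 ∣ suc μ)) → let d = suc (suc e) in let n = (2 + d) * suc μ + d in
  Matchless n (2 + d) f → Tot n (λ v → ι (f v)) ≤ Tot n (λ v → ι (heavy (suc μ) 1 v))
two-special e μ f cases M = exchange n m 1 f (begin
  Tot n (gain m 1 f)
    ≤⟨ Tot-low n (suc m) (λ v _ → ≤-refl) (λ v m<w → gain-heavy m 1 f v (≤-trans m<w (m≤m+n (wt v) _))) ⟩
  ∑ m (λ k → Lev n k (gain m 1 f)) + Lev n m (gain m 1 f)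
    ≤⟨ +-mono-≤ (∑-mono m (λ k _ → Lev-mono n k (λ v _ → gain≤ι m 1 f v))) top ⟩
  L + N₀
    -- Adding N₁, the member m-sets through the first point, completes level m on the left and turns
    -- D₁ into all m-sets through that point on the right, so that the symmetric estimate applies.
    ≤⟨ +-cancelʳ-≤ N₁ (L + N₀) (D₁ + Y + Y⁺) core ⟩
  D₁ + Y + Y⁺
    ≤⟨ +-mono-≤ (+-mono-≤ D₁≤ (level (suc m) ≤-refl)) (level (suc (suc m)) (n≤1+n (suc m))) ⟩
  Lev n m (loss m 1 f) + Lev n (suc m) (loss m 1 f) + Lev n (suc (suc m)) (loss m 1 f)
    ≤⟨ Lev₃≤Tot n m (loss m 1 f) (≤-trans (m≤m+n (suc (suc m)) (suc m))
         (≤-trans (≤-reflexive (cong (_+ suc m) (sym (*-identityˡ (suc (suc m)))))) (≤-by _ (two-size₄ e μ)))) ⟩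
  Tot n (loss m 1 f) ∎)
  where
  open ≤-Reasoning
  d = suc (suc e)
  m = suc μ
  n = (2 + d) * m + d
  g = μ + suc d * suc μ + d
  h₀ h₁ : Vec Bool g → ℕ
  h₀ v = ι (f (false ∷ v))
  h₁ v = ι (f (true ∷ v))
  L N₀ N₁ D₁ Y Y⁺ : ℕ
  L  = ∑ m (λ k → Lev n k (λ v → ι (f v)))
  N₀ = Lev g m h₀
  N₁ = Lev g μ h₁
  D₁ = Lev g μ (λ v → miss (f (true ∷ v)))
  Y  = Lev n (suc m) (λ v → miss (f v))
  Y⁺ = Lev n (suc (suc m)) (λ v → miss (f v))
  heavy-true : ∀ v → wt v ≡ μ → m < wt (true ∷ v) + pre 1 (true ∷ v)
  heavy-true v e = ≤-reflexive (trans (+-comm 1 m) (cong (λ w → suc w + 1) (sym e)))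
  top : Lev n m (gain m 1 f) ≤ N₀
  top = ≤-trans (+-mono-≤ (Lev-mono g m (λ v _ → gain≤ι m 1 f (false ∷ v)))
    (≤-reflexive (Lev-zero g μ (λ v e → gain-heavy m 1 f (true ∷ v) (heavy-true v e))))) (≤-reflexive (+-identityʳ N₀))
  D₁≤ : D₁ ≤ Lev n m (loss m 1 f)
  D₁≤ = ≤-trans (≤-reflexive (Lev-cong g μ (λ v e → sym (loss-heavy m 1 f (true ∷ v) (heavy-true v e))))) (m≤n+m _ _)
  level : ∀ k → m < k → Lev n k (λ v → miss (f v)) ≤ Lev n k (loss m 1 f)
  level k m<k = ≤-reflexive (Lev-cong n k
      (λ v e → sym (loss-heavy m 1 f v (≤-trans (subst (m <_) (sym e) m<k) (m≤m+n (wt v) _)))))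
  growth : ∀ k → k < μ → suc d * binom n k ≤ binom n (suc k)
  growth k k<μ with ≤⇒∃ k<μ
  ... | j , refl = binom-grow n k (suc d) (≤-by _ (two-size₂ d k j))
  small : d * suc m * ∑ m (binom n) ≤ m * binom n m
  small = begin
    d * suc m * ∑ m (binom n) ≡⟨ two-size₇ d μ (∑ m (binom n)) ⟩
    suc m * (d * (∑ μ (binom n) + binom n μ))
        ≤⟨ *-monoʳ-≤ (suc m) (≤-trans (≤-reflexive (two-size₆ d (∑ μ (binom n)) (binom n μ)))
        (+-monoˡ-≤ (d * binom n μ) (binom-below n d μ growth))) ⟩
    suc m * (binom n μ + d * binom n μ) ≡⟨ two-size₈ d μ (binom n μ) ⟩
    suc d * suc m * binom n μ
        ≡⟨ cong (_* binom n μ) (sym (trans (cong (_∸ μ) (sym (two-size₁ d μ))) (m+n∸m≡n μ (suc d * suc m)))) ⟩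
    (n ∸ μ) * binom n μ ≡⟨ sym (binom-step n μ) ⟩
    m * binom n m ∎
  step : suc m * binom n (suc m) ≡ (m + d * suc m) * binom n m
  step = trans (binom-step n m) (cong (_* binom n m) (trans (cong (_∸ m) (two-size₅ d m)) (m+n∸m≡n m (m + d * suc m))))
  grow₂ : binom n m ≤ binom n (suc (suc m))
  grow₂ = ≤-trans (≤-reflexive (sym (*-identityˡ _))) (≤-trans (binom-grow n m 1 (≤-by _ (two-size₃ e μ)))
    (≤-trans (≤-reflexive (sym (*-identityˡ _))) (binom-grow n (suc m) 1 (≤-by _ (two-size₄ e μ)))))
  core : L + N₀ + N₁ ≤ D₁ + Y + Y⁺ + N₁
  core = begin
    L + N₀ + N₁ ≡⟨ +-assoc L N₀ N₁ ⟩
    L + Lev n m (λ v → ι (f v))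
      ≤⟨ two-arithmetic e m n (n !) (∑ m (binom n)) (hits {0} f [] μ) (hits {0} f [] m) (gaps {0} f [] (suc m))
           (gaps {0} f [] (suc (suc m)))
           (binom n m) (binom n (suc m)) (binom n (suc (suc m))) L (Lev n m (λ v → ι (f v))) (binom g μ) Y Y⁺ _ (n !≢0)
           (low-levels {0} M [] μ (≤-trans (m≤m+n μ _) (≤-reflexive (two-size₁ d μ))))
           (binom-den n m (λ v → ι (f v))) (binom-den n (suc m) (λ v → miss (f v)))
               (binom-den n (suc (suc m)) (λ v → miss (f v)))
           (small-set-density M μ (≤-reflexive (two-size₁ d μ)))
           (circle-density e m f (s≤s z≤n) cases M)
           small step grow₂ (absorb g μ) ⟩
    binom g μ + Y + Y⁺ ≡⟨ cong (λ z → z + Y + Y⁺) split ⟩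
    D₁ + N₁ + Y + Y⁺ ≡⟨ rearrange D₁ N₁ Y Y⁺ ⟩
    D₁ + Y + Y⁺ + N₁ ∎
    where
    split : binom g μ ≡ D₁ + N₁
    split = trans (Lev-cong g μ (λ v _ → sym (trans (+-comm (miss (f (true ∷ v))) _) (ι+miss (f (true ∷ v))))))
        (Lev-+ g μ (λ v → miss (f (true ∷ v))) h₁)
    rearrange : ∀ a b c d → a + b + c + d ≡ a + c + d + b
    rearrange a b c d = trans (cong (_+ d) (trans (+-assoc a b c) (trans (cong (a +_) (+-comm b c)) (sym (+-assoc a c b)))))
      (trans (+-assoc (a + c) b d) (trans (cong (a + c +_) (+-comm b d)) (sym (+-assoc (a + c) d b))))

-- Compression

-- The compression that replaces k + 1 by k. Adjacent pairs suffice for sorting a set to the left,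
-- and they allow recursion along the vector.
shift : ∀ {n} → ℕ → (Vec Bool n → Bool) → Vec Bool n → Bool
shift zero    f (true ∷ false ∷ v) = f (true ∷ false ∷ v) ∨ f (false ∷ true ∷ v)
shift zero    f (false ∷ true ∷ v) = f (false ∷ true ∷ v) ∧ f (true ∷ false ∷ v)
shift zero    f v                  = f v
shift (suc k) f []                 = f []
shift (suc k) f (a ∷ v)            = shift k (f ∘ (a ∷_)) v

swap : ∀ {n} → ℕ → Vec Bool n → Vec Bool n
swap zero    (a ∷ b ∷ v) = b ∷ a ∷ v
swap zero    v           = v
swap (suc k) []          = []
swap (suc k) (a ∷ v)     = a ∷ swap k v

at : ∀ {n} → ℕ → Vec Bool n → Bool
at k       []      = false
at zero    (a ∷ v) = a
at (suc k) (a ∷ v) = at k v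

at-apart : ∀ {n} k {u v : Vec Bool n} → Pointwise Apart u v → at k u ≡ true → at k v ≡ true → ⊥
at-apart zero    (ap ∷ _)  = ap
at-apart (suc k) (_ ∷ aps) = at-apart k aps

swap-pointwise : ∀ {n} (R : Bool → Bool → Set) k {u v : Vec Bool n} → Pointwise R u v → Pointwise R (swap k u) (swap k v)
swap-pointwise R zero    []            = []
swap-pointwise R zero    (r ∷ [])      = r ∷ []
swap-pointwise R zero    (r ∷ r′ ∷ rs) = r′ ∷ r ∷ rs
swap-pointwise R (suc k) []            = []
swap-pointwise R (suc k) (r ∷ rs)      = r ∷ swap-pointwise R k rs

shift-new : ∀ {n} k (f : Vec Bool n → Bool) v → shift k f v ≡ true → f v ≡ false → at k v ≡ true
shift-new zero    f (true ∷ false ∷ v)  h e = refl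
shift-new zero    f (true ∷ true ∷ v)   h e = refl
shift-new zero    f (true ∷ [])         h e = refl
shift-new zero    f (false ∷ true ∷ v)  h e = false≢true (trans (sym e) (proj₁ (∧-true h)))
shift-new zero    f (false ∷ false ∷ v) h e = false≢true (trans (sym e) h)
shift-new zero    f (false ∷ [])        h e = false≢true (trans (sym e) h)
shift-new zero    f []                  h e = false≢true (trans (sym e) h)
shift-new (suc k) f []                  h e = false≢true (trans (sym e) h)
shift-new (suc k) f (a ∷ v)             h e = shift-new k (f ∘ (a ∷_)) v h e

shift-swap : ∀ {n} k (f : Vec Bool n → Bool) v → shift k f v ≡ true → f v ≡ false ⊎ at k v ≡ false → f (swap k v) ≡ true
shift-swap zero    f (true ∷ false ∷ v)  h (inj₁ e) with ∨-true {f (true ∷ false ∷ v)} h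
... | inj₁ t = false≢true (trans (sym e) t)
... | inj₂ t = t
shift-swap zero    f (true ∷ true ∷ v)   h (inj₁ e) = false≢true (trans (sym e) h)
shift-swap zero    f (true ∷ [])         h (inj₁ e) = false≢true (trans (sym e) h)
shift-swap zero    f (false ∷ true ∷ v)  h _        = proj₂ (∧-true {f (false ∷ true ∷ v)} h)
shift-swap zero    f (false ∷ false ∷ v) h _        = h
shift-swap zero    f (false ∷ [])        h _        = h
shift-swap zero    f []                  h _        = h
shift-swap (suc k) f []                  h _        = h
shift-swap (suc k) f (a ∷ v)             h c        = shift-swap k (f ∘ (a ∷_)) v h c

Increasing : ∀ {n} → (Vec Bool n → Bool) → (Vec Bool n → Bool) → Set
Increasing f f′ = ∀ {u v} → Pointwise Below u v → f u ≡ true → f′ v ≡ true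

-- Two functions are compared instead of one because the induction passes to the restrictions to two
-- heads a ≤ b, which may differ.
shift-increasing : ∀ {n} k {f f′ : Vec Bool n → Bool} → Increasing f f′ → Increasing (shift k f) (shift k f′)
shift-increasing zero    inc {[]} {[]} _ h = inc [] h
shift-increasing zero    inc {a ∷ []} {b ∷ []} (r ∷ []) h = shift₁ b (inc (r ∷ []) (shift₁′ a h))
  where
  shift₁ : ∀ {f} b → f (b ∷ []) ≡ true → shift zero f (b ∷ []) ≡ true
  shift₁ true  h = h
  shift₁ false h = h
  shift₁′ : ∀ {f} b → shift zero f (b ∷ []) ≡ true → f (b ∷ []) ≡ true
  shift₁′ true  h = h
  shift₁′ false h = h
shift-increasing zero {f} {f′} inc {false ∷ false ∷ u} {false ∷ false ∷ v} (r ∷ r′ ∷ rs) h = inc (r ∷ r′ ∷ rs) h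
shift-increasing zero {f} {f′} inc {false ∷ false ∷ u} {false ∷ true ∷ v} (r ∷ r′ ∷ rs) h
  rewrite inc {v = false ∷ true ∷ v} (id ∷ (λ ()) ∷ rs) h = inc ((λ ()) ∷ id ∷ rs) h
shift-increasing zero {f} {f′} inc {false ∷ false ∷ u} {true ∷ false ∷ v} (r ∷ r′ ∷ rs) h = ∨-left _ (inc ((λ ()) ∷ id ∷ rs) h)
shift-increasing zero {f} {f′} inc {false ∷ false ∷ u} {true ∷ true ∷ v} (r ∷ r′ ∷ rs) h = inc ((λ ()) ∷ (λ ()) ∷ rs) h
shift-increasing zero {f} {f′} inc {false ∷ true ∷ u} {_ ∷ false ∷ v} (r ∷ r′ ∷ rs) h with r′ refl
... | ()
shift-increasing zero {f} {f′} inc {false ∷ true ∷ u} {false ∷ true ∷ v} (r ∷ r′ ∷ rs) h with ∧-true {f (false ∷ true ∷ u)} h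
... | t , t′ rewrite inc {v = false ∷ true ∷ v} (id ∷ id ∷ rs) t = inc (id ∷ id ∷ rs) t′
shift-increasing zero {f} {f′} inc {false ∷ true ∷ u} {true ∷ true ∷ v} (r ∷ r′ ∷ rs) h = inc ((λ ()) ∷ id ∷ rs)
    (proj₁ (∧-true {f (false ∷ true ∷ u)} h))
shift-increasing zero {f} {f′} inc {true ∷ _ ∷ u} {false ∷ _ ∷ v} (r ∷ r′ ∷ rs) h with r refl
... | ()
shift-increasing zero {f} {f′} inc {true ∷ false ∷ u} {true ∷ false ∷ v} (r ∷ r′ ∷ rs) h with ∨-true {f (true ∷ false ∷ u)} h
... | inj₁ t = ∨-left _ (inc (id ∷ id ∷ rs) t)
... | inj₂ t = ∨-right (f′ (true ∷ false ∷ v)) (inc (id ∷ id ∷ rs) t)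
shift-increasing zero {f} {f′} inc {true ∷ false ∷ u} {true ∷ true ∷ v} (r ∷ r′ ∷ rs) h with ∨-true {f (true ∷ false ∷ u)} h
... | inj₁ t = inc (id ∷ (λ ()) ∷ rs) t
... | inj₂ t = inc ((λ ()) ∷ id ∷ rs) t
shift-increasing zero {f} {f′} inc {true ∷ true ∷ u} {true ∷ false ∷ v} (r ∷ r′ ∷ rs) h with r′ refl
... | ()
shift-increasing zero {f} {f′} inc {true ∷ true ∷ u} {true ∷ true ∷ v} (r ∷ r′ ∷ rs) h = inc (id ∷ id ∷ rs) h
shift-increasing (suc k) inc []       h = inc [] h
shift-increasing (suc k) inc (r ∷ rs) h = shift-increasing k (λ rs → inc (r ∷ rs)) rs h

-- If some set of a matching is new, it contains k, so no other set of the matching does. Exchanging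
-- k and k + 1 in all sets at once then gives a matching in `f`.
shift-matchless : ∀ {n s} k {f : Vec Bool n → Bool} → Matchless n s f → Matchless n s (shift k f)
shift-matchless {n} {s} k {f} M = record { upward = shift-increasing k (upward M) ; matching = match }
  where
  match : (G : ℕ → Vec Bool n) → (∀ i j → i < j → j < s → Pointwise Apart (G i) (G j)) →
      (∀ i → i < s → shift k f (G i) ≡ true) → ⊥
  match G apart members with search s (λ i → f (G i))
  ... | inj₂ all = matching M G apart all
  ... | inj₁ (a , a<s , fa) = matching M (λ i → swap k (G i))
      (λ i j i<j j<s → swap-pointwise Apart k (apart i j i<j j<s)) swapped
    where
    ak : at k (G a) ≡ true
    ak = shift-new k f (G a) (members a a<s) fa
    not-k : ∀ i → (at k (G i) ≡ true → ⊥) → at k (G i) ≡ false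
    not-k i h with at k (G i)
    ... | false = refl
    ... | true  = ⊥-elim (h refl)
    swapped : ∀ i → i < s → f (swap k (G i)) ≡ true
    swapped i i<s with <-cmp i a
    ... | tri< i<a _ _ = shift-swap k f (G i) (members i i<s) (inj₂ (not-k i (λ ik → at-apart k (apart i a i<a a<s) ik ak)))
    ... | tri≈ _ refl _ = shift-swap k f (G i) (members i i<s) (inj₁ fa)
    ... | tri> _ _ a<i = shift-swap k f (G i) (members i i<s) (inj₂ (not-k i (λ ik → at-apart k (apart a i a<i i<s) ak ik)))

Tot-cong₂ : ∀ n {h₁ h₂ h₃ h₄ : Vec Bool n → ℕ} → (∀ v → h₁ v + h₂ v ≡ h₃ v + h₄ v) → Tot n h₁ + Tot n h₂ ≡ Tot n h₃ + Tot n h₄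
Tot-cong₂ n {h₁} {h₂} {h₃} {h₄} H = trans (sym (Tot-+ n h₁ h₂)) (trans (Tot-cong n H) (Tot-+ n h₃ h₄))

middle : ∀ {a b b′ c c′ d} → b + c ≡ b′ + c′ → a + b + (c + d) ≡ a + b′ + (c′ + d)
middle {a} {b} {b′} {c} {c′} {d} e = trans (reassoc a b c d) (trans (cong (λ z → a + z + d) e) (sym (reassoc a b′ c′ d)))
  where
  reassoc : ∀ a b c d → a + b + (c + d) ≡ a + (b + c) + d
  reassoc a b c d = trans (sym (+-assoc (a + b) c d)) (cong (_+ d) (+-assoc a b c))

shift-size : ∀ n k (f : Vec Bool n → Bool) → Tot n (λ v → ι (shift k f v)) ≡ Tot n (λ v → ι (f v))
shift-size zero          zero    f = refl
shift-size (suc zero)    zero    f = refl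
shift-size (suc (suc n)) zero    f =
  middle {Tot n (λ v → ι (f (false ∷ false ∷ v)))} {d = Tot n (λ v → ι (f (true ∷ true ∷ v)))}
    (Tot-cong₂ n (λ v → bits (f (false ∷ true ∷ v)) (f (true ∷ false ∷ v))))
  where
  bits : ∀ a b → ι (a ∧ b) + ι (b ∨ a) ≡ ι a + ι b
  bits true  true  = refl
  bits true  false = refl
  bits false true  = refl
  bits false false = refl
shift-size zero          (suc k) f = refl
shift-size (suc n)       (suc k) f = cong₂ _+_ (shift-size n k (f ∘ (false ∷_))) (shift-size n k (f ∘ (true ∷_)))

position : ∀ {n} → ℕ → Vec Bool n → ℕ
position o []      = 0
position o (a ∷ v) = o * ι a + position (suc o) v

-- A compression lowers this sum of all elements of all members by one for each set it moves, that
-- is by `defects`; hence repeated compression comes to an end.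
potential : ∀ {n} → ℕ → (Vec Bool n → Bool) → ℕ
potential {n} o f = Tot n (λ v → ι (f v) * position o v)

defects : ∀ {n} → ℕ → (Vec Bool n → Bool) → ℕ
defects {zero}        k       f = 0
defects {suc n}       (suc k) f = defects k (f ∘ (false ∷_)) + defects k (f ∘ (true ∷_))
defects {suc zero}    zero    f = 0
defects {suc (suc n)} zero    f = Tot n (λ v → ι (f (false ∷ true ∷ v) ∧ not (f (true ∷ false ∷ v))))

weighted : ∀ n a o (f : Vec Bool n → Bool) → Tot n (λ v → ι (f v) * (a + position o v))
    ≡ a * Tot n (λ v → ι (f v)) + potential o f
weighted n a o f = trans (Tot-cong n (λ v → expand (ι (f v)) a (position o v)))
  (trans (Tot-+ n (λ v → a * ι (f v)) (λ v → ι (f v) * position o v)) (cong (_+ potential o f) (Tot-* n a (λ v → ι (f v)))))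
  where
  expand : ∀ x a p → x * (a + p) ≡ a * x + x * p
  expand x a p = trans (*-distribˡ-+ x a p) (cong (_+ x * p) (*-comm x a))

shift-ring₁ : ∀ a b c d e → (a + b) + (c + d) + e ≡ a + (b + c + e) + d
shift-ring₁ = solve-∀

shift-ring₂ : ∀ a b c d → a + (b + c) + d ≡ (a + b) + (c + d)
shift-ring₂ = solve-∀

shift-ring₃ : ∀ a b c d e f → (a + b) + (c + d) + (e + f) ≡ (a + (b + e)) + (c + (d + f))
shift-ring₃ = solve-∀

shift-ring₄ : ∀ o p → 1 * (o * 1 + (suc o * 0 + p)) + 1 ≡ 1 * (o * 0 + (suc o * 1 + p)) + 0
shift-ring₄ = solve-∀

shift-potential : ∀ n k o (f : Vec Bool n → Bool) → potential o (shift k f) + defects k f ≡ potential o f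
shift-potential zero          zero    o f = +-identityʳ _
shift-potential zero          (suc k) o f = +-identityʳ _
shift-potential (suc zero)    zero    o f = +-identityʳ _
shift-potential (suc (suc n)) zero    o f = begin
  (A + B′) + (C′ + D) + E ≡⟨ shift-ring₁ A B′ C′ D E ⟩
  A + (B′ + C′ + E) + D ≡⟨ cong (λ z → A + z + D) moved ⟩
  A + (B + C) + D ≡⟨ shift-ring₂ A B C D ⟩
  (A + B) + (C + D) ∎
  where
  open ≡-Reasoning
  p : Bool → Bool → Vec Bool n → ℕ
  p a b v = position o (a ∷ b ∷ v)
  A B B′ C C′ D E : ℕ
  A  = Tot n (λ v → ι (f (false ∷ false ∷ v)) * p false false v)
  B  = Tot n (λ v → ι (f (false ∷ true ∷ v)) * p false true v)
  B′ = Tot n (λ v → ι (f (false ∷ true ∷ v) ∧ f (true ∷ false ∷ v)) * p false true v)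
  C  = Tot n (λ v → ι (f (true ∷ false ∷ v)) * p true false v)
  C′ = Tot n (λ v → ι (f (true ∷ false ∷ v) ∨ f (false ∷ true ∷ v)) * p true false v)
  D  = Tot n (λ v → ι (f (true ∷ true ∷ v)) * p true true v)
  E  = Tot n (λ v → ι (f (false ∷ true ∷ v) ∧ not (f (true ∷ false ∷ v))))
  bits : ∀ a b x → ι (a ∧ b) * (o * 0 + (suc o * 1 + x)) + ι (b ∨ a) * (o * 1 + (suc o * 0 + x)) + ι (a ∧ not b)
    ≡ ι a * (o * 0 + (suc o * 1 + x)) + ι b * (o * 1 + (suc o * 0 + x))
  bits true  true  x = +-identityʳ _
  bits true  false x = trans (shift-ring₄ o x) refl
  bits false true  x = +-identityʳ _
  bits false false x = refl
  moved : B′ + C′ + E ≡ B + C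
  moved = trans (cong (_+ E) (sym (Tot-+ n _ _)))
      (Tot-cong₂ n (λ v → bits (f (false ∷ true ∷ v)) (f (true ∷ false ∷ v)) (position (suc (suc o)) v)))
shift-potential (suc n)       (suc k) o f = begin
  potential o (shift (suc k) f) + (defects k f₀ + defects k f₁)
    ≡⟨ cong (_+ (defects k f₀ + defects k f₁))
         (cong₂ _+_ (weighted n (o * 0) (suc o) (shift k f₀)) (weighted n (o * 1) (suc o) (shift k f₁))) ⟩
  (o * 0 * Tot n (λ v → ι (shift k f₀ v)) + potential (suc o) (shift k f₀)) +
      (o * 1 * Tot n (λ v → ι (shift k f₁ v)) + potential (suc o) (shift k f₁))
    + (defects k f₀ + defects k f₁)
    ≡⟨ shift-ring₃ (o * 0 * Tot n (λ v → ι (shift k f₀ v))) (potential (suc o) (shift k f₀))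
         (o * 1 * Tot n (λ v → ι (shift k f₁ v))) (potential (suc o) (shift k f₁)) (defects k f₀) (defects k f₁) ⟩
  (o * 0 * Tot n (λ v → ι (shift k f₀ v)) + (potential (suc o) (shift k f₀) + defects k f₀))
    + (o * 1 * Tot n (λ v → ι (shift k f₁ v)) + (potential (suc o) (shift k f₁) + defects k f₁))
    ≡⟨ cong₂ _+_ (cong₂ (λ a b → o * 0 * a + b) (shift-size n k f₀) (shift-potential n k (suc o) f₀))
                 (cong₂ (λ a b → o * 1 * a + b) (shift-size n k f₁) (shift-potential n k (suc o) f₁)) ⟩
  (o * 0 * Tot n (λ v → ι (f₀ v)) + potential (suc o) f₀) + (o * 1 * Tot n (λ v → ι (f₁ v)) + potential (suc o) f₁)
    ≡⟨ sym (cong₂ _+_ (weighted n (o * 0) (suc o) f₀) (weighted n (o * 1) (suc o) f₁)) ⟩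
  potential o f ∎
  where
  open ≡-Reasoning
  f₀ = f ∘ (false ∷_)
  f₁ = f ∘ (true ∷_)

Closed : ∀ {n} → ℕ → (Vec Bool n → Bool) → Set
Closed {zero}        k       f = ⊤
Closed {suc n}       (suc k) f = ∀ a → Closed k (f ∘ (a ∷_))
Closed {suc zero}    zero    f = ⊤
Closed {suc (suc n)} zero    f = ∀ v → f (false ∷ true ∷ v) ≡ true → f (true ∷ false ∷ v) ≡ true

Tot≡0 : ∀ n (h : Vec Bool n → ℕ) → Tot n h ≡ 0 → ∀ v → h v ≡ 0
Tot≡0 zero    h e []          = e
Tot≡0 (suc n) h e (false ∷ v) = Tot≡0 n (h ∘ (false ∷_)) (m+n≡0⇒m≡0 _ e) v
Tot≡0 (suc n) h e (true ∷ v)  = Tot≡0 n (h ∘ (true ∷_)) (m+n≡0⇒n≡0 (Tot n (h ∘ (false ∷_))) e) v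

no-defects : ∀ n k (f : Vec Bool n → Bool) → defects k f ≡ 0 → Closed k f
no-defects zero          k       f e = tt
no-defects (suc zero)    zero    f e = tt
no-defects (suc (suc n)) zero    f e v t = contrapositive (f (true ∷ false ∷ v)) t
    (Tot≡0 n (λ v → ι (f (false ∷ true ∷ v) ∧ not (f (true ∷ false ∷ v)))) e v)
  where
  contrapositive : ∀ {a} b → a ≡ true → ι (a ∧ not b) ≡ 0 → b ≡ true
  contrapositive true  refl _ = refl
  contrapositive false refl ()
no-defects (suc n)       (suc k) f e false = no-defects n k (f ∘ (false ∷_)) (m+n≡0⇒m≡0 _ e)
no-defects (suc n)       (suc k) f e true  = no-defects n k (f ∘ (true ∷_)) (m+n≡0⇒n≡0 (defects k (f ∘ (false ∷_))) e)

defects-beyond : ∀ n k (f : Vec Bool n → Bool) → n ≤ k → defects k f ≡ 0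
defects-beyond zero          k       f _         = refl
defects-beyond (suc n)       (suc k) f (s≤s n≤k) = cong₂ _+_ (defects-beyond n k (f ∘ (false ∷_)) n≤k)
    (defects-beyond n k (f ∘ (true ∷_)) n≤k)

Shifted : ∀ {n} → (Vec Bool n → Bool) → Set
Shifted f = ∀ k → Closed k f

compress : ∀ {n s} (f : Vec Bool n → Bool) → Matchless n s f →
  Σ (Vec Bool n → Bool) λ f′ → Matchless n s f′ × Shifted f′ × Tot n (λ v → ι (f v)) ≡ Tot n (λ v → ι (f′ v))
compress {n} {s} f M = go (suc (potential 0 f)) f M ≤-refl
  where
  go : ∀ fuel f → Matchless n s f → potential 0 f < fuel →
    Σ (Vec Bool n → Bool) λ f′ → Matchless n s f′ × Shifted f′ × Tot n (λ v → ι (f v)) ≡ Tot n (λ v → ι (f′ v))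
  go (suc fuel) f M (s≤s small) with search n (λ k → defects k f ≡ᵇ 0)
  ... | inj₂ all = f , M , (λ k → no-defects n k f (none k)) , refl
    where
    none : ∀ k → defects k f ≡ 0
    none k with n ≤? k
    ... | yes n≤k = defects-beyond n k f n≤k
    ... | no  n≰k = ≡ᵇ⇒≡ (defects k f) 0 (subst Bool.T (sym (all k (≰⇒> n≰k))) tt)
  ... | inj₁ (k , _ , e) with go fuel (shift k f) (shift-matchless k M) (≤-trans drop small)
    where
    drop : potential 0 (shift k f) < potential 0 f
    drop with defects k f in d
    ... | suc j = subst (potential 0 (shift k f) <_) (shift-potential n k 0 f)
      (subst (λ z → potential 0 (shift k f) < potential 0 (shift k f) + z) (sym d)
        (≤-trans (≤-reflexive (+-comm 1 _)) (+-monoʳ-≤ (potential 0 (shift k f)) (s≤s z≤n))))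
  ...   | f′ , M′ , S′ , size = f′ , M′ , S′ , trans (sym (shift-size n k f)) size

shifted-prefix : ∀ l {g} {f : Vec Bool (l + g) → Bool} → Shifted f → ∀ (T : Vec Bool g) → Shifted {l} (λ u → f (u ++ T))
shifted-prefix l {g} {f} S T k = restrict l f k (S k)
  where
  restrict : ∀ l (f : Vec Bool (l + g) → Bool) k → Closed k f → Closed {l} k (λ u → f (u ++ T))
  restrict zero          f k       c   = tt
  restrict (suc l)       f (suc k) c a = restrict l (f ∘ (a ∷_)) k (c a)
  restrict (suc zero)    f zero    c   = tt
  restrict (suc (suc l)) f zero    c v = c (v ++ T)

interval-suc : ∀ a k x → interval (suc a) k (suc x) ≡ interval a k x
interval-suc zero    k x = refl
interval-suc (suc a) k x = refl

push-zero : ∀ n {f : Vec Bool (suc n) → Bool} → Shifted f → ∀ w → w ≤ n →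
  f (false ∷ tab n (interval 0 w)) ≡ true → f (tab (suc n) (interval 0 w)) ≡ true
push-zero n       S zero    _         h = h
push-zero (suc n) S (suc w) (s≤s w≤n) h = push-zero n (λ k → S (suc k) true) w w≤n (S 0 (tab n (interval 0 w)) h)

sort-left : ∀ {n} {f : Vec Bool n → Bool} → Shifted f → ∀ v → f v ≡ true → f (tab n (interval 0 (wt v))) ≡ true
sort-left         S []          h = h
sort-left         S (true ∷ v)  h = sort-left (λ k → S (suc k) true) v h
sort-left {suc n} S (false ∷ v) h = push-zero n S (wt v) (wt≤n v) (sort-left (λ k → S (suc k) false) v h)

-- Restriction to sets without the first b points leaves a shifted family, in which a member can be
-- moved to the left end.
sort-after : ∀ {n} {f : Vec Bool n → Bool} → Shifted f → ∀ b v → pre b v ≡ 0 → f v ≡ true → f (tab n (interval b (wt v))) ≡ true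
sort-after         S zero    v           _ h = sort-left S v h
sort-after         S (suc b) []          _ h = h
sort-after {suc n} {f} S (suc b) (false ∷ v) e h = subst (λ u → f (false ∷ u) ≡ true)
    (tab-cong n (λ x _ → sym (interval-suc b (wt v) x)))
  (sort-after (λ k → S (suc k) false) b v e h)

wt-single : ∀ n i → i < n → wt (single n i) ≡ 1
wt-single n i i<n = trans (wt-tab n (interval i 1)) (interval-size n i 1 (≤-trans (≤-reflexive (+-comm i 1)) i<n))

pre-tab : ∀ n b p → (∀ x → x < b → p x ≡ false) → pre b (tab n p) ≡ 0
pre-tab n       zero    p h = refl
pre-tab zero    (suc b) p h = refl
pre-tab (suc n) (suc b) p h rewrite h 0 (s≤s z≤n) = pre-tab n b (p ∘ suc) (λ x x<b → h (suc x) (s≤s x<b))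

single-down : ∀ {n} {f : Vec Bool n → Bool} → Shifted f → ∀ b i → b ≤ i → i < n → f (single n i) ≡ true → f (single n b) ≡ true
single-down {n} {f} S b i b≤i i<n h = subst (λ w → f (tab n (interval b w)) ≡ true) (wt-single n i i<n)
  (sort-after S b (single n i) (pre-tab n b (interval i 1) (λ x x<b → interval-below i 1 x (≤-trans x<b b≤i))) h)

-- The case m = 1

interval-+ : ∀ a b k x → interval (a + b) k (a + x) ≡ interval b k x
interval-+ zero    b k x = refl
interval-+ (suc a) b k x = trans (interval-suc (a + b) k (a + x)) (interval-+ a b k x)

pre-all : ∀ {n} (v : Vec Bool n) c → pre c v ≤ wt v
pre-all v           zero    = z≤n
pre-all []          (suc c) = z≤n
pre-all (b ∷ v)     (suc c) = +-monoʳ-≤ (ι b) (pre-all v c)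

pre-single : ∀ n c i → i < c → i < n → pre c (single n i) ≡ 1
pre-single (suc n) (suc c) zero    _         _         = cong suc (pre-tab n c (λ x → interval 0 1 (suc x)) (λ x _ → refl))
pre-single (suc n) (suc c) (suc i) (s≤s i<c) (s≤s i<n) =
  trans (cong (pre (suc c)) (single-suc n i)) (pre-single n c i i<c i<n)

empty-absent : ∀ {n s} {f : Vec Bool n → Bool} → Matchless n s f → f (empty n) ≡ false
empty-absent {n} {f = f} M with f (empty n) in e
... | false = refl
... | true  = ⊥-elim (matching M (λ _ → empty n) (λ _ _ _ _ → tab-pointwise Apart n (λ x _ ())) (λ _ _ → e))

singles-apart : ∀ n i j → i < j → Pointwise Apart (single n i) (single n j)
singles-apart n i j i<j = tab-pointwise Apart n (λ x _ → interval-apart i 1 j 1 x (≤-trans (≤-reflexive (+-comm i 1)) i<j))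

-- This singleton would bring all earlier ones with it, s + 1 disjoint members in all.
last-single-absent : ∀ {n s} {f : Vec Bool n → Bool} → Matchless n (suc s) f → Shifted f → s < n → f (single n s) ≡ false
last-single-absent {n} {s} {f} M S s<n with f (single n s) in e
... | false = refl
... | true  = ⊥-elim (matching M (single n) (λ i j i<j _ → singles-apart n i j i<j)
                (λ i i≤s → single-down S i s (≤-pred i≤s) s<n e))

single-beyond : ∀ {n} {f : Vec Bool n → Bool} → Shifted f → ∀ b i → b ≤ i → i < n → f (single n b)
    ≡ false → f (single n i) ≡ false
single-beyond {n} {f} S b i b≤i i<n e with f (single n i) in e′
... | false = refl
... | true  = false≢true (trans (sym e) (single-down S b i b≤i i<n e′))

gain-small : ∀ {n s} {f : Vec Bool n → Bool} c j → n ≡ c + j → Matchless n s f →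
  Tot n (gain 1 c f) ≤ ∑ j (λ i → ι (f (single n (c + i))))
gain-small {n} {s} {f} c j refl M = begin
  Tot n (gain 1 c f)
    ≤⟨ Tot-low n 2 (λ v _ → ≤-refl) (λ v 2≤w → gain-heavy 1 c f v (≤-trans 2≤w (m≤m+n (wt v) _))) ⟩
  Lev n 0 (gain 1 c f) + Lev n 1 (gain 1 c f)
    ≡⟨ cong₂ _+_ (trans (Lev₀ n (gain 1 c f)) no-empty) (Lev₁ n (gain 1 c f)) ⟩
  ∑ n (λ i → gain 1 c f (single n i))
    ≡⟨ ∑-split c j (λ i → gain 1 c f (single n i)) ⟩
  ∑ c (λ i → gain 1 c f (single n i)) + ∑ j (λ i → gain 1 c f (single n (c + i)))
    ≤⟨ +-mono-≤ (≤-reflexive (∑-zero c (λ i i<c → gain-heavy 1 c f (single n i) (heavy-single i i<c))))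
         (∑-mono j (λ i _ → gain≤ι 1 c f (single n (c + i)))) ⟩
  ∑ j (λ i → ι (f (single n (c + i)))) ∎
  where
  open ≤-Reasoning
  no-empty : gain 1 c f (empty n) ≡ 0
  no-empty rewrite empty-absent M = refl
  heavy-single : ∀ i → i < c → 1 < wt (single n i) + pre c (single n i)
  heavy-single i i<c = ≤-reflexive
      (sym (cong₂ _+_ (wt-single n i (≤-trans i<c (m≤m+n c j))) (pre-single n c i i<c (≤-trans i<c (m≤m+n c j)))))

-- By compression the first c + 1 singletons are members, which is s - d of the s one-point blocks.
-- So d pairs of one of the first s and one of the last d points are missing, and all pairs belong
-- to 𝒫.
loss-pairs : ∀ c d (f : Vec Bool (suc c + d + d) → Bool) → let s = suc c + d in
  Matchless (s + d) s f → Shifted f → f (single (s + d) c) ≡ true → d ≤ Tot (s + d) (loss 1 c f)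
loss-pairs c d f M S fc = begin
  d ≤⟨ W.missing (view-matchless 0 n {f = f} (λ R rs → rs) M) enough ⟩
  ∑ s (λ i → ∑ d (λ t → miss (f (tab n (W.block i ∪ W.tail t)))))
    ≡⟨ ∑-cong s (λ i i<s → ∑-cong d (λ t t<d → pair i t i<s t<d)) ⟩
  ∑ s (λ i → ∑ d (λ t → loss 1 c f (single s i ++ single d t)))
    ≤⟨ ∑-mono s (λ i _ → ≤-trans (m≤n+m _ _) (Tot-empty-singles d (λ T → loss 1 c f (single s i ++ T)))) ⟩
  ∑ s (λ i → Tot d (λ T → loss 1 c f (single s i ++ T)))
    ≤⟨ ≤-trans (m≤n+m (∑ s (λ i → Tot d (λ T → loss 1 c f (single s i ++ T)))) (Tot d (λ T → loss 1 c f (empty s ++ T))))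
         (Tot-empty-singles s (λ Q → Tot d (λ T → loss 1 c f (Q ++ T)))) ⟩
  Tot s (λ Q → Tot d (λ T → loss 1 c f (Q ++ T)))
    ≡⟨ sym (Tot-++ s d (loss 1 c f)) ⟩
  Tot n (loss 1 c f) ∎
  where
  open ≤-Reasoning
  s = suc c + d
  n = s + d
  module W = Blocks n s 1 d 1 (≤-reflexive (cong₂ _+_ (*-identityʳ s) (*-identityʳ d)))
  block-single : ∀ i → tab n (W.block i) ≡ single n i
  block-single i = cong (λ a → tab n (interval a 1)) (*-identityʳ i)
  enough : s ≤ ∑ s (λ i → ι (f (tab n (W.block i)))) + d
  enough = +-monoˡ-≤ d (begin
    suc c ≡⟨ sym (trans (∑-const (suc c) 1) (*-identityʳ (suc c))) ⟩
    ∑ (suc c) (λ _ → 1)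
      ≡⟨ ∑-cong (suc c) (λ i i≤c → sym (cong ι (trans (cong f (block-single i))
           (single-down S i c (≤-pred i≤c) (≤-trans (m≤m+n (suc c) d) (m≤m+n s d)) fc)))) ⟩
    ∑ (suc c) (λ i → ι (f (tab n (W.block i)))) ≤⟨ ∑-≤-bound (λ i → ι (f (tab n (W.block i)))) (m≤m+n (suc c) d) ⟩
    ∑ s (λ i → ι (f (tab n (W.block i)))) ∎)
  tab-pair : ∀ i t → i < s → t < d → tab n (W.block i ∪ W.tail t) ≡ single s i ++ single d t
  tab-pair i t i<s t<d = trans (tab-++ s d (W.block i ∪ W.tail t)) (cong₂ _++_
    (tab-cong s (λ x x<s → trans
        (cong (W.block i x ∨_)
            (interval-below (s * 1 + t * 1) 1 x
                (≤-trans x<s (≤-trans (≤-reflexive (sym (*-identityʳ s))) (m≤m+n (s * 1) (t * 1))))))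
      (trans (∨-identityʳ _) (cong (λ a → interval a 1 x) (*-identityʳ i)))))
    (tab-cong d (λ x _ → trans (cong (_∨ W.tail t (s + x)) (interval-above (i * 1) 1 (s + x)
        (≤-trans (≤-reflexive (trans (cong (_+ 1) (*-identityʳ i)) (+-comm i 1))) (≤-trans i<s (m≤m+n s x)))))
      (trans (cong₂ (λ a b → interval (a + b) 1 (s + x)) (*-identityʳ s) (*-identityʳ t)) (interval-+ s t 1 x)))))
  pair : ∀ i t → i < s → t < d → miss (f (tab n (W.block i ∪ W.tail t))) ≡ loss 1 c f (single s i ++ single d t)
  pair i t i<s t<d = trans (cong (λ v → miss (f v)) (tab-pair i t i<s t<d)) (sym (loss-heavy 1 c f (single s i ++ single d t)
    (≤-trans (≤-reflexive (sym
        (trans (wt-++ (single s i) (single d t)) (cong₂ _+_ (wt-single s i i<s) (wt-single d t t<d))))) (m≤m+n _ _))))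

pairs-case : ∀ c d (f : Vec Bool (suc c + d + d) → Bool) → Matchless (suc c + d + d) (suc c + d) f →
  Tot (suc c + d + d) (λ v → ι (f v)) ≤ Tot (suc c + d + d) (λ v → ι (heavy 1 c v))
pairs-case c d f₀ M₀ with compress f₀ M₀
... | f , M , S , size = subst (_≤ Tot n (λ v → ι (heavy 1 c v))) (sym size)
    (exchange n 1 c f (≤-trans (gain-small c (suc d + d) n≡ M) compare))
  where
  n = suc c + d + d
  n≡ : n ≡ c + (suc d + d)
  n≡ = trans (cong (_+ d) (sym (+-suc c d))) (+-assoc c (suc d) d)
  inside : ∀ i → i < suc d + d → c + i < n
  inside i i< = subst (c + i <_) (sym n≡) (+-monoʳ-< c i<)
  open ≤-Reasoning
  compare : ∑ (suc d + d) (λ i → ι (f (single n (c + i)))) ≤ Tot n (loss 1 c f)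
  compare with f (single n c) in fc
  ... | false = ≤-trans (≤-reflexive
      (∑-zero (suc d + d) (λ i i< → cong ι (single-beyond S c (c + i) (m≤m+n c i) (inside i i<) fc)))) z≤n
  ... | true  = begin
    -- No singleton from position c + d = s - 1 on is a member, so at most the d positions c, ..., c
    -- + d - 1 contribute to the gain.
    ∑ (suc d + d) (λ i → ι (f (single n (c + i))))
      ≡⟨ cong (λ k → ∑ k (λ i → ι (f (single n (c + i))))) (sym (+-suc d d)) ⟩
    ∑ (d + suc d) (λ i → ι (f (single n (c + i))))
      ≡⟨ ∑-split d (suc d) (λ i → ι (f (single n (c + i)))) ⟩
    ∑ d (λ i → ι (f (single n (c + i)))) + ∑ (suc d) (λ i → ι (f (single n (c + (d + i)))))
      ≤⟨ +-mono-≤ (∑-mono d (λ i _ → ι≤1 _)) (≤-reflexive (∑-zero (suc d) (λ i i≤d → cong ι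
           (single-beyond S (c + d) (c + (d + i)) (+-monoʳ-≤ c (m≤m+n d i))
               (inside (d + i) (subst (d + i <_) (+-suc d d) (+-monoʳ-< d i≤d)))
             (last-single-absent M S (m≤m+n (suc c + d) d)))))) ⟩
    ∑ d (λ _ → 1) + 0 ≡⟨ trans (+-identityʳ _) (trans (∑-const d 1) (*-identityʳ d)) ⟩
    d ≤⟨ loss-pairs c d f M S fc ⟩
    Tot n (loss 1 c f) ∎

-- The case s ≥ l m + 3 l + 3

Lev-suffix : ∀ c g k (h : Vec Bool (c + g) → ℕ) → Lev g k (λ v → h (empty c ++ v)) ≤ Lev (c + g) k h
Lev-suffix zero    g k       h = ≤-refl
Lev-suffix (suc c) g zero    h = Lev-suffix c g zero (h ∘ (false ∷_))
Lev-suffix (suc c) g (suc k) h = ≤-trans (Lev-suffix c g (suc k) (h ∘ (false ∷_))) (m≤m+n _ _)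

binom-mono : ∀ {n n′} k → n ≤ n′ → binom n k ≤ binom n′ k
binom-mono {n} k n≤n′ with ≤⇒∃ n≤n′
... | z , refl = subst (λ x → binom n k ≤ binom x k) (+-comm z n) (Lev-suffix z n k (λ _ → 1))

-- The t points are deleted one at a time; each deletion loses the sets through that point, at most
-- `binom N k` of them.
binom-avoid : ∀ t g k N → t + g ≤ suc N → binom (t + g) (suc k) ≤ binom g (suc k) + t * binom N k
binom-avoid zero    g k N _       = m≤m+n _ 0
binom-avoid (suc t) g k N (s≤s h) = begin
  binom (t + g) (suc k) + binom (t + g) k ≤⟨ +-mono-≤ (binom-avoid t g k N (m≤n⇒m≤1+n h)) (binom-mono k h) ⟩
  binom g (suc k) + t * binom N k + binom N k
      ≡⟨ trans (+-assoc (binom g (suc k)) _ _) (cong (binom g (suc k) +_) (+-comm (t * binom N k) _)) ⟩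
  binom g (suc k) + suc t * binom N k ∎
  where open ≤-Reasoning

-- By `absorb` the sets through one point are the fraction (k + 1) / n of their level.
binom-avoid-density : ∀ t g k → (t + g) * binom (t + g) (suc k) ≤ (t + g) * binom g (suc k) + t * suc k * binom (t + g) (suc k)
binom-avoid-density zero    zero    k = z≤n
binom-avoid-density zero    (suc g) k = m≤m+n _ 0
binom-avoid-density (suc t) g       k = begin
  n * binom n (suc k) ≤⟨ *-monoʳ-≤ n (binom-avoid (suc t) g k (t + g) ≤-refl) ⟩
  n * (binom g (suc k) + suc t * binom (t + g) k) ≡⟨ *-distribˡ-+ n (binom g (suc k)) _ ⟩
  n * binom g (suc k) + n * (suc t * binom (t + g) k)
    ≡⟨ cong (n * binom g (suc k) +_)
         (trans (swap-factors n (suc t) (binom (t + g) k))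
             (trans (cong (suc t *_) (absorb (t + g) k)) (sym (*-assoc (suc t) (suc k) _)))) ⟩
  n * binom g (suc k) + suc t * suc k * binom n (suc k) ∎
  where
  open ≤-Reasoning
  n = suc t + g

-- The points outside the l given members are partitioned into d sets of size m + 1, one of which is missing.
many-large-gaps : ∀ l d m (f : Vec Bool (l * m + d * suc m) → Bool) → Matchless (l * m + d * suc m) (l + d) f →
  (∀ i → i < l → f (tab (l * m + d * suc m) (interval (i * m) m)) ≡ true) →
  binom (d * suc m) (suc m) ≤ d * Lev (l * m + d * suc m) (suc m) (λ v → miss (f v))
many-large-gaps l d m f M members = ≤-trans (*-cancelˡ-≤ (g !) {{g !≢0}} (begin
  g ! * binom g (suc m) ≡⟨ *-comm (g !) _ ⟩
  binom g (suc m) * g ! ≤⟨ *-monoʳ-≤ (binom g (suc m)) bound ⟩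
  binom g (suc m) * (d * gaps f (empty c) (suc m)) ≡⟨ swap-factors (binom g (suc m)) d _ ⟩
  d * (binom g (suc m) * gaps f (empty c) (suc m)) ≡⟨ cong (d *_) (binom-den g (suc m) _) ⟩
  d * (g ! * Lev g (suc m) (λ v → miss (f (empty c ++ v)))) ≡⟨ swap-factors d (g !) _ ⟩
  g ! * (d * Lev g (suc m) (λ v → miss (f (empty c ++ v)))) ∎))
  (*-monoʳ-≤ d (Lev-suffix c g (suc m) (λ v → miss (f v))))
  where
  open ≤-Reasoning
  c = l * m
  g = d * suc m
  -- The first l sets are members inside the prefix and take no point of the suffix; each of the
  -- other d takes m + 1.
  k : ℕ → ℕ
  k i = if i <ᵇ l then 0 else suc m
  k-small : ∀ i → i < l → k i ≡ 0
  k-small i i<l rewrite <ᵇ-complete i<l = refl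
  k-large : ∀ i → k (l + i) ≡ suc m
  k-large i rewrite <ᵇ-refute (m≤m+n l i) = refl
  sizes : ∑ (l + d) k ≤ g
  sizes = ≤-reflexive (trans (∑-split l d k)
      (cong₂ _+_ (∑-zero l k-small) (trans (∑-cong d (λ i _ → k-large i)) (∑-const d (suc m)))))
  small : ∀ i → i < l → gaps f (tab c (interval (i * m) m)) (k i) ≡ 0
  small i i<l rewrite k-small i i<l = trans (cong (0 ! * g ! *_) (trans (Lev₀ g _) present)) (*-zeroʳ (0 ! * g !))
    where
    present : miss (f (tab c (interval (i * m) m) ++ empty g)) ≡ 0
    present = cong miss (trans (cong f (sym (trans (tab-++ c g (interval (i * m) m)) (cong (tab c (interval (i * m) m) ++_)
      (tab-cong g (λ x _ → interval-above (i * m) m (c + x)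
          (≤-trans (subst (_≤ l * m) (+-comm m (i * m)) (*-monoˡ-≤ m i<l)) (m≤m+n c x)))))))) (members i i<l))
  large : ∀ i → gaps f (tab c (interval ((l + i) * m) m)) (k (l + i)) ≡ gaps f (empty c) (suc m)
  large i = cong₂ (gaps f) (tab-cong c
      (λ x x<c → interval-below ((l + i) * m) m x (≤-trans x<c (*-monoˡ-≤ m (m≤m+n l i))))) (k-large i)
  bound : g ! ≤ d * gaps f (empty c) (suc m)
  bound = begin
    g !
      ≤⟨ union-bound M (λ i → interval (i * m) m) k
           (λ i j x i<j _ _ → interval-apart (i * m) m (j * m) m x
               (subst (_≤ j * m) (+-comm m (i * m)) (*-monoˡ-≤ m i<j))) sizes ⟩
    ∑ (l + d) (λ i → gaps f (tab c (interval (i * m) m)) (k i))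
      ≡⟨ ∑-split l d _ ⟩
    ∑ l (λ i → gaps f (tab c (interval (i * m) m)) (k i)) + ∑ d (λ i → gaps f (tab c (interval ((l + i) * m) m)) (k (l + i)))
      ≡⟨ cong₂ _+_ (∑-zero l small) (trans (∑-cong d (λ i _ → large i)) (∑-const d _)) ⟩
    d * gaps f (empty c) (suc m) ∎

halves : ∀ d → Σ ℕ λ p → Σ ℕ λ q → d ≡ p + q × p ≤ q × q ≤ suc p
halves zero    = 0 , 0 , refl , z≤n , z≤n
halves (suc d) with halves d
... | p , q , refl , p≤q , q≤1+p with m≤n⇒m<n∨m≡n p≤q
...   | inj₁ p<q  = suc p , q , refl , p<q , m≤n⇒m≤1+n q≤1+p
...   | inj₂ refl = p , suc p , sym (+-suc p p) , n≤1+n p , ≤-refl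

lower-half : ∀ p q → 3 ≤ p + q → q ≤ suc p → 0 < p
lower-half zero    q h h′ = ⊥-elim (<⇒≱ (s≤s (s≤s z≤n)) (≤-trans h h′))
lower-half (suc p) q _ _  = s≤s z≤n

gaps-ring₁ : ∀ c u z → let l = suc c; m = suc u; d = l * m + 2 * l + 3 + z in
  l * m + d * suc m ≡ l * m * suc m + (l * m + (2 * l + 3 + z) * suc m)
gaps-ring₁ = solve-∀

gaps-ring₂ : ∀ c u z → let l = suc c; m = suc u; d = l * m + 2 * l + 3 + z in
  (l + d) * (l * m + (2 * l + 3 + z) * suc m) ≡ (2 * l + 3) * (l * m + d * suc m)
    + (12 + 18 * c + 8 * u + 15 * z + 6 * c * c + 13 * c * u + 9 * c * z + u * u + 10 * u * z + 2 * z * z + 5 * c * c * u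
       + 2 * c * u * u + 7 * c * u * z + u * u * z + u * z * z + c * c * u * u + c * u * u * z)
gaps-ring₂ = solve-∀

gaps-ring₃ : ∀ a n C → a * n * C ≡ n * (a * C)
gaps-ring₃ = solve-∀

-- C, C₁ and B stand for C(n, m), C(n, m + 1) and C(d (m + 1), m + 1), and Y for the number of missing (m + 1)-sets.
gaps-arithmetic : ∀ c u z C C₁ B Y → let l = suc c; m = suc u; d = l * m + 2 * l + 3 + z; n = l * m + d * suc m in
  n * C₁ ≤ n * B + l * m * suc m * C₁ → B ≤ d * Y → d * C ≤ C₁ → (2 * l + 3) * C ≤ (l + d) * Y
gaps-arithmetic c u z C C₁ B Y avoid B≤ C₁≥ = *-cancelˡ-≤ n (begin
  n * ((2 * l + 3) * C) ≡⟨ sym (gaps-ring₃ (2 * l + 3) n C) ⟩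
  (2 * l + 3) * n * C ≤⟨ *-monoˡ-≤ C coefficients ⟩
  s * K * C ≡⟨ *-assoc s K C ⟩
  s * (K * C) ≤⟨ *-monoʳ-≤ s KC≤ ⟩
  s * (n * Y) ≡⟨ swap-factors s n Y ⟩
  n * (s * Y) ∎)
  where
  open ≤-Reasoning
  l = suc c
  m = suc u
  d = l * m + 2 * l + 3 + z
  n = l * m + d * suc m
  s = l + d
  K = l * m + (2 * l + 3 + z) * suc m
  -- The source of condition (iii): divided by m + 1, K is a little more than d - l m ≥ 2 l + 3, and
  -- n is slightly less than s.
  coefficients : (2 * l + 3) * n ≤ s * K
  coefficients = ≤-by _ (gaps-ring₂ c u z)
  KC₁≤ : K * C₁ ≤ n * B
  KC₁≤ = +-cancelˡ-≤ (l * m * suc m * C₁) _ _ (begin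
    l * m * suc m * C₁ + K * C₁ ≡⟨ sym (*-distribʳ-+ C₁ (l * m * suc m) K) ⟩
    (l * m * suc m + K) * C₁ ≡⟨ cong (_* C₁) (sym (gaps-ring₁ c u z)) ⟩
    n * C₁ ≤⟨ avoid ⟩
    n * B + l * m * suc m * C₁ ≡⟨ +-comm (n * B) _ ⟩
    l * m * suc m * C₁ + n * B ∎)
  KC≤ : K * C ≤ n * Y
  KC≤ = *-cancelˡ-≤ d {{>-nonZero (≤-trans (s≤s z≤n) (≤-trans (m≤n+m 3 (l * m + 2 * l)) (m≤m+n _ z)))}} (begin
    d * (K * C) ≡⟨ swap-factors d K C ⟩
    K * (d * C) ≤⟨ *-monoʳ-≤ K C₁≥ ⟩
    K * C₁ ≤⟨ KC₁≤ ⟩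
    n * B ≤⟨ *-monoʳ-≤ n B≤ ⟩
    n * (d * Y) ≡⟨ swap-factors n d Y ⟩
    d * (n * Y) ∎)

dense-ring₁ : ∀ d s T L N → 2 * d * s * T * (L + N) ≡ 2 * d * (s * (T * L)) + 2 * d * (s * (T * N))
dense-ring₁ = solve-∀

dense-ring₂ : ∀ d C T c q s g g⁺ → 2 * d * (C * (T * c + q * (s * g) + s * (s * g⁺)))
    ≡ 2 * d * c * (T * C) + (q + q) * s * (d * C * g) + 2 * d * s * (s * C * g⁺)
dense-ring₂ = solve-∀

dense-ring₃ : ∀ d s T E → 2 * d * (s * (T * E)) ≡ 2 * d * T * (s * E)
dense-ring₃ = solve-∀

dense-ring₄ : ∀ d T c s C Y Y⁺ → 2 * d * T * (2 * C) + (2 * d * c * (T * C) + suc d * s * (T * Y) + 2 * d * s * (T * Y⁺))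
  ≡ T * (2 * d * (2 + c) * C + (suc d * (s * Y) + 2 * d * s * Y⁺))
dense-ring₄ = solve-∀

dense-ring₅ : ∀ c a C → (suc c + suc c + 3 + a) * ((2 * suc c + 3) * C)
    ≡ 2 * suc (suc c + suc c + 3 + a) * (2 + c) * C + suc a * C
dense-ring₅ = solve-∀

dense-ring₆ : ∀ d s T Y Y⁺ → T * (d * (s * Y) + (suc (suc d) * (s * Y) + 2 * suc d * s * Y⁺)) ≡ 2 * suc d * s * T * (Y + Y⁺)
dense-ring₆ = solve-∀

-- As 2 q ≤ d + 1, the blocks use up about half of the missing (m + 1)-sets. The other half has to
-- cover (c + 2) C, where c C stems from the blocks that may be members for free and 2 C from the
-- lower levels. With s Y ≥ (2 l + 3) C and d ≥ 2 l + 4 it does.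
dense-arithmetic : ∀ c d′ a q T E h g g⁺ C C₁ C₂ L N Y Y⁺ → let d = suc d′; s = suc c + d in NonZero T →
  d′ ≡ suc c + suc c + 3 + a → q + q ≤ suc d → T * L ≤ T * E → C * h ≡ T * N → C₁ * g ≡ T * Y → C₂ * g⁺ ≡ T * Y⁺ →
  s * h ≤ T * c + q * (s * g) + s * (s * g⁺) → s * E ≤ 2 * C → d * C ≤ C₁ → s * C ≤ C₂ → (2 * suc c + 3) * C ≤ s * Y →
  L + N ≤ Y + Y⁺
dense-arithmetic c d′ a q T E h g g⁺ C C₁ C₂ L N Y Y⁺ T≢0 d′≡ 2q≤ low level loss₁ loss₂ block E≤ C₁≥ C₂≥ Y≥ =
  *-cancelˡ-≤ (2 * d * s * T) {{m*n≢0 (2 * d * s) T {{_}} {{T≢0}}}} (begin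
    2 * d * s * T * (L + N) ≡⟨ dense-ring₁ d s T L N ⟩
    2 * d * (s * (T * L)) + 2 * d * (s * (T * N))
      ≤⟨ +-mono-≤ (*-monoʳ-≤ (2 * d) (*-monoʳ-≤ s low)) (≤-reflexive (cong (λ x → 2 * d * (s * x)) (sym level))) ⟩
    2 * d * (s * (T * E)) + 2 * d * (s * (C * h)) ≡⟨ cong₂ _+_ (dense-ring₃ d s T E) (cong (2 * d *_) (swap-factors s C h)) ⟩
    2 * d * T * (s * E) + 2 * d * (C * (s * h)) ≤⟨ +-mono-≤ (*-monoʳ-≤ (2 * d * T) E≤) (*-monoʳ-≤ (2 * d) (*-monoʳ-≤ C block)) ⟩
    2 * d * T * (2 * C) + 2 * d * (C * (T * c + q * (s * g) + s * (s * g⁺)))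
      ≡⟨ cong (2 * d * T * (2 * C) +_) (dense-ring₂ d C T c q s g g⁺) ⟩
    2 * d * T * (2 * C) + (2 * d * c * (T * C) + (q + q) * s * (d * C * g) + 2 * d * s * (s * C * g⁺))
      ≤⟨ +-monoʳ-≤ (2 * d * T * (2 * C)) (+-mono-≤ (+-monoʳ-≤ (2 * d * c * (T * C))
           (*-mono-≤ (*-monoˡ-≤ s 2q≤) (≤-trans (*-monoˡ-≤ g C₁≥) (≤-reflexive loss₁))))
           (*-monoʳ-≤ (2 * d * s) (≤-trans (*-monoˡ-≤ g⁺ C₂≥) (≤-reflexive loss₂)))) ⟩
    2 * d * T * (2 * C) + (2 * d * c * (T * C) + suc d * s * (T * Y) + 2 * d * s * (T * Y⁺))
      ≡⟨ dense-ring₄ d T c s C Y Y⁺ ⟩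
    T * (2 * d * (2 + c) * C + (suc d * (s * Y) + 2 * d * s * Y⁺))
      ≤⟨ *-monoʳ-≤ T (+-monoˡ-≤ (suc d * (s * Y) + 2 * d * s * Y⁺) enough) ⟩
    T * (d′ * (s * Y) + (suc d * (s * Y) + 2 * d * s * Y⁺)) ≡⟨ dense-ring₆ d′ s T Y Y⁺ ⟩
    2 * d * s * T * (Y + Y⁺) ∎)
  where
  open ≤-Reasoning
  d = suc d′
  s = suc c + d
  enough : 2 * d * (2 + c) * C ≤ d′ * (s * Y)
  enough = begin
    2 * d * (2 + c) * C ≡⟨ cong (λ x → 2 * suc x * (2 + c) * C) d′≡ ⟩
    2 * suc (suc c + suc c + 3 + a) * (2 + c) * C ≤⟨ ≤-by _ (dense-ring₅ c a C) ⟩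
    (suc c + suc c + 3 + a) * ((2 * suc c + 3) * C) ≡⟨ cong (_* ((2 * suc c + 3) * C)) (sym d′≡) ⟩
    d′ * ((2 * suc c + 3) * C) ≤⟨ *-monoʳ-≤ d′ Y≥ ⟩
    d′ * (s * Y) ∎

dense-size₁ : ∀ l d m → (l + d) * m + d ≡ l * m + d * suc m
dense-size₁ = solve-∀

dense-size₂ : ∀ c d k j → let l = suc c in l * suc (k + j) + d * suc (suc (k + j))
    ≡ (c + d) * suc k + k + (c * j + d * j + suc j + d)
dense-size₂ = solve-∀

dense-size₃ : ∀ c d m → suc c * m + d * suc m ≡ d * suc m + m + c * m
dense-size₃ = solve-∀

dense-size₄ : ∀ c u z → let l = suc c; m = suc u; d = l * m + 2 * l + 3 + z in
  l * m + d * suc m ≡ (2 * suc (suc m) + suc m) + (5 + 7 * c + 6 * u + 2 * z + 6 * c * u + u * u + u * z + c * u * u)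
dense-size₄ = solve-∀

dense-size₅ : ∀ c u z C → let l = suc c; m = suc u; d = l * m + 2 * l + 3 + z in 2 * (d * C)
    ≡ (l + d) * C + (l * m + l + 3 + z) * C
dense-size₅ = solve-∀

dense-size₆ : ∀ c u z → u + c * suc u + 2 * suc c + 3 + z ≡ suc c + suc c + 3 + (u + c * suc u + z)
dense-size₆ = solve-∀

dense-size₇ : ∀ c u z E → let l = suc c; m = suc u in
  2 * ((c + (l * m + 2 * l + 2 + z)) * E) ≡ (l + (l * m + 2 * l + 3 + z)) * E + (3 + 4 * c + u + z + c * u) * E
dense-size₇ = solve-∀

dense-size₈ : ∀ c u z → let l = suc c; m = suc u in c + (l * m + 2 * l + 3 + z) ≡ suc (c + (l * m + 2 * l + 2 + z))
dense-size₈ = solve-∀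

-- So many (m + 1)-sets are missing here that the family may even contain all sets of fewer than m points.
dense-case : ∀ c u z f → let l = suc c; m = suc u; d = l * m + 2 * l + 3 + z; n = l * m + d * suc m in
  Matchless n (l + d) f → (∀ i → i < l → f (tab n (interval (i * m) m)) ≡ true) →
  Tot n (λ v → ι (f v)) ≤ Tot n (λ v → ι (heavy m c v))
dense-case c u z f M members with halves (suc c * suc u + 2 * suc c + 3 + z)
... | p , q , d≡ , p≤q , q≤1+p = exchange-levels n m c f
  (dense-arithmetic c (u + c * suc u + 2 * suc c + 3 + z) (u + c * suc u + z) q (n !) (∑ m (binom n)) (hits {0} f [] m)
    (gaps {0} f [] (suc m)) (gaps {0} f [] (suc (suc m))) C C₁ C₂ _ _ Y _ (n !≢0)
    (dense-size₆ c u z) (≤-trans (+-monoˡ-≤ q q≤1+p) (≤-reflexive (cong suc (sym d≡))))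
    low (binom-den n m (λ v → ι (f v))) (binom-den n (suc m) (λ v → miss (f v))) (binom-den n (suc (suc m)) (λ v → miss (f v)))
    (subst (λ q → s * hits {0} f [] m ≤ n ! * c + q * (s * gaps {0} f [] (suc m)) + s * (s * gaps {0} f [] (suc (suc m)))) d∸p
      (block-density M m c d p refl (≤-reflexive (dense-size₁ l d m)) 0<p (≤-trans (+-monoʳ-≤ p p≤q) (≤-reflexive (sym d≡)))))
    small grow₁
    (≤-trans (≤-by _ (dense-size₅ c u z C)) (≤-trans (*-monoʳ-≤ 2 grow₁) (binom-grow n (suc m) 2 (≤-by _ (dense-size₄ c u z)))))
    (gaps-arithmetic c u z C C₁ (binom (d * suc m) (suc m)) Y (binom-avoid-density (l * m) (d * suc m) m)
      (many-large-gaps l d m f M members) grow₁))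
  where
  open ≤-Reasoning
  l = suc c
  m = suc u
  d = l * m + 2 * l + 3 + z
  s = l + d
  n = l * m + d * suc m
  C C₁ C₂ Y : ℕ
  C  = binom n m
  C₁ = binom n (suc m)
  C₂ = binom n (suc (suc m))
  Y  = Lev n (suc m) (λ v → miss (f v))
  d∸p : d ∸ p ≡ q
  d∸p = trans (cong (_∸ p) d≡) (m+n∸m≡n p q)
  0<p : 0 < p
  0<p = lower-half p q (≤-trans (≤-trans (m≤n+m 3 (l * m + 2 * l)) (m≤m+n _ z)) (≤-reflexive d≡)) q≤1+p
  low : n ! * ∑ m (λ k → Lev n k (λ v → ι (f v))) ≤ n ! * ∑ m (binom n)
  low = *-monoʳ-≤ (n !) (∑-mono m (λ k _ → Lev-mono n k (λ v _ → ι≤1 (f v))))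
  grow₁ : d * C ≤ C₁
  grow₁ = binom-grow n m d (≤-by _ (dense-size₃ c d m))
  growth : ∀ k → k < m → (c + d) * binom n k ≤ binom n (suc k)
  growth k k<m with ≤⇒∃ k<m
  ... | j , refl = binom-grow n k (c + d) (≤-by _ (dense-size₂ c d k j))
  small : s * ∑ m (binom n) ≤ 2 * C
  small = begin
    s * ∑ m (binom n) ≤⟨ ≤-by _ (dense-size₇ c u z (∑ m (binom n))) ⟩
    2 * ((c + (l * m + 2 * l + 2 + z)) * ∑ m (binom n)) ≤⟨ *-monoʳ-≤ 2 (binom-below n (c + (l * m + 2 * l + 2 + z)) m
        (λ k k<m → subst (λ r → r * binom n k ≤ binom n (suc k)) (dense-size₈ c u z) (growth k k<m))) ⟩
    2 * C ∎

-- Members outside 𝒫 that meet [l - 1]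

member : ∀ {c} → Vec Bool c → Points
member []      x       = false
member (b ∷ Q) zero    = b
member (b ∷ Q) (suc x) = member Q x

tab-member : ∀ {c} (Q : Vec Bool c) → tab c (member Q) ≡ Q
tab-member []      = refl
tab-member (b ∷ Q) = cong (b ∷_) (tab-member Q)

positive : ℕ → ℕ
positive zero    = 0
positive (suc _) = 1

-- With S κ the number of sets of fewer than κ points of the suffix and κ = m + 1, `prefixes` counts
-- the sets outside 𝒫 by their trace Q on the first c points, each of which has weight 2. The
-- variant `prefixes⁺` keeps the nonempty traces.
prefixes prefixes⁺ : (ℕ → ℕ) → ℕ → ℕ → ℕ
prefixes  S c κ = Tot c (λ Q → S (κ ∸ (wt Q + wt Q)))
prefixes⁺ S c κ = Tot c (λ Q → positive (wt Q) * S (κ ∸ (wt Q + wt Q)))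

∸-double : ∀ κ w → κ ∸ (suc w + suc w) ≡ κ ∸ 2 ∸ (w + w)
∸-double κ w = trans (cong (κ ∸_) (cong suc (+-suc w w))) (sym (∸-+-assoc κ 2 (w + w)))

prefixes⁺-suc : ∀ S c κ → prefixes⁺ S (suc c) κ ≡ prefixes⁺ S c κ + prefixes S c (κ ∸ 2)
prefixes⁺-suc S c κ = cong (prefixes⁺ S c κ +_) (Tot-cong c (λ Q → trans (*-identityˡ _) (cong S (∸-double κ (wt Q)))))

prefixes-split : ∀ S c κ → prefixes S c κ ≡ S κ + prefixes⁺ S c κ
prefixes-split S zero    κ = sym (+-identityʳ (S κ))
prefixes-split S (suc c) κ = begin
  prefixes S c κ + Tot c (λ Q → S (κ ∸ (suc (wt Q) + suc (wt Q))))
    ≡⟨ cong₂ _+_ (prefixes-split S c κ) (Tot-cong c (λ Q → cong S (∸-double κ (wt Q)))) ⟩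
  S κ + prefixes⁺ S c κ + prefixes S c (κ ∸ 2)
    ≡⟨ +-assoc (S κ) _ _ ⟩
  S κ + (prefixes⁺ S c κ + prefixes S c (κ ∸ 2))
    ≡⟨ cong (S κ +_) (sym (prefixes⁺-suc S c κ)) ⟩
  S κ + prefixes⁺ S (suc c) κ ∎
  where open ≡-Reasoning

prefix-count-ring₁ : ∀ c a → 2 * c * a + (a + a) ≡ 2 * suc c * a
prefix-count-ring₁ = solve-∀

-- S falls by a factor of 2 C whenever κ falls by 2, so larger traces at most double the
-- contribution S (κ - 2) of a one-point trace.
prefixes⁺-bound : ∀ S C M → (∀ κ → κ ≤ M → 2 * C * S (κ ∸ 2) ≤ S κ) → ∀ c → c ≤ C → ∀ κ → κ ≤ 2 + M → prefixes⁺ S c κ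
    ≤ 2 * c * S (κ ∸ 2)
prefixes⁺-bound S C M h zero    _   κ _   = z≤n
prefixes⁺-bound S C M h (suc c) c<C κ κ≤ = begin
  prefixes⁺ S (suc c) κ ≡⟨ prefixes⁺-suc S c κ ⟩
  prefixes⁺ S c κ + prefixes S c (κ ∸ 2) ≡⟨ cong (prefixes⁺ S c κ +_) (prefixes-split S c (κ ∸ 2)) ⟩
  prefixes⁺ S c κ + (S (κ ∸ 2) + prefixes⁺ S c (κ ∸ 2))
    ≤⟨ +-mono-≤ (prefixes⁺-bound S C M h c (<⇒≤ c<C) κ κ≤)
         (+-monoʳ-≤ (S (κ ∸ 2)) (≤-trans (prefixes⁺-bound S C M h c (<⇒≤ c<C) (κ ∸ 2) (≤-trans (m∸n≤m κ 2) κ≤))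
           (≤-trans (*-monoˡ-≤ (S (κ ∸ 2 ∸ 2)) (*-monoʳ-≤ 2 (<⇒≤ c<C))) (h (κ ∸ 2) (m≤n+o⇒m∸n≤o κ 2 κ≤))))) ⟩
  2 * c * S (κ ∸ 2) + (S (κ ∸ 2) + S (κ ∸ 2)) ≡⟨ prefix-count-ring₁ c (S (κ ∸ 2)) ⟩
  2 * suc c * S (κ ∸ 2) ∎
  where open ≤-Reasoning

prefix-ring₁ : ∀ A c G e d → A + c * G + e + d * G ≡ A + (c + d) * G + e
prefix-ring₁ = solve-∀

prefix-ring₂ : ∀ a w k b → a + 2 * w + k + b ≡ a + (k + (w + w)) + b
prefix-ring₂ = solve-∀

-- Q ++ T with Q nonempty, one set {i} ++ T_i for every i < c outside Q, and sets of size m + 1 otherwise.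
prefix-density : ∀ {c g d μ} {f : Vec Bool (c + g) → Bool} → let m = suc μ in Matchless (c + g) (suc c + d) f →
  c * μ + m + d * suc m ≤ g → ∀ (Q : Vec Bool c) k → k + (wt Q + wt Q) ≤ m →
  hits f Q k ≤ ∑ c (λ i → gaps f (single c i) μ) + (suc c + d) * gaps f (empty c) (suc m)
prefix-density {c} {g} {d} {μ} {f} M fits Q k light = +-cancelʳ-≤ (gaps f Q k) _ _ (begin
  hits f Q k + gaps f Q k ≡⟨ hits+gaps f Q k k≤g ⟩
  g ! ≤⟨ union-bound M q κ q-apart sizes ⟩
  ∑ (suc c + d) (λ i → gaps f (tab c (q i)) (κ i)) ≡⟨ ∑-split (suc c) d _ ⟩
  ∑ c (λ i → gaps f (tab c (q i)) (κ i)) + gaps f (tab c (q c)) (κ c) + ∑ d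
      (λ i → gaps f (tab c (q (suc c + i))) (κ (suc c + i)))
    ≤⟨ +-mono-≤ (+-mono-≤ (∑-mono c below) (≤-reflexive at-c))
         (≤-reflexive (trans (∑-cong d (λ i _ → above i)) (∑-const d G))) ⟩
  ∑ c (λ i → gaps f (single c i) μ + G) + gaps f Q k + d * G
    ≡⟨ cong (λ z → z + gaps f Q k + d * G) (trans (∑-+ c (λ i → gaps f (single c i) μ) (λ _ → G)) (cong (A +_) (∑-const c G))) ⟩
  A + c * G + gaps f Q k + d * G ≡⟨ prefix-ring₁ A c G (gaps f Q k) d ⟩
  A + (c + d) * G + gaps f Q k
    ≤⟨ +-monoˡ-≤ (gaps f Q k) (+-monoʳ-≤ A (*-monoˡ-≤ G (n≤1+n (c + d)))) ⟩
  A + (suc c + d) * G + gaps f Q k ∎)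
  where
  open ≤-Reasoning
  m = suc μ
  A G : ℕ
  A = ∑ c (λ i → gaps f (single c i) μ)
  G = gaps f (empty c) (suc m)
  k≤g : k ≤ g
  k≤g = ≤-trans (m+n≤o⇒m≤o k light) (≤-trans (≤-trans (m≤n+m m (c * μ)) (m≤m+n (c * μ + m) _)) fits)
  none : Points
  none _ = false
  q : ℕ → Points
  q i = if i <ᵇ c then (if member Q i then none else interval i 1) else (if i <ᵇ suc c then member Q else none)
  κ : ℕ → ℕ
  κ i = if i <ᵇ c then (if member Q i then suc m else μ) else (if i <ᵇ suc c then k else suc m)
  q-c : q c ≡ member Q
  q-c rewrite <ᵇ-refute (≤-refl {c}) | <ᵇ-complete (n<1+n c) = refl
  κ-c : κ c ≡ k
  κ-c rewrite <ᵇ-refute (≤-refl {c}) | <ᵇ-complete (n<1+n c) = refl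
  q-above : ∀ i → c < i → q i ≡ none
  q-above i c<i rewrite <ᵇ-refute (<⇒≤ c<i) | <ᵇ-refute c<i = refl
  κ-above : ∀ i → c < i → κ i ≡ suc m
  κ-above i c<i rewrite <ᵇ-refute (<⇒≤ c<i) | <ᵇ-refute c<i = refl
  at-c : gaps f (tab c (q c)) (κ c) ≡ gaps f Q k
  at-c = cong₂ (gaps f) (trans (cong (tab c) q-c) (tab-member Q)) κ-c
  above : ∀ i → gaps f (tab c (q (suc c + i))) (κ (suc c + i)) ≡ G
  above i = cong₂ (gaps f) (cong (tab c) (q-above (suc c + i) (m≤m+n (suc c) i))) (κ-above (suc c + i) (m≤m+n (suc c) i))
  below : ∀ i → i < c → gaps f (tab c (q i)) (κ i) ≤ gaps f (single c i) μ + G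
  below i i<c rewrite <ᵇ-complete i<c with member Q i
  ... | true  = m≤n+m G _
  ... | false = m≤m+n _ G
  q-below : ∀ i x → i < c → q i x ≡ true → x ≡ i × member Q i ≡ false
  q-below i x i<c h rewrite <ᵇ-complete i<c with member Q i
  ... | false = ≤-antisym (≤-pred (≤-trans (proj₂ (interval-bounds i 1 x h)) (≤-reflexive (+-comm i 1))))
      (proj₁ (interval-bounds i 1 x h)) , refl
  q-apart : ∀ i j x → i < j → j < suc c + d → x < c → q i x ≡ true → q j x ≡ true → ⊥
  q-apart i j x i<j _ _ hi hj with <-cmp j c
  ... | tri< j<c _ _ with q-below i x (<-trans i<j j<c) hi | q-below j x j<c hj
  ...   | x≡i , _ | x≡j , _ = <⇒≢ i<j (trans (sym x≡i) x≡j)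
  q-apart i j x i<j _ _ hi hj | tri≈ _ refl _ with q-below i x i<j hi
  ...   | refl , Qi = false≢true (trans (sym Qi) (subst (λ p → p i ≡ true) q-c hj))
  q-apart i j x i<j _ _ hi hj | tri> _ _ c<j = false≢true (subst (λ p → p x ≡ true) (q-above j c<j) hj)
  -- A point of Q raises the size at its index from m - 1 to m + 1. The total increase of 2 wt Q is
  -- what k + 2 wt Q ≤ m leaves free.
  κ-below : ∀ i → i < c → κ i ≡ μ + 2 * ι (member Q i)
  κ-below i i<c rewrite <ᵇ-complete i<c with member Q i
  ... | true  = +-comm 2 μ
  ... | false = sym (+-identityʳ μ)
  weight : ∑ c (λ i → ι (member Q i)) ≡ wt Q
  weight = trans (sym (wt-tab c (member Q))) (cong wt (tab-member Q))
  sizes : ∑ (suc c + d) κ ≤ g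
  sizes = begin
    ∑ (suc c + d) κ ≡⟨ ∑-split (suc c) d κ ⟩
    ∑ c κ + κ c + ∑ d (λ i → κ (suc c + i))
      ≡⟨ cong₂ _+_ (cong₂ _+_ (trans (∑-cong c κ-below) (trans (∑-+ c (λ _ → μ) (λ i → 2 * ι (member Q i)))
           (cong₂ _+_ (∑-const c μ) (trans (∑-* c 2 (λ i → ι (member Q i))) (cong (2 *_) weight))))) κ-c)
         (trans (∑-cong d (λ i _ → κ-above (suc c + i) (m≤m+n (suc c) i))) (∑-const d (suc m))) ⟩
    c * μ + 2 * wt Q + k + d * suc m ≡⟨ prefix-ring₂ (c * μ) (wt Q) k (d * suc m) ⟩
    c * μ + (k + (wt Q + wt Q)) + d * suc m ≤⟨ +-monoˡ-≤ (d * suc m) (+-monoʳ-≤ (c * μ) light) ⟩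
    c * μ + m + d * suc m ≤⟨ fits ⟩
    g ∎

-- The gain is split by whether the set meets [l - 1]. Both parts are charged to the whole loss,
-- which is affordable because their coefficients together do not exceed d + 1.
gain⁺ gain⁰ : ∀ {n} → ℕ → ℕ → (Vec Bool n → Bool) → Vec Bool n → ℕ
gain⁺ m c f v = positive (pre c v) * gain m c f v
gain⁰ m c f v = (1 ∸ positive (pre c v)) * gain m c f v

gain-split : ∀ n m c (f : Vec Bool n → Bool) → Tot n (gain m c f) ≡ Tot n (gain⁺ m c f) + Tot n (gain⁰ m c f)
gain-split n m c f = trans (Tot-cong n (λ v → dichotomy (pre c v) (gain m c f v))) (Tot-+ n (gain⁺ m c f) (gain⁰ m c f))
  where
  dichotomy : ∀ w x → x ≡ positive w * x + (1 ∸ positive w) * x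
  dichotomy zero    x = sym (*-identityˡ x)
  dichotomy (suc w) x = sym (trans (+-identityʳ _) (*-identityˡ x))

∸-room : ∀ k a b → k < a ∸ b → k + b < a
∸-room k a       zero    h = subst (_< a) (sym (+-identityʳ k)) h
∸-room k (suc a) (suc b) h = subst (_< suc a) (sym (+-suc k b)) (s≤s (∸-room k a b h))

levels-hits : ∀ {c g} (f : Vec Bool (c + g) → Bool) Q κ Ω → (∀ k → k < κ → hits f Q k ≤ Ω) →
  g ! * ∑ κ (λ k → Lev g k (λ v → ι (f (Q ++ v)))) ≤ ∑ κ (binom g) * Ω
levels-hits {c} {g} f Q κ Ω h = begin
  g ! * ∑ κ (λ k → Lev g k (λ v → ι (f (Q ++ v)))) ≡⟨ sym (∑-* κ (g !) _) ⟩
  ∑ κ (λ k → g ! * Lev g k (λ v → ι (f (Q ++ v)))) ≡⟨ ∑-cong κ (λ k _ → sym (binom-den g k (λ v → ι (f (Q ++ v))))) ⟩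
  ∑ κ (λ k → binom g k * hits f Q k) ≤⟨ ∑-mono κ (λ k k<κ → *-monoʳ-≤ (binom g k) (h k k<κ)) ⟩
  ∑ κ (λ k → binom g k * Ω) ≡⟨ ∑-cong κ (λ k _ → *-comm (binom g k) Ω) ⟩
  ∑ κ (λ k → Ω * binom g k) ≡⟨ ∑-* κ Ω (binom g) ⟩
  Ω * ∑ κ (binom g) ≡⟨ *-comm Ω _ ⟩
  ∑ κ (binom g) * Ω ∎
  where open ≤-Reasoning

pre-prefix : ∀ {p g} c → c ≤ p → (Q : Vec Bool p) (T : Vec Bool g) → pre c (Q ++ T) ≡ pre c Q
pre-prefix zero    _         Q       T = refl
pre-prefix (suc c) (s≤s c≤p) (b ∷ Q) T = cong (ι b +_) (pre-prefix c c≤p Q T)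

-- Two kinds of sets of 𝒫 suffice to bound the loss: those of m + 1 points off the prefix, and those
-- of m points with exactly one prefix point i < c, which counts twice.
loss-singles : ∀ p c g μ (f : Vec Bool (p + g) → Bool) → c ≤ p → let m = suc μ in
  Lev g (suc m) (λ v → miss (f (empty p ++ v))) + ∑ c (λ i → Lev g μ (λ v → miss (f (single p i ++ v))))
      ≤ Tot (p + g) (loss m c f)
loss-singles p c g μ f c≤p = begin
  Lev g (suc m) (λ v → miss (f (empty p ++ v))) + ∑ c (λ i → Lev g μ (λ v → miss (f (single p i ++ v))))
    ≤⟨ +-mono-≤ (level (empty p) (suc m) heavy-empty) (∑-mono c (λ i i<c → level (single p i) μ (heavy-single i i<c))) ⟩
  inner (empty p) + ∑ c (λ i → inner (single p i)) ≤⟨ +-monoʳ-≤ (inner (empty p)) (∑-≤-bound (λ i → inner (single p i)) c≤p) ⟩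
  inner (empty p) + ∑ p (λ i → inner (single p i)) ≤⟨ Tot-empty-singles p inner ⟩
  Tot p inner ≡⟨ sym (Tot-++ p g (loss m c f)) ⟩
  Tot (p + g) (loss m c f) ∎
  where
  open ≤-Reasoning
  m = suc μ
  inner : Vec Bool p → ℕ
  inner Q = Tot g (λ v → loss m c f (Q ++ v))
  level : ∀ Q k → (∀ v → wt v ≡ k → m < wt (Q ++ v) + pre c (Q ++ v)) → Lev g k (λ v → miss (f (Q ++ v))) ≤ inner Q
  level Q k h = ≤-trans (≤-reflexive (Lev-cong g k (λ v e → sym (loss-heavy m c f (Q ++ v) (h v e))))) (Lev≤Tot g k _)
  heavy-empty : ∀ v → wt v ≡ suc m → m < wt (empty p ++ v) + pre c (empty p ++ v)
  heavy-empty v e = ≤-trans (≤-trans (≤-reflexive (sym e)) (m≤n+m (wt v) (wt (empty p))))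
    (≤-trans (≤-reflexive (sym (wt-++ (empty p) v))) (m≤m+n _ _))
  heavy-single : ∀ i → i < c → ∀ v → wt v ≡ μ → m < wt (single p i ++ v) + pre c (single p i ++ v)
  heavy-single i i<c v e = ≤-reflexive (sym (trans (cong₂ _+_ (trans (wt-++ (single p i) v) (cong₂ _+_ (wt-single p i i<p) e))
    (trans (pre-prefix c c≤p (single p i) v) (pre-single p c i i<c i<p))) (+-comm m 1)))
    where
    i<p : i < p
    i<p = ≤-trans i<c c≤p

prefixed-ring₁ : ∀ c d μ → c * μ + suc μ + d * suc (suc μ) ≡ suc (c + d) * μ + (1 + (d + d))
prefixed-ring₁ = solve-∀

prefixed-ring₂ : ∀ c μ z → let d = c + μ + z in suc (c + d) * μ + (1 + (d + d)) ≡ (suc c + d) * suc μ + μ + z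
prefixed-ring₂ = solve-∀

prefixed-ring₃ : ∀ a b S O → a * (b * S * O) ≡ b * (a * S * O)
prefixed-ring₃ = solve-∀

prefixed-ring₄ : ∀ b A s G → b * (A + s * G) ≡ b * A + s * b * G
prefixed-ring₄ = solve-∀
prefixed-ring₅ : ∀ a T D Y → a * (T * D + T * Y) ≡ T * (a * (Y + D))
prefixed-ring₅ = solve-∀

prefixed-ring₆ : ∀ c μ z → let d = suc c + μ + z in suc (suc c + d) * μ + (1 + (d + d))
    ≡ 1 * suc (suc μ) + suc μ + (2 * c + 2 * z + 3 * μ + 2 * c * μ + z * μ + μ * μ)
prefixed-ring₆ = solve-∀

prefixed-ring₇ : ∀ w t → w + t + w ≡ w + w + t
prefixed-ring₇ = solve-∀

-- A single bound Ω serves for the densities of all traces, and at most 2 (l - 1) S μ sets are in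
-- question. The growth of the binomials converts Ω into missing sets at the small rate 2 (l - 1) /
-- (s - 1).
prefixed-gain : ∀ c d μ n (f : Vec Bool n → Bool) → let m = suc μ in n ≡ suc c + (suc c * μ + m + d * suc m) → suc c + μ ≤ d →
  Matchless n (suc (suc c) + d) f → (suc c + d) * Tot n (gain⁺ m (suc c) f) ≤ 2 * suc c * Tot n (loss m (suc c) f)
prefixed-gain c₀ d μ n f refl c+μ≤d M = *-cancelˡ-≤ (N !) {{N !≢0}} (begin
  N ! * ((c + d) * Tot n (gain⁺ m c f)) ≡⟨ swap-factors (N !) (c + d) _ ⟩
  (c + d) * (N ! * Tot n (gain⁺ m c f)) ≤⟨ *-monoʳ-≤ (c + d) counted ⟩
  (c + d) * (2 * c * S μ * Ω) ≡⟨ prefixed-ring₃ (c + d) (2 * c) (S μ) Ω ⟩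
  2 * c * ((c + d) * S μ * Ω) ≤⟨ *-monoʳ-≤ (2 * c) (*-monoˡ-≤ Ω (binom-below N (c + d) μ growth)) ⟩
  2 * c * (binom N μ * Ω) ≡⟨ cong (2 * c *_) (prefixed-ring₄ (binom N μ) A s G) ⟩
  2 * c * (binom N μ * A + s * binom N μ * G) ≤⟨ *-monoʳ-≤ (2 * c) (+-mono-≤ singles (*-monoˡ-≤ G grow)) ⟩
  2 * c * (N ! * D + binom N (suc m) * G) ≡⟨ cong (λ z → 2 * c * (N ! * D + z)) (binom-den N (suc m) _) ⟩
  2 * c * (N ! * D + N ! * Y) ≡⟨ prefixed-ring₅ (2 * c) (N !) D Y ⟩
  N ! * (2 * c * (Y + D)) ≤⟨ *-monoʳ-≤ (N !) (*-monoʳ-≤ (2 * c) (loss-singles c c N μ f ≤-refl)) ⟩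
  N ! * (2 * c * Tot n (loss m c f)) ∎)
  where
  open ≤-Reasoning
  c = suc c₀
  m = suc μ
  s = suc c + d
  N = c * μ + m + d * suc m
  S : ℕ → ℕ
  S κ = ∑ κ (binom N)
  A G Ω D Y : ℕ
  A = ∑ c (λ i → gaps f (single c i) μ)
  G = gaps f (empty c) (suc m)
  Ω = A + s * G
  D = ∑ c (λ i → Lev N μ (λ v → miss (f (single c i ++ v))))
  Y = Lev N (suc m) (λ v → miss (f (empty c ++ v)))
  μ≤d : μ ≤ d
  μ≤d = ≤-trans (m≤n+m μ c) c+μ≤d
  growth : ∀ k → k < μ → suc (c + d) * binom N k ≤ binom N (suc k)
  growth k k<μ = binom-grow N k (suc (c + d)) (begin
    suc (c + d) * suc k + k
        ≤⟨ +-mono-≤ (*-monoʳ-≤ (suc (c + d)) k<μ) (≤-trans (<⇒≤ k<μ) (≤-trans μ≤d (≤-trans (m≤m+n d d) (n≤1+n (d + d))))) ⟩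
    suc (c + d) * μ + (1 + (d + d)) ≡⟨ sym (prefixed-ring₁ c d μ) ⟩
    N ∎)
  grow : s * binom N μ ≤ binom N (suc m)
  grow with ≤⇒∃ c+μ≤d
  ... | z , refl = ≤-trans (binom-grow N μ s (≤-by z (trans (prefixed-ring₁ c d μ) (prefixed-ring₂ c μ z))))
    (≤-trans (≤-reflexive (sym (*-identityˡ _)))
        (binom-grow N m 1 (≤-by _ (trans (prefixed-ring₁ c d μ) (prefixed-ring₆ c₀ μ z)))))
  singles : binom N μ * A ≤ N ! * D
  singles = ≤-reflexive (trans (sym (∑-* c (binom N μ) _)) (trans (∑-cong c (λ i _ → binom-den N μ _)) (∑-* c (N !) _)))
  doubling : ∀ κ → κ ≤ μ → 2 * c * S (κ ∸ 2) ≤ S κ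
  doubling zero          _ = ≤-reflexive (*-zeroʳ (2 * c))
  doubling (suc zero)    _ = ≤-trans (≤-reflexive (*-zeroʳ (2 * c))) z≤n
  doubling (suc (suc κ)) h = begin
    2 * c * S κ ≤⟨ *-mono-≤ 2c≤ (m≤m+n (S κ) (binom N κ)) ⟩
    (c + d) * S (suc κ) ≤⟨ binom-below N (c + d) (suc κ) (λ k k≤κ → growth k (≤-trans k≤κ (≤-trans (n≤1+n (suc κ)) h))) ⟩
    binom N (suc κ) ≤⟨ m≤n+m _ (S (suc κ)) ⟩
    S (suc (suc κ)) ∎
    where
    2c≤ : 2 * c ≤ c + d
    2c≤ = ≤-trans (≤-reflexive (cong (c +_) (+-identityʳ c))) (+-monoʳ-≤ c (≤-trans (m≤m+n c μ) c+μ≤d))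
  inner outer : Vec Bool c → ℕ
  inner Q = Tot N (λ T → gain⁺ m c f (Q ++ T))
  outer Q = positive (wt Q) * S (suc m ∸ (wt Q + wt Q))
  fibre : ∀ Q → N ! * inner Q ≤ Ω * outer Q
  fibre Q with wt Q in w
  ... | zero  = ≤-trans (≤-reflexive (trans (cong (N ! *_) (Tot-zero N
                  (λ T → cong (λ k → positive k * gain m c f (Q ++ T)) (trans (pre-++ Q T) w)))) (*-zeroʳ (N !)))) z≤n
  ... | suc w′ = begin
    N ! * Tot N (λ T → gain⁺ m c f (Q ++ T))
      ≤⟨ *-monoʳ-≤ (N !) (Tot-low N κ {h′ = λ T → ι (f (Q ++ T))}
           (λ T _ → ≤-trans (*-monoˡ-≤ (gain m c f (Q ++ T)) (positive≤1 (pre c (Q ++ T))))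
               (≤-trans (≤-reflexive (*-identityˡ _)) (gain≤ι m c f (Q ++ T))))
           (λ T h → trans (cong (positive (pre c (Q ++ T)) *_) (gain-heavy m c f (Q ++ T) (heavy-fibre T h)))
               (*-zeroʳ (positive (pre c (Q ++ T)))))) ⟩
    N ! * ∑ κ (λ k → Lev N k (λ T → ι (f (Q ++ T))))
      ≤⟨ levels-hits f Q κ Ω (λ k k<κ → prefix-density M ≤-refl Q k
           (≤-pred (subst (λ x → k + (x + x) < suc m) (sym w) (∸-room k (suc m) (suc w′ + suc w′) k<κ)))) ⟩
    S κ * Ω ≡⟨ *-comm (S κ) Ω ⟩
    Ω * S κ ≡⟨ cong (Ω *_) (sym (*-identityˡ (S κ))) ⟩
    Ω * (1 * S κ) ∎
    where
    κ = suc m ∸ (suc w′ + suc w′)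
    positive≤1 : ∀ x → positive x ≤ 1
    positive≤1 zero    = z≤n
    positive≤1 (suc _) = ≤-refl
    heavy-fibre : ∀ T → κ ≤ wt T → m < wt (Q ++ T) + pre c (Q ++ T)
    heavy-fibre T h = ≤-trans (≤-trans (m≤n+m∸n (suc m) (suc w′ + suc w′)) (+-monoʳ-≤ (suc w′ + suc w′) h))
      (≤-reflexive (sym (trans (cong₂ _+_ (trans (wt-++ Q T) (cong (_+ wt T) w)) (trans (pre-++ Q T) w))
          (prefixed-ring₇ (suc w′) (wt T)))))
  counted : N ! * Tot n (gain⁺ m c f) ≤ 2 * c * S μ * Ω
  counted = begin
    N ! * Tot n (gain⁺ m c f)
      ≡⟨ trans (cong (N ! *_) (Tot-++ c N (gain⁺ m c f))) (sym (Tot-* c (N !) inner)) ⟩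
    Tot c (λ Q → N ! * inner Q)
      ≤⟨ Tot-mono c fibre ⟩
    Tot c (λ Q → Ω * outer Q)
      ≡⟨ Tot-* c Ω outer ⟩
    Ω * prefixes⁺ S c (suc m)
      ≤⟨ *-monoʳ-≤ Ω (prefixes⁺-bound S c μ doubling c ≤-refl (suc m) ≤-refl) ⟩
    Ω * (2 * c * S μ)
      ≡⟨ *-comm Ω _ ⟩
    2 * c * S μ * Ω ∎

-- Members outside 𝒫 that avoid [l - 1]

interval-one : ∀ i x → interval i 1 x ≡ true → x ≡ i
interval-one i x h = ≤-antisym (≤-pred (≤-trans (proj₂ (interval-bounds i 1 x h)) (≤-reflexive (+-comm i 1))))
    (proj₁ (interval-bounds i 1 x h))

-- owner j < l means that block j is matched to the special point owner j.
record Assignment (s l t k : ℕ) (W : ℕ → ℕ → Bool) : Set where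
  field
    owner     : ℕ → ℕ
    compatible : ∀ j → j < s → owner j < l → t ≤ owner j × W (owner j) j ≡ true
    injective : ∀ j j′ → j < s → j′ < s → owner j < l → owner j ≡ owner j′ → j ≡ j′
    matched   : ∑ s (λ j → ι (owner j <ᵇ l)) ≡ k

no-owner : ∀ s l t W → Assignment s l t 0 W
no-owner s l t W = record
  { owner = λ _ → l
  ; compatible = λ j _ l<l → ⊥-elim (n≮n l l<l)
  ; injective = λ j j′ _ _ l<l _ → ⊥-elim (n≮n l l<l)
  ; matched = ∑-zero s (λ j _ → cong ι (<ᵇ-refute (≤-refl {l})))
  }

-- Only k blocks are taken so far, so one of the k + 1 neighbours of t is free.
extend-assignment : ∀ {s l t k W} → t < l → Assignment s l (suc t) k W → suc k
    ≤ ∑ s (λ j → ι (W t j)) → Assignment s l t (suc k) W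
extend-assignment {s} {l} {t} {k} {W} t<l α plenty with search s (λ j → not (W t j) ∨ (Assignment.owner α j <ᵇ l))
... | inj₂ all = ⊥-elim (<⇒≱ plenty
    (subst (∑ s (λ j → ι (W t j)) ≤_) matched (∑-mono s (λ j j<s → ι-mono (λ w → free j w (all j j<s))))))
  where
  open Assignment α
  free : ∀ j → W t j ≡ true → not (W t j) ∨ (owner j <ᵇ l) ≡ true → (owner j <ᵇ l) ≡ true
  free j w h rewrite w = h
... | inj₁ (j₀ , j₀<s , e) = record { owner = owner′ ; compatible = compatible′ ; injective = injective′ ; matched = matched′ }
  where
  open Assignment α
  split : ∀ a b → not a ∨ b ≡ false → a ≡ true × b ≡ false
  split true  b h = refl , h
  wj₀ : W t j₀ ≡ true
  wj₀ = proj₁ (split (W t j₀) (owner j₀ <ᵇ l) e)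
  free₀ : (owner j₀ <ᵇ l) ≡ false
  free₀ = proj₂ (split (W t j₀) (owner j₀ <ᵇ l) e)
  owner′ : ℕ → ℕ
  owner′ j = if interval j₀ 1 j then t else owner j
  cases : ∀ j → (j ≡ j₀ × owner′ j ≡ t) ⊎ (interval j₀ 1 j ≡ false × owner′ j ≡ owner j)
  cases j with interval j₀ 1 j in h
  ... | true  = inj₁ (interval-one j₀ j h , refl)
  ... | false = inj₂ (refl , refl)
  compatible′ : ∀ j → j < s → owner′ j < l → t ≤ owner′ j × W (owner′ j) j ≡ true
  compatible′ j j<s h with cases j
  ... | inj₁ (refl , o) = ≤-reflexive (sym o) , subst (λ x → W x j ≡ true) (sym o) wj₀
  ... | inj₂ (_ , o) with compatible j j<s (subst (_< l) o h)
  ...   | t<o , w = subst (t ≤_) (sym o) (<⇒≤ t<o) , subst (λ x → W x j ≡ true) (sym o) w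
  injective′ : ∀ j j′ → j < s → j′ < s → owner′ j < l → owner′ j ≡ owner′ j′ → j ≡ j′
  injective′ j j′ j<s j′<s h eq with cases j | cases j′
  ... | inj₁ (p , _) | inj₁ (p′ , _) = trans p (sym p′)
  ... | inj₁ (_ , o) | inj₂ (_ , o′) = ⊥-elim
      (<⇒≢ (proj₁ (compatible j′ j′<s (subst (_< l) (trans eq o′) h))) (trans (sym o) (trans eq o′)))
  ... | inj₂ (_ , o) | inj₁ (_ , o′) = ⊥-elim
      (<⇒≢ (proj₁ (compatible j j<s (subst (_< l) o h))) (trans (sym o′) (trans (sym eq) o)))
  ... | inj₂ (_ , o) | inj₂ (_ , o′) = injective j j′ j<s j′<s (subst (_< l) o h) (trans (sym o) (trans eq o′))
  pointwise : ∀ j → ι (owner′ j <ᵇ l) ≡ ι (owner j <ᵇ l) + ι (interval j₀ 1 j)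
  pointwise j with interval j₀ 1 j in h
  ... | false = sym (+-identityʳ _)
  ... | true with interval-one j₀ j h
  ...   | refl = trans (cong ι (<ᵇ-complete t<l)) (cong (λ b → ι b + 1) (sym free₀))
  matched′ : ∑ s (λ j → ι (owner′ j <ᵇ l)) ≡ suc k
  matched′ = trans (∑-cong s (λ j _ → pointwise j)) (trans (∑-+ s (λ j → ι (owner j <ᵇ l)) (λ j → ι (interval j₀ 1 j)))
    (trans (cong₂ _+_ matched (interval-size s j₀ 1 (≤-trans (≤-reflexive (+-comm j₀ 1)) j₀<s))) (+-comm k 1)))

-- Hall's theorem for nested neighbourhoods, by greedy choice from the smallest one.
nested-assignment : ∀ {s l W} → (∀ i → i < l → l ≤ ∑ s (λ j → ι (W i j)) + i) → ∀ k t → t + k ≡ l → Assignment s l t k W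
nested-assignment             big zero    t _  = no-owner _ _ t _
nested-assignment {s} {l} {W} big (suc k) t eq = extend-assignment t<l
  (nested-assignment big k (suc t) (trans (sym (+-suc t k)) eq))
  (+-cancelˡ-≤ t _ _ (≤-trans (≤-reflexive eq) (≤-trans (big t t<l) (≤-reflexive (+-comm _ t)))))
  where
  t<l : t < l
  t<l = subst (suc t ≤_) (trans (sym (+-suc t k)) eq) (m≤m+n (suc t) k)

pay₁ : ∀ d s → suc d * s ≡ s + s * d
pay₁ = solve-∀

pay₂ : ∀ d s → d + d + s * d ≡ (2 + s) * d
pay₂ = solve-∀

module Specials (c d μ g : ℕ) {φ : Points → Bool} (M : MatchlessOn (suc c + g) (suc c + d) φ)
  (fits : (suc c + d) * μ + d * 2 ≤ g) where

  s l : ℕ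
  l = suc c
  s = suc c + d

  open Blocks g s μ d 2 fits

  none : Points
  none _ = false

  W : ℕ → ℕ → Bool
  W i j = φ (join l (interval i 1) (block j))

  H : ℕ → ℕ → Bool
  H j t = φ (join l none (block j ∪ tail t))

  degree : ℕ → ℕ
  degree i = ∑ s (λ j → ι (W i j))

  -- A matching turns l of the s blocks into members by adding distinct special points. Each missing
  -- set A j ∪ T t contains block j ∪ tail t, which is then missing as well.
  saturated : (∀ i → i < l → l ≤ degree i + i) → d ≤ ∑ s (λ j → ∑ d (λ t → miss (H j t)))
  saturated big = ≤-trans (missing-pairs M A T d A-apart T-apart AT-apart enough)
    (∑-mono s (λ j _ → ∑-mono d
        (λ t _ → miss-anti (upwardOn M (join l none (block j ∪ tail t)) (A j ∪ T t) (λ x _ → smaller j t x)))))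
    where
    open Assignment (nested-assignment {s} {l} {W} big l 0 refl)
    A T : ℕ → Points
    -- An unmatched block has its owner at l or beyond, where `join l` cuts it off, so its prefix is
    -- empty.
    A j = join l (interval (owner j) 1) (block j)
    T t = join l none (tail t)
    A-apart : ∀ i j x → i < j → j < s → x < l + g → A i x ≡ true → A j x ≡ true → ⊥
    A-apart i j x i<j j<s x<n = join-apart l g (interval (owner i) 1) (block i) (interval (owner j) 1) (block j)
      (λ x x<l h h′ → <⇒≢ i<j (injective i j (<-trans i<j j<s) j<s (subst (_< l) (interval-one (owner i) x h) x<l)
        (trans (sym (interval-one (owner i) x h)) (interval-one (owner j) x h′))))
      (λ x _ → block-apart i j x i<j) x x<n
    T-apart : ∀ t u x → t < u → u < d → x < l + g → T t x ≡ true → T u x ≡ true → ⊥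
    T-apart t u x t<u _ x<n = join-apart l g none (tail t) none (tail u) (λ _ _ ()) (λ x _ → tail-apart t u x t<u) x x<n
    AT-apart : ∀ j t x → j < s → t < d → x < l + g → A j x ≡ true → T t x ≡ true → ⊥
    AT-apart j t x j<s _ x<n = join-apart l g (interval (owner j) 1) (block j) none (tail t) (λ _ _ _ ())
      (λ x _ → block-tail-apart j t x j<s) x x<n
    member-A : ∀ j → j < s → (owner j <ᵇ l) ≡ true → φ (A j) ≡ true
    member-A j j<s h = proj₂ (compatible j j<s (<ᵇ-sound (owner j) l h))
    enough : s ≤ ∑ s (λ j → ι (φ (A j))) + d
    enough = +-monoˡ-≤ d (subst (_≤ ∑ s (λ j → ι (φ (A j)))) matched (∑-mono s (λ j j<s → ι-mono (member-A j j<s))))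
    smaller : ∀ j t x → join l none (block j ∪ tail t) x ≡ true → (A j ∪ T t) x ≡ true
    smaller j t x h with x <ᵇ l
    ... | false = h

  -- Either the special points can be matched to blocks, so that d pairs (block, tail) are missing, or some point
  -- i has degree at most c - i, and the rows i, …, c - 1 pay for the degree of c.
  trade : s + 1 ≤ d + d → (∀ i i′ j → i ≤ i′ → i′ ≤ c → W i′ j ≡ true → W i j ≡ true) →
    suc d * degree c ≤ ∑ c (λ i → ∑ s (λ j → miss (W i j))) + (2 + s) * ∑ s (λ j → ∑ d (λ t → miss (H j t)))
  trade s<2d nested with search l (λ i → c <ᵇ degree i + i)
  ... | inj₂ all = ≤-trans (*-monoʳ-≤ (suc d) degree≤s)
      (≤-trans pay (≤-trans (*-monoʳ-≤ (2 + s) (saturated (λ i i<l → <ᵇ-sound c (degree i + i) (all i i<l))))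
                    (m≤n+m ((2 + s) * ∑ s (λ j → ∑ d (λ t → miss (H j t)))) (∑ c (λ i → ∑ s (λ j → miss (W i j)))))))
    where
    degree≤s : degree c ≤ s
    degree≤s = subst (degree c ≤_) (trans (∑-const s 1) (*-identityʳ s)) (∑-mono s (λ j _ → ι≤1 _))
    -- The factor 2 + s is made for this: (d + 1) s = s + s d, and s ≤ 2 d.
    pay : suc d * s ≤ (2 + s) * d
    pay = ≤-trans (≤-reflexive (pay₁ d s)) (≤-trans (+-monoˡ-≤ (s * d) (≤-trans (m≤m+n s 1) s<2d)) (≤-reflexive (pay₂ d s)))
  ... | inj₁ (i , i<l , e) with ≤⇒∃ (≤-pred i<l)
  ...   | h , refl = begin
    suc d * degree (i + h) ≤⟨ *-monoʳ-≤ (suc d) (small (i + h) (m≤m+n i h) ≤-refl) ⟩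
    suc d * h ≡⟨ *-comm (suc d) h ⟩
    h * suc d ≡⟨ sym (∑-const h (suc d)) ⟩
    ∑ h (λ _ → suc d) ≤⟨ ∑-mono h (λ x x<h → row (i + x) (m≤m+n i x) (+-monoʳ-≤ i (<⇒≤ x<h))) ⟩
    ∑ h (λ x → ∑ s (λ j → miss (W (i + x) j))) ≤⟨ m≤n+m _ (∑ i (λ x → ∑ s (λ j → miss (W x j)))) ⟩
    ∑ i (λ x → ∑ s (λ j → miss (W x j))) + ∑ h (λ x → ∑ s (λ j → miss (W (i + x) j)))
      ≡⟨ sym (∑-split i h (λ x → ∑ s (λ j → miss (W x j)))) ⟩
    ∑ (i + h) (λ x → ∑ s (λ j → miss (W x j))) ≤⟨ m≤m+n _ ((2 + s) * ∑ s (λ j → ∑ d (λ t → miss (H j t)))) ⟩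
    ∑ (i + h) (λ x → ∑ s (λ j → miss (W x j))) + (2 + s) * ∑ s (λ j → ∑ d (λ t → miss (H j t))) ∎
    where
    open ≤-Reasoning
    small-i : degree i ≤ h
    small-i = +-cancelʳ-≤ i (degree i) h
        (≤-trans (≮⇒≥ (λ lt → false≢true (trans (sym e) (<ᵇ-complete lt)))) (≤-reflexive (+-comm i h)))
    small : ∀ i′ → i ≤ i′ → i′ ≤ i + h → degree i′ ≤ h
    small i′ i≤i′ i′≤c = ≤-trans (∑-mono s (λ j _ → ι-mono (nested i i′ j i≤i′ i′≤c))) small-i
    -- At most h ≤ c of the s blocks are adjacent to this point, so at least s - c = d + 1 are not.
    row : ∀ i′ → i ≤ i′ → i′ ≤ i + h → suc d ≤ ∑ s (λ j → miss (W i′ j))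
    row i′ i≤i′ i′≤c = +-cancelˡ-≤ (i + h) _ _ (begin
      i + h + suc d ≡⟨ +-suc (i + h) d ⟩
      s ≡⟨ sym (trans (∑-const s 1) (*-identityʳ s)) ⟩
      ∑ s (λ _ → 1) ≡⟨ ∑-cong s (λ j _ → sym (ι+miss (W i′ j))) ⟩
      ∑ s (λ j → ι (W i′ j) + miss (W i′ j)) ≡⟨ ∑-+ s (λ j → ι (W i′ j)) (λ j → miss (W i′ j)) ⟩
      degree i′ + ∑ s (λ j → miss (W i′ j)) ≤⟨ +-monoˡ-≤ _ (≤-trans (small i′ i≤i′ i′≤c) (m≤n+m h i)) ⟩
      i + h + ∑ s (λ j → miss (W i′ j)) ∎)

special-ring₁ : ∀ A s d G → s * A + (2 + s) * (s * (d * G)) ≡ s * (A + (2 + s) * (d * G))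
special-ring₁ = solve-∀

-- The prefix stays in place under the permutations, so compression makes the neighbourhoods nested
-- for each of them, and the trade can be averaged.
special-density : ∀ c d μ g (f : Vec Bool (suc c + g) → Bool) → let s = suc c + d in Matchless (suc c + g) s f → Shifted f →
  s * μ + d * 2 ≤ g → s + 1 ≤ d + d →
  suc d * hits f (single (suc c) c) μ ≤ ∑ c (λ i → gaps f (single (suc c) i) μ) + (2 + s) * (d * gaps f (empty (suc c)) (2 + μ))
special-density c d μ g f M S fits s<2d = *-cancelˡ-≤ s (begin
  s * (suc d * hits f (single l c) μ) ≡⟨ sym (swap-factors (suc d) s (hits f (single l c) μ)) ⟩
  suc d * (s * hits f (single l c) μ) ≡⟨ cong (suc d *_) (sym 𝔼-degree) ⟩
  suc d * 𝔼 g degree ≡⟨ sym (𝔼-* g (suc d) degree) ⟩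
  𝔼 g (λ σ → suc d * degree σ) ≤⟨ 𝔼-mono g (λ σ nat → Specials.trade c d μ g (view-matchless l g nat M) fits s<2d (nested σ)) ⟩
  𝔼 g (λ σ → absent σ + (2 + s) * absent′ σ)
    ≡⟨ trans (𝔼-+ g absent (λ σ → (2 + s) * absent′ σ))
         (cong₂ _+_ 𝔼-absent (trans (𝔼-* g (2 + s) absent′) (cong ((2 + s) *_) 𝔼-absent′))) ⟩
  s * ∑ c (λ i → gaps f (single l i) μ) + (2 + s) * (s * (d * G))
    ≡⟨ special-ring₁ (∑ c (λ i → gaps f (single l i) μ)) s d G ⟩
  s * (∑ c (λ i → gaps f (single l i) μ) + (2 + s) * (d * G)) ∎)
  where
  open ≤-Reasoning
  l = suc c
  s = suc c + d
  G = gaps f (empty l) (2 + μ)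
  open Blocks g s μ d 2 fits
  none : Points
  none _ = false
  W : Act g → ℕ → ℕ → Bool
  W σ i j = view l g f σ (join l (interval i 1) (block j))
  H : Act g → ℕ → ℕ → Bool
  H σ j t = view l g f σ (join l none (block j ∪ tail t))
  degree absent absent′ : Act g → ℕ
  degree σ  = ∑ s (λ j → ι (W σ c j))
  absent σ  = ∑ c (λ i → ∑ s (λ j → miss (W σ i j)))
  absent′ σ = ∑ s (λ j → ∑ d (λ t → miss (H σ j t)))
  nested : ∀ σ i i′ j → i ≤ i′ → i′ ≤ c → W σ i′ j ≡ true → W σ i j ≡ true
  nested σ i i′ j i≤i′ i′≤c h = trans (view-join l g f σ (interval i 1) (block j))
    (single-down (shifted-prefix l S (σ (tab g (block j)))) i i′ i≤i′ (s≤s i′≤c)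
      (trans (sym (view-join l g f σ (interval i′ 1) (block j))) h))
  𝔼-degree : 𝔼 g degree ≡ s * hits f (single l c) μ
  𝔼-degree = trans (𝔼-∑ g s _) (trans (∑-cong s (λ j j<s → trans
    (𝔼-cong g (λ σ → cong ι (view-join l g f σ (interval c 1) (block j))))
    (average-tab g (λ v → ι (f (single l c ++ v))) (block j) μ (block-size j j<s)))) (∑-const s _))
  row : ∀ i j → j < s → 𝔼 g (λ σ → miss (W σ i j)) ≡ gaps f (single l i) μ
  row i j j<s = trans (𝔼-cong g (λ σ → cong miss (view-join l g f σ (interval i 1) (block j))))
    (average-tab g (λ v → miss (f (single l i ++ v))) (block j) μ (block-size j j<s))
  𝔼-absent : 𝔼 g absent ≡ s * ∑ c (λ i → gaps f (single l i) μ)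
  𝔼-absent = trans (𝔼-∑ g c _) (trans (∑-cong c (λ i _ → trans (𝔼-∑ g s _) (trans (∑-cong s (row i)) (∑-const s _))))
    (∑-* c s (λ i → gaps f (single l i) μ)))
  cell : ∀ j t → j < s → t < d → 𝔼 g (λ σ → miss (H σ j t)) ≡ G
  cell j t j<s t<d = trans (𝔼-cong g (λ σ → cong miss (view-join l g f σ none (block j ∪ tail t))))
    (average-tab g (λ v → miss (f (empty l ++ v))) (block j ∪ tail t) (2 + μ)
        (trans (block-tail-size j t j<s t<d) (+-comm μ 2)))
  𝔼-absent′ : 𝔼 g absent′ ≡ s * (d * G)
  𝔼-absent′ = trans (𝔼-∑ g s _)
      (trans (∑-cong s (λ j j<s → trans (𝔼-∑ g d _) (trans (∑-cong d (λ t → cell j t j<s)) (∑-const d _)))) (∑-const s _))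

-- The value of h₀ at a nonempty set is at most that of h₁ at the set without its least element,
-- expressed by recursion on the leading zeros.
Deletes : ∀ {n} → (Vec Bool n → ℕ) → (Vec Bool n → ℕ) → Set
Deletes {zero}  h₀ h₁ = ⊤
Deletes {suc n} h₀ h₁ = (∀ v → h₀ (true ∷ v) ≤ h₁ (false ∷ v)) × Deletes (h₀ ∘ (false ∷_)) (h₁ ∘ (false ∷_))

deletes-mono : ∀ n {h₀ h₁ h₂ : Vec Bool n → ℕ} → (∀ v → h₁ v ≤ h₂ v) → Deletes h₀ h₁ → Deletes h₀ h₂
deletes-mono zero    h D          = tt
deletes-mono (suc n) h (D₁ , D₂) = (λ v → ≤-trans (D₁ v) (h (false ∷ v))) , deletes-mono n (λ v → h (false ∷ v)) D₂

Lev-false : ∀ n k (h : Vec Bool (suc n) → ℕ) → Lev n k (h ∘ (false ∷_)) ≤ Lev (suc n) k h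
Lev-false n zero    h = ≤-refl
Lev-false n (suc k) h = m≤m+n _ _

-- Where the least element is one of the first D points, its deletion is at most D-to-one.
Lev-delete : ∀ D n k (h₀ h₁ : Vec Bool n → ℕ) → Deletes h₀ h₁ → (∀ v → wt v ≡ suc k → pre D v ≡ 0 → h₀ v ≡ 0) →
  Lev n (suc k) h₀ ≤ D * Lev n k h₁
Lev-delete zero    n       k h₀ h₁ _         early = ≤-reflexive (Lev-zero n (suc k) (λ v e → early v e refl))
Lev-delete (suc D) zero    k h₀ h₁ _         early = z≤n
Lev-delete (suc D) (suc n) k h₀ h₁ (D₁ , D₂) early = begin
  Lev n (suc k) (h₀ ∘ (false ∷_)) + Lev n k (h₀ ∘ (true ∷_))
    ≤⟨ +-mono-≤ (Lev-delete D n k (h₀ ∘ (false ∷_)) (h₁ ∘ (false ∷_)) D₂ (λ v e p → early (false ∷ v) e p))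
         (Lev-mono n k (λ v _ → D₁ v)) ⟩
  D * Lev n k (h₁ ∘ (false ∷_)) + Lev n k (h₁ ∘ (false ∷_))
    ≡⟨ +-comm (D * Lev n k (h₁ ∘ (false ∷_))) _ ⟩
  suc D * Lev n k (h₁ ∘ (false ∷_))
    ≤⟨ *-monoʳ-≤ (suc D) (Lev-false n k h₁) ⟩
  suc D * Lev (suc n) k h₁ ∎
  where open ≤-Reasoning

-- The least element travels across the zeros in front of it, one adjacent compression at a time,
-- until it reaches the first coordinate.
shifted-deletes : ∀ n {f : Vec Bool (suc n) → Bool} → Shifted f → Deletes (λ v → ι (f (false ∷ v))) (λ v → ι (f (true ∷ v)))
shifted-deletes zero    S = tt
shifted-deletes (suc n) {f} S = (λ v → ι-mono (S 0 v)) ,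
  deletes-mono n (λ v → ι-mono (S 0 v)) (shifted-deletes n (λ k → S (suc k) false))

prefix-deletes : ∀ c g {f : Vec Bool (suc c + g) → Bool} → Shifted f →
  Deletes (λ v → ι (f (empty (suc c) ++ v))) (λ v → ι (f (single (suc c) c ++ v)))
prefix-deletes zero    g S = shifted-deletes g S
prefix-deletes (suc c) g {f} S = subst (λ u → Deletes (λ v → ι (f (false ∷ (empty (suc c) ++ v)))) (λ v → ι (f (u ++ v))))
  (sym (single-suc (suc c) c)) (prefix-deletes c g (λ k → S (suc k) false))

Tot-last : ∀ c (h : Vec Bool (suc c) → ℕ) → (∀ Q → 0 < pre c Q → h Q ≡ 0) → Tot (suc c) h
    ≤ h (empty (suc c)) + h (single (suc c) c)
Tot-last zero    h _    = ≤-refl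
Tot-last (suc c) h late = begin
  Tot (suc c) (h ∘ (false ∷_)) + Tot (suc c) (h ∘ (true ∷_))
    ≡⟨ cong (Tot (suc c) (h ∘ (false ∷_)) +_) (Tot-zero (suc c) (λ v → late (true ∷ v) (s≤s z≤n))) ⟩
  Tot (suc c) (h ∘ (false ∷_)) + 0
    ≡⟨ +-identityʳ _ ⟩
  Tot (suc c) (h ∘ (false ∷_))
    ≤⟨ Tot-last c (h ∘ (false ∷_)) (λ Q p → late (false ∷ Q) p) ⟩
  h (empty (suc (suc c))) + h (false ∷ single (suc c) c)
    ≡⟨ cong (λ u → h (empty (suc (suc c))) + h u) (sym (single-suc (suc c) c)) ⟩
  h (empty (suc (suc c))) + h (single (suc (suc c)) (suc c)) ∎
  where open ≤-Reasoning

pre-empty-++ : ∀ l D {g} (v : Vec Bool g) → pre (l + D) (empty l ++ v) ≡ pre D v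
pre-empty-++ zero    D v = refl
pre-empty-++ (suc l) D v = pre-empty-++ l D v

unprefixed-size₁ : ∀ l d μ → (l + d) * μ + d * 2 ≡ l * μ + d * suc (suc μ)
unprefixed-size₁ = solve-∀

unprefixed-size₂ : ∀ T a D b e → T * (a + D * b + e) ≡ T * a + D * (T * b) + T * e
unprefixed-size₂ = solve-∀

unprefixed-size₃ : ∀ S B H D → (S + B) * H + D * (B * H) + (S + B) * H ≡ 2 * S * H + (D * (B * H) + 2 * (B * H))
unprefixed-size₃ = solve-∀

unprefixed-ring₁ : ∀ D B H → B * H + (D * (B * H) + 2 * (B * H)) ≡ (D + 3) * (B * H)
unprefixed-ring₁ = solve-∀

unprefixed-ring₂ : ∀ a D B H → a * ((D + 3) * (B * H)) ≡ (D + 3) * (B * (a * H))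
unprefixed-ring₂ = solve-∀

unprefixed-ring₃ : ∀ B A s d G → B * (A + s * (d * G)) ≡ B * A + d * (s * B) * G
unprefixed-ring₃ = solve-∀

unprefixed-ring₄ : ∀ a T X Y → a * (T * X + T * Y) ≡ T * (a * (Y + X))
unprefixed-ring₄ = solve-∀

-- The unit of account is the bound B He for the sets {l} ∪ T with |T| = m - 1. The m-sets that
-- avoid [l] cost D units, by replacing their least element by l; level m - 1 of the suffix costs
-- one unit with l and one without; all lower levels together cost one more.
unprefixed-gain : ∀ c d μ D n (f : Vec Bool n → Bool) → let l = suc c; m = suc μ; s = l + d; g = l * μ + d * suc m in
  n ≡ l + g → Matchless n s f → Shifted f → c * m ≡ l + D → (∀ v → wt v ≡ m → pre (c * m) v ≡ 0 → f v ≡ false) →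
  s + 1 ≤ d + d → (2 + s) * m + μ ≤ g → d * suc m + m ≤ g → 3 ≤ d → suc d * Tot n (gain⁰ m c f) ≤ (D + 3) * Tot n (loss m c f)
unprefixed-gain c d μ D n f refl M S cm≡ early s<2d room room′ 3≤d = *-cancelˡ-≤ (g !) {{g !≢0}} (begin
  g ! * (suc d * Tot n (gain⁰ m c f)) ≡⟨ swap-factors (g !) (suc d) _ ⟩
  suc d * (g ! * Tot n (gain⁰ m c f)) ≤⟨ *-monoʳ-≤ (suc d) counted ⟩
  suc d * ((D + 3) * (B * He)) ≡⟨ unprefixed-ring₂ (suc d) D B He ⟩
  (D + 3) * (B * (suc d * He))
    ≤⟨ *-monoʳ-≤ (D + 3) (*-monoʳ-≤ B (special-density c d μ g f M S (≤-reflexive (unprefixed-size₁ l d μ)) s<2d)) ⟩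
  (D + 3) * (B * (A + (2 + s) * (d * G))) ≡⟨ cong ((D + 3) *_) (unprefixed-ring₃ B A (2 + s) d G) ⟩
  (D + 3) * (B * A + d * ((2 + s) * B) * G)
    ≤⟨ *-monoʳ-≤ (D + 3) (+-mono-≤ (≤-reflexive singles)
         (*-monoˡ-≤ G (≤-trans (*-monoʳ-≤ d (binom-grow g μ (2 + s) room)) (binom-grow g m d room′)))) ⟩
  (D + 3) * (g ! * X + binom g (suc m) * G) ≡⟨ cong (λ z → (D + 3) * (g ! * X + z)) (binom-den g (suc m) _) ⟩
  (D + 3) * (g ! * X + g ! * Y) ≡⟨ unprefixed-ring₄ (D + 3) (g !) X Y ⟩
  g ! * ((D + 3) * (Y + X)) ≤⟨ *-monoʳ-≤ (g !) (*-monoʳ-≤ (D + 3) (loss-singles l c g μ f (n≤1+n c))) ⟩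
  g ! * ((D + 3) * Tot n (loss m c f)) ∎)
  where
  open ≤-Reasoning
  l = suc c
  m = suc μ
  s = l + d
  g = l * μ + d * suc m
  o e : Vec Bool l
  o = empty l
  e = single l c
  B He A G X Y : ℕ
  B  = binom g μ
  He = hits f e μ
  A  = ∑ c (λ i → gaps f (single l i) μ)
  G  = gaps f o (suc m)
  X  = ∑ c (λ i → Lev g μ (λ v → miss (f (single l i ++ v))))
  Y  = Lev g (suc m) (λ v → miss (f (o ++ v)))
  singles : B * A ≡ g ! * X
  singles = trans (sym (∑-* c B _)) (trans (∑-cong c (λ i _ → binom-den g μ _)) (∑-* c (g !) _))
  wt-o : wt o ≡ 0
  wt-o = trans (wt-tab l (λ _ → false)) (∑-zero l (λ _ _ → refl))
  gain⁰≤ : ∀ v → gain⁰ m c f v ≤ ι (f v)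
  gain⁰≤ v = ≤-trans (*-monoˡ-≤ (gain m c f v) (m∸n≤m 1 (positive (pre c v))))
      (≤-trans (≤-reflexive (*-identityˡ _)) (gain≤ι m c f v))
  gain⁰-heavy : ∀ v → m < wt v → gain⁰ m c f v ≡ 0
  gain⁰-heavy v h = trans (cong ((1 ∸ positive (pre c v)) *_) (gain-heavy m c f v (≤-trans h (m≤m+n (wt v) _))))
      (*-zeroʳ (1 ∸ positive (pre c v)))
  fibre : Vec Bool l → ℕ
  fibre Q = Tot g (λ v → gain⁰ m c f (Q ++ v))
  late : ∀ Q → 0 < pre c Q → fibre Q ≡ 0
  late Q h = Tot-zero g (λ v → cong (_* gain m c f (Q ++ v))
      (vanish (pre c (Q ++ v)) (subst (0 <_) (sym (pre-prefix c (n≤1+n c) Q v)) h)))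
    where
    vanish : ∀ w → 0 < w → 1 ∸ positive w ≡ 0
    vanish (suc w) _ = refl
  L : Vec Bool l → ℕ → ℕ
  L Q k = Lev g k (λ v → ι (f (Q ++ v)))
  fibre-o : fibre o ≤ ∑ m (L o) + L o m
  fibre-o = Tot-low g (suc m) (λ v _ → gain⁰≤ (o ++ v))
      (λ v h → gain⁰-heavy (o ++ v) (≤-trans h (≤-reflexive (sym (trans (wt-++ o v) (cong (_+ wt v) wt-o))))))
  fibre-e : fibre e ≤ ∑ m (L e)
  fibre-e = Tot-low g m (λ v _ → gain⁰≤ (e ++ v)) (λ v h → gain⁰-heavy (e ++ v) (≤-trans (s≤s h)
    (≤-reflexive (sym (trans (wt-++ e v) (cong (_+ wt v) (wt-single l c ≤-refl)))))))
  top : L o m ≤ D * L e μ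
  top = Lev-delete D g μ (λ v → ι (f (o ++ v))) (λ v → ι (f (e ++ v))) (prefix-deletes c g S)
    (λ v w p → cong ι (early (o ++ v) (trans (wt-++ o v) (trans (cong (_+ wt v) wt-o) w))
      (trans (cong (λ b → pre b (o ++ v)) cm≡) (trans (pre-empty-++ l D v) p))))
  μ≤g : μ ≤ g
  μ≤g = ≤-trans (m≤n+m μ ((2 + s) * m)) room
  below : 2 * ∑ μ (binom g) ≤ B
  below = binom-below g 2 μ (λ k k<μ → binom-grow g k 3
      (≤-trans (+-mono-≤ (*-mono-≤ 3≤d (≤-trans k<μ (≤-trans (n≤1+n μ) (n≤1+n m)))) (≤-trans (<⇒≤ k<μ) (n≤1+n μ))) room′))
  o≤e : Pointwise Below o e
  o≤e = tab-pointwise Below l {λ _ → false} {interval c 1} (λ x _ ())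
  counted : g ! * Tot n (gain⁰ m c f) ≤ (D + 3) * (B * He)
  counted = begin
    g ! * Tot n (gain⁰ m c f)
      ≡⟨ cong (g ! *_) (Tot-++ l g (gain⁰ m c f)) ⟩
    g ! * Tot l fibre
      ≤⟨ *-monoʳ-≤ (g !) (≤-trans (Tot-last c fibre late) (+-mono-≤ (≤-trans fibre-o (+-monoʳ-≤ (∑ m (L o)) top)) fibre-e)) ⟩
    g ! * (∑ m (L o) + D * L e μ + ∑ m (L e))
      ≡⟨ unprefixed-size₂ (g !) (∑ m (L o)) D (L e μ) (∑ m (L e)) ⟩
    g ! * ∑ m (L o) + D * (g ! * L e μ) + g ! * ∑ m (L e)
      ≤⟨ +-mono-≤ (+-mono-≤ (≤-trans (low-levels M o μ μ≤g) (*-monoʳ-≤ (∑ m (binom g)) (hits-mono M o≤e ≤-refl μ≤g)))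
                            (≤-reflexive (cong (D *_) (sym (binom-den g μ _)))))
                  (low-levels M e μ μ≤g) ⟩
    (∑ μ (binom g) + B) * He + D * (B * He) + (∑ μ (binom g) + B) * He
      ≡⟨ unprefixed-size₃ (∑ μ (binom g)) B He D ⟩
    2 * ∑ μ (binom g) * He + (D * (B * He) + 2 * (B * He))
      ≤⟨ +-monoˡ-≤ (D * (B * He) + 2 * (B * He)) (*-monoˡ-≤ He below) ⟩
    B * He + (D * (B * He) + 2 * (B * He))
      ≡⟨ unprefixed-ring₁ D B He ⟩
    (D + 3) * (B * He) ∎

-- Large s: the two alternatives combined

search-vectors : ∀ n (p : Vec Bool n → Bool) → (Σ (Vec Bool n) λ v → p v ≡ true) ⊎ (∀ v → p v ≡ false)
search-vectors zero    p with p [] in e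
... | true  = inj₁ ([] , e)
... | false = inj₂ (λ { [] → e })
search-vectors (suc n) p with search-vectors n (p ∘ (false ∷_)) | search-vectors n (p ∘ (true ∷_))
... | inj₁ (v , e) | _            = inj₁ (false ∷ v , e)
... | inj₂ _       | inj₁ (v , e) = inj₁ (true ∷ v , e)
... | inj₂ h₀      | inj₂ h₁      = inj₂ (λ { (false ∷ v) → h₀ v ; (true ∷ v) → h₁ v })

pre-mono : ∀ {n} (v : Vec Bool n) {a b} → a ≤ b → pre a v ≤ pre b v
pre-mono v       z≤n       = z≤n
pre-mono []      (s≤s a≤b) = z≤n
pre-mono (x ∷ v) (s≤s a≤b) = +-monoʳ-≤ (ι x) (pre-mono v a≤b)

≡ᵇ-sound : ∀ a b → (a ≡ᵇ b) ≡ true → a ≡ b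
≡ᵇ-sound a b h = ≡ᵇ⇒≡ a b (subst Bool.T (sym h) _)

large-size₁ : ∀ l d μ → (l + d) * suc μ + d ≡ l + (l * μ + d * suc (suc μ))
large-size₁ = solve-∀

large-size₂ : ∀ c d μ → (suc c + d) * suc μ + d ≡ c + (c * μ + suc μ + d * suc (suc μ))
large-size₂ = solve-∀

large-size₃ : ∀ c u z → let l = 3 + c; m = 2 + u; d = l * m + 2 * l + 3 + z in d + d
    ≡ (l + d + 1) + (11 + 3 * c + 3 * u + z + c * u)
large-size₃ = solve-∀

large-size₄ : ∀ c u z → let l = 3 + c; m = 2 + u; d = l * m + 2 * l + 3 + z in
  l * (1 + u) + d * suc m ≡ ((2 + (l + d)) * m + (1 + u)) + (7 + 3 * c + z + c * u)
large-size₄ = solve-∀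

large-size₅ : ∀ c u z → let l = 3 + c; m = 2 + u; d = l * m + 2 * l + 3 + z in l * (1 + u) + d * suc m
    ≡ (d * suc m + m) + (1 + c + 2 * u + c * u)
large-size₅ = solve-∀

large-size₆ : ∀ c u z → let l = 3 + c; m = 2 + u in l * m + 2 * l + 3 + z
    ≡ ((2 + c) + (1 + u)) + (12 + 3 * c + 2 * u + z + c * u)
large-size₆ = solve-∀

large-size₇ : ∀ c u → (2 + c) * (2 + u) ≡ 3 + c + (1 + c + 2 * u + c * u)
large-size₇ = solve-∀

large-size₈ : ∀ c u z → let l = 3 + c; m = 2 + u in suc (l * m + 2 * l + 3 + z)
    ≡ (2 * (2 + c) + ((1 + c + 2 * u + c * u) + 3)) + (8 + c + u + z)
large-size₈ = solve-∀

large-size₉ : ∀ c u z → let l = 3 + c; m = 2 + u in l * m + 2 * l + 3 + z ≡ 3 + (12 + 4 * c + 3 * u + z + c * u)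
large-size₉ = solve-∀

-- If a member of size m avoids the first c m points, compression moves it onto each of the first l blocks of
-- m points.  Otherwise the least element of an m-set takes few values, so F has few m-sets that avoid [l].
large-case : ∀ c₀ u z n f → let c = 2 + c₀; l = suc c; m = 2 + u; d = l * m + 2 * l + 3 + z in
  n ≡ (l + d) * m + d → Matchless n (l + d) f → Tot n (λ v → ι (f v)) ≤ Tot n (λ v → ι (heavy m c v))
large-case c₀ u z n f₀ n≡ M₀ with compress f₀ M₀
... | f , M , S , size = subst (_≤ Tot n (λ v → ι (heavy m c v))) (sym size) (cases (search-vectors n far))
  where
  open ≤-Reasoning
  c = 2 + c₀
  l = suc c
  μ = suc u
  m = suc μ
  d = l * m + 2 * l + 3 + z
  -- This is c m - l, the number of possible least elements of a member of size m that avoids [l]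
  -- but meets the first c m points.
  D = 1 + c₀ + 2 * u + c₀ * u
  far : Vec Bool n → Bool
  far v = f v ∧ ((wt v ≡ᵇ m) ∧ (pre (c * m) v ≡ᵇ 0))
  dense : ∀ n f → n ≡ l * m + d * suc m → Matchless n (l + d) f → (∀ i → i < l → f (tab n (interval (i * m) m)) ≡ true) →
    Tot n (λ v → ι (f v)) ≤ Tot n (λ v → ι (heavy m c v))
  dense n f refl = dense-case c (suc u) z f
  excess : suc d * Tot n (gain m c f) ≤ suc d * Tot n (loss m c f) → Tot n (λ v → ι (f v)) ≤ Tot n (λ v → ι (heavy m c v))
  excess h = exchange n m c f (*-cancelˡ-≤ (suc d) h)
  cases : (Σ (Vec Bool n) λ v → far v ≡ true) ⊎ (∀ v → far v ≡ false) → Tot n (λ v → ι (f v)) ≤ Tot n (λ v → ι (heavy m c v))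
  cases (inj₁ (v , h)) with ∧-true {f v} h
  ... | fv , h′ with ∧-true {wt v ≡ᵇ m} h′
  ...   | w , p = dense n f (trans n≡ (dense-size₁ l d m)) M
      (λ i i<l → subst (λ k → f (tab n (interval (i * m) k)) ≡ true) (≡ᵇ-sound (wt v) m w)
    (sort-after S (i * m) v (n≤0⇒n≡0
        (≤-trans (pre-mono v (*-monoˡ-≤ m (≤-pred i<l))) (≤-reflexive (≡ᵇ-sound (pre (c * m) v) 0 p)))) fv))
  cases (inj₂ none) = excess (begin
    suc d * Tot n (gain m c f) ≡⟨ cong (suc d *_) (gain-split n m c f) ⟩
    suc d * (Tot n (gain⁺ m c f) + Tot n (gain⁰ m c f)) ≡⟨ *-distribˡ-+ (suc d) (Tot n (gain⁺ m c f)) _ ⟩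
    suc d * Tot n (gain⁺ m c f) + suc d * Tot n (gain⁰ m c f)
      ≤⟨ +-mono-≤ (≤-trans (*-monoˡ-≤ (Tot n (gain⁺ m c f)) (s≤s (m≤n+m d (suc c₀))))
           (prefixed-gain (suc c₀) d μ n f (trans n≡ (large-size₂ c d μ)) (≤-by _ (large-size₆ c₀ u z)) M))
         (unprefixed-gain c d μ D n f (trans n≡ (large-size₁ l d μ)) M S (large-size₇ c₀ u) early
             (≤-by _ (large-size₃ c₀ u z)) (≤-by _ (large-size₄ c₀ u z)) (≤-by _ (large-size₅ c₀ u z))
                 (≤-by _ (large-size₉ c₀ u z))) ⟩
    2 * c * Tot n (loss m c f) + (D + 3) * Tot n (loss m c f) ≡⟨ sym (*-distribʳ-+ (Tot n (loss m c f)) (2 * c) (D + 3)) ⟩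
    (2 * c + (D + 3)) * Tot n (loss m c f) ≤⟨ *-monoˡ-≤ (Tot n (loss m c f)) coefficients ⟩
    suc d * Tot n (loss m c f) ∎)
    where
    coefficients : 2 * c + (D + 3) ≤ suc d
    coefficients = ≤-by _ (large-size₈ c₀ u z)
    early : ∀ v → wt v ≡ m → pre (c * m) v ≡ 0 → f v ≡ false
    early v w p with f v in e
    ... | false = refl
    ... | true  = false≢true (trans (sym (none v)) (trans (cong (_∧ ((wt v ≡ᵇ m) ∧ (pre (c * m) v ≡ᵇ 0))) e)
        (trans (cong₂ (λ a b → (a ≡ᵇ m) ∧ (b ≡ᵇ 0)) w p) (cong (_∧ true) (≡ᵇ-refl m)))))
      where
      ≡ᵇ-refl : ∀ m → (m ≡ᵇ m) ≡ true
      ≡ᵇ-refl zero    = refl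
      ≡ᵇ-refl (suc m) = ≡ᵇ-refl m

-- Families as lists

card-wt : ∀ {n} (v : Subset n) → ∣ v ∣ ≡ wt v
card-wt []          = refl
card-wt (true ∷ v)  = cong suc (card-wt v)
card-wt (false ∷ v) = card-wt v

card-initSeg : ∀ c {n} (v : Subset n) → ∣ v ∩ initSeg n (suc c) ∣ ≡ pre c v
card-initSeg zero    []          = refl
card-initSeg zero    (true ∷ v)  = card-initSeg zero v
card-initSeg zero    (false ∷ v) = card-initSeg zero v
card-initSeg (suc c) []          = refl
card-initSeg (suc c) (true ∷ v)  = cong suc (card-initSeg c v)
card-initSeg (suc c) (false ∷ v) = card-initSeg c v

apart-empty : ∀ {n} {u v : Subset n} → Pointwise Apart u v → Empty (u ∩ v)
apart-empty {u = u} {v} aps (x , x∈) = clash aps x (proj₁ (x∈p∩q⁻ u v x∈)) (proj₂ (x∈p∩q⁻ u v x∈))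
  where
  clash : ∀ {n} {u v : Subset n} → Pointwise Apart u v → ∀ x → x ∈ u → x ∈ v → ⊥
  clash (ap ∷ _)  _ here        here        = ap refl refl
  clash (_ ∷ aps) _ (there x∈u) (there x∈v) = clash aps _ x∈u x∈v

empty-apart : ∀ {n} {u v : Subset n} → Empty (u ∩ v) → Pointwise Apart u v
empty-apart {u = []}    {[]}    _ = []
empty-apart {u = _ ∷ _} {_ ∷ _} e =
  (λ { refl refl → e (Fin.zero , here) }) ∷ empty-apart (λ { (x , x∈) → e (Fin.suc x , there x∈) })

apart-sym : ∀ {n} {u v : Subset n} → Pointwise Apart u v → Pointwise Apart v u
apart-sym []         = []
apart-sym (ap ∷ aps) = (λ a b → ap b a) ∷ apart-sym aps

indicator : ∀ {n} → Vec Bool n → Vec Bool n → ℕ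
indicator []          []          = 1
indicator (true ∷ u)  (true ∷ v)  = indicator u v
indicator (false ∷ u) (false ∷ v) = indicator u v
indicator (_ ∷ u)     (_ ∷ v)     = 0

Tot-indicator : ∀ {n} (u : Vec Bool n) → Tot n (indicator u) ≡ 1
Tot-indicator []                    = refl
Tot-indicator {suc n} (true ∷ u)  = cong₂ _+_ (Tot-zero n (λ _ → refl)) (Tot-indicator u)
Tot-indicator {suc n} (false ∷ u) = cong₂ _+_ (Tot-indicator u) (Tot-zero n (λ _ → refl))

indicator-diagonal : ∀ {n} (u v : Vec Bool n) → indicator u v ≡ 0 ⊎ (u ≡ v × indicator u v ≡ 1)
indicator-diagonal []          []          = inj₂ (refl , refl)
indicator-diagonal (true ∷ u)  (false ∷ v) = inj₁ refl
indicator-diagonal (false ∷ u) (true ∷ v)  = inj₁ refl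
indicator-diagonal (true ∷ u)  (true ∷ v) with indicator-diagonal u v
... | inj₁ e       = inj₁ e
... | inj₂ (p , e) = inj₂ (cong (true ∷_) p , e)
indicator-diagonal (false ∷ u) (false ∷ v) with indicator-diagonal u v
... | inj₁ e       = inj₁ e
... | inj₂ (p , e) = inj₂ (cong (false ∷_) p , e)

occurrences : ∀ {n} → List (Subset n) → Subset n → ℕ
occurrences []      v = 0
occurrences (u ∷ F) v = indicator u v + occurrences F v

Tot-occurrences : ∀ {n} (F : List (Subset n)) → Tot n (occurrences F) ≡ length F
Tot-occurrences {n} []      = Tot-zero n (λ _ → refl)
Tot-occurrences {n} (u ∷ F) = trans (Tot-+ n (indicator u) (occurrences F)) (cong₂ _+_ (Tot-indicator u) (Tot-occurrences F))

occurrences-absent : ∀ {n} (F : List (Subset n)) v → ¬ (v LM.∈ F) → occurrences F v ≡ 0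
occurrences-absent []      v _   = refl
occurrences-absent (u ∷ F) v v∉F with indicator-diagonal u v
... | inj₁ e       = cong₂ _+_ e (occurrences-absent F v (v∉F ∘ there))
... | inj₂ (p , _) = ⊥-elim (v∉F (here (sym p)))

length≤Tot : ∀ {n} (F : List (Subset n)) → Unique F → (f : Vec Bool n → Bool) → (∀ v → v LM.∈ F → f v ≡ true) →
  length F ≤ Tot n (λ v → ι (f v))
length≤Tot {n} F unique f F⊆f = subst (_≤ Tot n (λ v → ι (f v))) (Tot-occurrences F) (Tot-mono n (once F unique F⊆f))
  where
  once : ∀ F → Unique F → (∀ v → v LM.∈ F → f v ≡ true) → ∀ v → occurrences F v ≤ ι (f v)
  once []      _          F⊆f v = z≤n
  once (u ∷ F) (u∉F ∷ uF) F⊆f v with indicator-diagonal u v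
  ... | inj₁ e           = ≤-trans (≤-reflexive (cong (_+ occurrences F v) e)) (once F uF (λ w w∈ → F⊆f w (there w∈)) v)
  ... | inj₂ (refl , e) = ≤-reflexive (trans (cong₂ _+_ e (occurrences-absent F u (λ u∈F → All.lookup u∉F u∈F refl)))
                            (cong ι (sym (F⊆f u (here refl)))))

length-filter-map : ∀ {n} {p} {P : Pred (Subset (suc n)) p} (P? : Decidable P) b (F : List (Subset n)) →
  length (filter P? (map (b ∷_) F)) ≡ length (filter (λ v → P? (b ∷ v)) F)
length-filter-map P? b []      = refl
length-filter-map P? b (v ∷ F) with does (P? (b ∷ v))
... | true  = cong suc (length-filter-map P? b F)
... | false = length-filter-map P? b F

length-filter : ∀ n {p} {P : Pred (Subset n) p} (P? : Decidable P) →
  length (filter P? (allSubsets n)) ≡ Tot n (λ v → ι (does (P? v)))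
length-filter zero    P? with does (P? [])
... | true  = refl
... | false = refl
length-filter (suc n) P? = begin
  length (filter P? (map (false ∷_) (allSubsets n) List.++ map (true ∷_) (allSubsets n)))
    ≡⟨ cong length (filter-++ P? (map (false ∷_) (allSubsets n)) (map (true ∷_) (allSubsets n))) ⟩
  length (filter P? (map (false ∷_) (allSubsets n)) List.++ filter P? (map (true ∷_) (allSubsets n)))
    ≡⟨ length-++ (filter P? (map (false ∷_) (allSubsets n))) ⟩
  length (filter P? (map (false ∷_) (allSubsets n))) + length (filter P? (map (true ∷_) (allSubsets n)))
    ≡⟨ cong₂ _+_ (trans (length-filter-map P? false (allSubsets n)) (length-filter n (λ v → P? (false ∷ v))))
                 (trans (length-filter-map P? true (allSubsets n)) (length-filter n (λ v → P? (true ∷ v)))) ⟩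
  Tot (suc n) (λ v → ι (does (P? v))) ∎
  where open ≡-Reasoning

allSubsets-unique : ∀ n → Unique (allSubsets n)
allSubsets-unique zero    = All.[] ∷ []
allSubsets-unique (suc n) = unique-++ (map⁺ ∷-injectiveʳ (allSubsets-unique n)) (map⁺ ∷-injectiveʳ (allSubsets-unique n))
  (λ { (x∈₀ , x∈₁) → heads (∈-map⁻ (false ∷_) x∈₀) (∈-map⁻ (true ∷_) x∈₁) })
  where
  heads : ∀ {x : Subset (suc n)} → Σ (Subset n) (λ v → v LM.∈ allSubsets n × x ≡ false ∷ v) →
    Σ (Subset n) (λ v → v LM.∈ allSubsets n × x ≡ true ∷ v) → ⊥
  heads (_ , _ , refl) (_ , _ , ())

at-most-one : ∀ s (b : ℕ → Bool) → (∀ i j → i < j → j < s → b i ≡ true → b j ≡ true → ⊥) → ∑ s (λ i → ι (b i)) ≤ 1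
at-most-one zero    b h = z≤n
at-most-one (suc s) b h with b s in e
... | false = ≤-trans (≤-reflexive (+-identityʳ _)) (at-most-one s b (λ i j i<j j<s → h i j i<j (m<n⇒m<1+n j<s)))
... | true  = ≤-reflexive (cong (_+ 1) (∑-zero s (λ i i<s → none i i<s)))
  where
  none : ∀ i → i < s → ι (b i) ≡ 0
  none i i<s with b i in e′
  ... | false = refl
  ... | true  = ⊥-elim (h i s i<s ≤-refl e′ e)

tail-apart : ∀ {n} {u v : Vec Bool (suc n)} → Pointwise Apart u v → Pointwise Apart (Vec.tail u) (Vec.tail v)
tail-apart (_ ∷ aps) = aps

head-apart : ∀ {n} {u v : Vec Bool (suc n)} → Pointwise Apart u v → Apart (Vec.head u) (Vec.head v)
head-apart (ap ∷ _) = ap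

-- Each coordinate belongs to at most one of the sets.
disjoint-weights : ∀ n c s (G : ℕ → Vec Bool n) → (∀ i j → i < j → j < s → Pointwise Apart (G i) (G j)) →
  ∑ s (λ i → wt (G i)) ≤ n × ∑ s (λ i → pre c (G i)) ≤ c
disjoint-weights zero    c s G h = ≤-reflexive (∑-zero s (λ i _ → wt-nil (G i))) , ≤-trans
    (≤-reflexive (∑-zero s (λ i _ → pre-nil c (G i)))) z≤n
  where
  wt-nil : (v : Vec Bool 0) → wt v ≡ 0
  wt-nil [] = refl
  pre-nil : ∀ c (v : Vec Bool 0) → pre c v ≡ 0
  pre-nil zero    [] = refl
  pre-nil (suc c) [] = refl
disjoint-weights (suc n) c s G h = total , prefix c
  where
  H : ℕ → Vec Bool n
  H i = Vec.tail (G i)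
  b : ℕ → Bool
  b i = Vec.head (G i)
  H-apart : ∀ i j → i < j → j < s → Pointwise Apart (H i) (H j)
  H-apart i j i<j j<s = tail-apart (h i j i<j j<s)
  heads : ∑ s (λ i → ι (b i)) ≤ 1
  heads = at-most-one s b (λ i j i<j j<s → head-apart (h i j i<j j<s))
  wt-split : (v : Vec Bool (suc n)) → wt v ≡ ι (Vec.head v) + wt (Vec.tail v)
  wt-split (_ ∷ _) = refl
  pre-split : ∀ c (v : Vec Bool (suc n)) → pre (suc c) v ≡ ι (Vec.head v) + pre c (Vec.tail v)
  pre-split c (_ ∷ _) = refl
  total : ∑ s (λ i → wt (G i)) ≤ suc n
  total = ≤-trans (≤-reflexive (trans (∑-cong s (λ i _ → wt-split (G i))) (∑-+ s (λ i → ι (b i)) (λ i → wt (H i)))))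
    (+-mono-≤ heads (proj₁ (disjoint-weights n 0 s H H-apart)))
  prefix : ∀ c → ∑ s (λ i → pre c (G i)) ≤ c
  prefix zero    = ≤-reflexive (∑-zero s (λ i _ → refl))
  prefix (suc c) = ≤-trans (≤-reflexive
      (trans (∑-cong s (λ i _ → pre-split c (G i))) (∑-+ s (λ i → ι (b i)) (λ i → pre c (H i)))))
    (+-mono-≤ heads (proj₂ (disjoint-weights n c s H H-apart)))

extend : ∀ {n s} → (Fin s → Subset n) → ℕ → Subset n
extend {n} {s} G i with i <? s
... | yes i<s = G (fromℕ< i<s)
... | no  _   = empty n

extend-< : ∀ {n s} (G : Fin s → Subset n) i (i<s : i < s) → extend G i ≡ G (fromℕ< i<s)
extend-< {s = s} G i i<s with i <? s
... | yes i<s′ = cong G (fromℕ<-cong i i refl i<s′ i<s)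
... | no  i≮s  = ⊥-elim (i≮s i<s)

-- The weights of s members add up to at least s (m + 1). Disjoint sets have total weight at most n
-- + c, as the points of [c] count twice, and this is s (m + 1) - 1.
PFam-matching : ∀ s m c → suc c ≤ s → NuLess (PFam s m (suc c)) s
PFam-matching s m c l≤s (G , G∈P , G-disjoint) = <⇒≱ too-small (begin
  s * suc m ≡⟨ sym (∑-const s (suc m)) ⟩
  ∑ s (λ _ → suc m) ≤⟨ ∑-mono s weight ⟩
  ∑ s (λ i → wt (H i) + pre c (H i)) ≡⟨ ∑-+ s (λ i → wt (H i)) (λ i → pre c (H i)) ⟩
  ∑ s (λ i → wt (H i)) + ∑ s (λ i → pre c (H i)) ≤⟨ +-mono-≤ (proj₁ sums) (proj₂ sums) ⟩
  n + c ∎)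
  where
  open ≤-Reasoning
  n = s * m + (s ∸ suc c)
  H : ℕ → Subset n
  H = extend G
  too-small : n + c < s * suc m
  too-small = ≤-reflexive (trans (sym (+-suc n c)) (trans (+-assoc (s * m) (s ∸ suc c) (suc c))
    (trans (cong (s * m +_) (m∸n+n≡m l≤s)) (trans (+-comm (s * m) s) (sym (*-suc s m))))))
  weight : ∀ i → i < s → suc m ≤ wt (H i) + pre c (H i)
  weight i i<s rewrite extend-< G i i<s = subst (suc m ≤_)
    (cong₂ _+_ (card-wt (G (fromℕ< i<s))) (card-initSeg c (G (fromℕ< i<s))))
    (proj₂ (∈-filter⁻ (λ P → suc m ≤? ∣ P ∣ + ∣ P ∩ initSeg n (suc c) ∣) {xs = allSubsets n} (G∈P (fromℕ< i<s))))
  H-apart : ∀ i j → i < j → j < s → Pointwise Apart (H i) (H j)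
  H-apart i j i<j j<s rewrite extend-< G i (<-trans i<j j<s) | extend-< G j j<s =
    empty-apart (G-disjoint _ _ (λ e → <⇒≢ i<j (fromℕ<-injective i j (<-trans i<j j<s) j<s e)))
  sums = disjoint-weights n c s H H-apart

-- The up-closure of a list

contained : ∀ {n} → Vec Bool n → Vec Bool n → Bool
contained []      []      = true
contained (a ∷ u) (b ∷ v) = (not a ∨ b) ∧ contained u v

contained-refl : ∀ {n} (u : Vec Bool n) → contained u u ≡ true
contained-refl []          = refl
contained-refl (true ∷ u)  = contained-refl u
contained-refl (false ∷ u) = contained-refl u

contained-sound : ∀ {n} (u v : Vec Bool n) → contained u v ≡ true → Pointwise Below u v
contained-sound []      []      _ = []
contained-sound (a ∷ u) (b ∷ v) e with ∧-true {not a ∨ b} e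
... | e₁ , e₂ = (λ { refl → e₁ }) ∷ contained-sound u v e₂

contained-complete : ∀ {n} {u v : Vec Bool n} → Pointwise Below u v → contained u v ≡ true
contained-complete []                     = refl
contained-complete (_∷_ {x = true}  h hs) rewrite h refl = contained-complete hs
contained-complete (_∷_ {x = false} h hs) = contained-complete hs

below-trans : ∀ {n} {u v w : Vec Bool n} → Pointwise Below u v → Pointwise Below v w → Pointwise Below u w
below-trans []       []         = []
below-trans (h ∷ hs) (h′ ∷ hs′) = (λ e → h′ (h e)) ∷ below-trans hs hs′

below-apart : ∀ {n} {u v u′ v′ : Vec Bool n} → Pointwise Below u u′ → Pointwise Below v v′ →
  Pointwise Apart u′ v′ → Pointwise Apart u v
below-apart []       []         []         = []
below-apart (h ∷ hs) (h′ ∷ hs′) (ap ∷ aps) = (λ e e′ → ap (h e) (h′ e′)) ∷ below-apart hs hs′ aps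

closure : ∀ {n} → List (Subset n) → Vec Bool n → Bool
closure F v = any (λ u → contained u v) F

closure-sound : ∀ {n} (F : List (Subset n)) v → closure F v ≡ true → Σ (Subset n) λ u → u LM.∈ F × Pointwise Below u v
closure-sound (u ∷ F) v e with ∨-true {contained u v} e
... | inj₁ e₁ = u , here refl , contained-sound u v e₁
... | inj₂ e₂ with closure-sound F v e₂
...   | w , w∈F , w≤v = w , there w∈F , w≤v

closure-complete : ∀ {n} {F : List (Subset n)} {u} v → u LM.∈ F → Pointwise Below u v → closure F v ≡ true
closure-complete {F = w ∷ F} v (here refl) u≤v = ∨-left (closure F v) (contained-complete u≤v)
closure-complete {F = w ∷ F} v (there u∈F) u≤v = ∨-right (contained w v) (closure-complete v u∈F u≤v)

-- Each set of a matching in the closure shrinks to a member of F inside it, and shrinking preserves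
-- disjointness.
closure-matchless : ∀ {n s} (F : List (Subset n)) → NuLess F s → Matchless n s (closure F)
closure-matchless {n} {s} F ν = record { upward = up ; matching = match }
  where
  up : ∀ {u v} → Pointwise Below u v → closure F u ≡ true → closure F v ≡ true
  up {u} {v} u≤v e with closure-sound F u e
  ... | w , w∈F , w≤u = closure-complete v w∈F (below-trans w≤u u≤v)
  match : (G : ℕ → Vec Bool n) → (∀ i j → i < j → j < s → Pointwise Apart (G i) (G j)) →
    (∀ i → i < s → closure F (G i) ≡ true) → ⊥
  match G apart members = ν (H , (λ i → proj₁ (proj₂ (pick i))) , disjoint)
    where
    pick : (i : Fin s) → Σ (Subset n) λ u → u LM.∈ F × Pointwise Below u (G (toℕ i))
    pick i = closure-sound F (G (toℕ i)) (members (toℕ i) (toℕ<n i))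
    H : Fin s → Subset n
    H i = proj₁ (pick i)
    disjoint : (i j : Fin s) → i ≢ j → Empty (H i ∩ H j)
    disjoint i j i≢j with <-cmp (toℕ i) (toℕ j)
    ... | tri< i<j _ _ = apart-empty (below-apart (proj₂ (proj₂ (pick i))) (proj₂ (proj₂ (pick j))) (apart _ _ i<j (toℕ<n j)))
    ... | tri≈ _ e _   = ⊥-elim (i≢j (toℕ-injective e))
    ... | tri> _ _ j<i = apart-empty
        (apart-sym (below-apart (proj₂ (proj₂ (pick j))) (proj₂ (proj₂ (pick i))) (apart _ _ j<i (toℕ<n i))))

-- The cases of the theorem

UpperBound : ℕ → ℕ → ℕ → ℕ → Set
UpperBound n s m c = ∀ f → Matchless n s f → Tot n (λ v → ι (f v)) ≤ Tot n (λ v → ι (heavy m c v))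

length-PFam : ∀ s m c → length (PFam s m (suc c)) ≡ Tot (s * m + (s ∸ suc c)) (λ v → ι (heavy m c v))
length-PFam s m c = trans (length-filter n (λ P → suc m ≤? ∣ P ∣ + ∣ P ∩ initSeg n (suc c) ∣))
  (Tot-cong n (λ v → cong (λ w → ι (m <ᵇ w)) (cong₂ _+_ (card-wt v) (card-initSeg c v))))
  where n = s * m + (s ∸ suc c)

extremal : ∀ s m c → suc c ≤ s → UpperBound (s * m + (s ∸ suc c)) s m c →
  IsE (s * m + (s ∸ suc c)) s (length (PFam s m (suc c)))
extremal s m c l≤s bound =
  (PFam s m (suc c) , filter⁺ _ (allSubsets-unique _) , PFam-matching s m c l≤s , refl) ,
  (λ F unique ν → subst (length F ≤_) (sym (length-PFam s m c))
    (≤-trans (length≤Tot F unique (closure F) (λ v v∈F → closure-complete v v∈F (below-refl v)))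
             (bound (closure F) (closure-matchless F ν))))

case-size₁ : ∀ c m z → let l = suc c in l * m + 3 * l + 3 + z ≡ l + (l * m + 2 * l + 3 + z)
case-size₁ = solve-∀

case-size₂ : ∀ μ z → 1 * suc μ + 3 * 1 + 3 + z ≡ 1 + suc (suc (4 + (μ + z)))
case-size₂ = solve-∀

case-size₃ : ∀ μ z → 2 * suc μ + 3 * 2 + 3 + z ≡ 2 + suc (suc (suc (6 + 2 * μ + z)))
case-size₃ = solve-∀

ones-bound : ∀ c d → UpperBound ((suc c + d) * 1 + d) (suc c + d) 1 c
ones-bound c d = subst (λ n → UpperBound n (suc c + d) 1 c) (cong (_+ d) (sym (*-identityʳ (suc c + d)))) (pairs-case c d)

-- For l = 1 and l = 2 condition (iii) gives s ≥ 7 and s ≥ 11, so these values are covered by the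
-- special arguments, as is m = 1. There remain l ≥ 3 and m ≥ 2.
large-bound : ∀ c μ d z → suc c + d
    ≡ suc c * suc μ + 3 * suc c + 3 + z → UpperBound ((suc c + d) * suc μ + d) (suc c + d) (suc μ) c
large-bound zero          μ       d z eq with +-cancelˡ-≡ 1 d _ (trans eq (case-size₂ μ z))
... | refl = kleitman (μ + z) μ
large-bound (suc zero)    μ       d z eq with +-cancelˡ-≡ 2 d _ (trans eq (case-size₃ μ z))
... | refl = λ f → two-special (suc (6 + 2 * μ + z)) μ f (inj₁ (s≤s z≤n))
large-bound (suc (suc c)) zero    d z eq = ones-bound (suc (suc c)) d
large-bound (suc (suc c)) (suc u) d z eq with +-cancelˡ-≡ (suc (suc (suc c))) d _
    (trans eq (case-size₁ (suc (suc c)) (suc (suc u)) z))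
... | refl = λ f → large-case c u z _ f refl

bound : ∀ c μ d → Cases (suc c + d) (suc μ) (suc c) → UpperBound ((suc c + d) * suc μ + d) (suc c + d) (suc μ) c
bound c μ (suc (suc (suc e))) (inj₁ (refl , _)) = λ f → two-special (suc e) μ f (inj₁ (s≤s z≤n))
bound c μ (suc (suc zero)) (inj₁ (refl , s≤s (s≤s (s≤s (s≤s ())))))
bound c μ (suc zero) (inj₁ (refl , s≤s (s≤s (s≤s ()))))
bound c μ zero (inj₁ (refl , s≤s (s≤s ())))
bound c μ d (inj₂ (inj₁ (refl , refl , even))) = λ f → two-special 0 μ f (inj₂ (refl , even))
bound c μ d (inj₂ (inj₂ (inj₁ refl)))          = ones-bound c d
bound c μ d (inj₂ (inj₂ (inj₂ h))) with ≤⇒∃ h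
... | z , eq = large-bound c μ d z eq

theorem1 : (s m l : ℕ) → 2 ≤ s → 1 ≤ m → 1 ≤ l → l ≤ s → Cases s m l →
    IsE (s * m + (s ∸ l)) s (length (PFam s m l))
theorem1 s (suc μ) (suc c) _ _ _ l≤s cases with ≤⇒∃ l≤s
... | d , refl = extremal (suc c + d) (suc μ) c l≤s
  (subst (λ x → UpperBound ((suc c + d) * suc μ + x) (suc c + d) (suc μ) c) (sym (m+n∸m≡n (suc c) d)) (bound c μ d cases))
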